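{- Let $\mathrm S$ be a dependent type theory admitting all the rules of two-dimensional type theory $\mathrm{ML}_2$. For each context $\Gamma$ and type $\Gamma\vdash A\ \mathsf{type}$ of $\mathrm S$, the weakening $2$-functor $\Delta_A:=\mathfrak T_{\mathrm S}(\pi_A)\colon\mathfrak T_{\mathrm S}(\Gamma)\to\mathfrak T_{\mathrm S}(\Gamma.A)$ has a left retract biadjoint $\Sigma_A$.
   Context: **Type theory.** $\mathrm S$ has judgement forms $A\ \mathsf{type}$, $a:A$, $A=B\ \mathsf{type}$, $a=b:A$ (definitional equality), relative to contexts $\Gamma=(x_1:A_1,\dots,x_n:A_n)$ with $A_i$ a type in context $(x_1:A_1,\dots,x_{i-1}:A_{i-1})$; equality rules (definitional equality is a congruence) and structural rules (weakening, contraction, exchange, substitution). All rules are relative to an arbitrary ambient context, and all operations are stable under substitution in it. Rules of $\mathrm{ML}_2$: - $\Sigma$: from $A$ and $x:A\vdash B(x)$ form $\Sigma(A,B)$; from $a:A$, $b:B(a)$ get $\langle a,b\rangle:\Sigma(A,B)$; from $z:\Sigma(A,B)\vdash C(z)\ \mathsf{type}$ and $x:A,y:B(x)\vdash d(x,y):C(\langle x,y\rangle)$ get $z:\Sigma(A,B)\vdash \mathrm E_d(z):C(z)$ with $\mathrm E_d(\langle x,y\rangle)=d(x,y)$. - Unit: $\mathbf 1\ \mathsf{type}$; $\star:\mathbf 1$; from $z:\mathbf 1\vdash C(z)\ \mathsf{type}$ and $d:C(\star)$ get $z:\mathbf 1\vdash\mathrm U_d(z):C(z)$ with $\mathrm U_d(\star)=d$.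 - Identity: from $a,b:A$ form $\mathrm{Id}_A(a,b)$; $\mathrm r(a):\mathrm{Id}_A(a,a)$; from $x,y:A,p:\mathrm{Id}_A(x,y)\vdash C(x,y,p)\ \mathsf{type}$ and $x:A\vdash d(x):C(x,x,\mathrm r(x))$ get $x,y:A,p:\mathrm{Id}_A(x,y)\vdash\mathrm J_d(x,y,p):C(x,y,p)$ with $\mathrm J_d(x,x,\mathrm r(x))=d(x)$. - $\Pi$: form $\Pi(A,B)$; from $x:A\vdash f(x):B(x)$ get $\lambda f:\Pi(A,B)$; from $m:\Pi(A,B)$ get $y:A\vdash m\cdot y:B(y)$; $(\lambda f)\cdot y=f(y)$. - Discrete identity types: if $p,q:\mathrm{Id}_A(a,b)$ and $\alpha:\mathrm{Id}(p,q)$ then $p=q$ and $\alpha=\mathrm r(p)$. - Function extensionality: from $m,n:\Pi(A,B)$ and $x:A\vdash p(x):\mathrm{Id}(m\cdot x,n\cdot x)$ get $\mathsf{ext}(m,n,p):\mathrm{Id}(m,n)$; $\mathsf{ext}(m,m,[x]\mathrm r(m\cdot x))=\mathrm r(m)$; $\mathsf{ext}(m,n,p)\ast x=p(x)$, where $p\ast a:=\mathrm J_{[x]\mathrm r(x\cdot a)}(m,n,p)$. By $\Pi$-abstracting over a telescope $\Delta$ one derives extended identity elimination/computation, in which $C$ and the conclusion live in context $x,y:A,p:\mathrm{Id}_A(x,y),\Delta$ and $d$ in context $x:A,\Delta[x,x,\mathrm r(x)/x,y,p]$. Vector notation is used: $x:\Gamma$ stands for a list of variables of the successive types of $\Gamma$.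 **The 2-category $\mathfrak T_{\mathrm S}(\Gamma)$.** (Modulo $\alpha$-conversion and definitional equality.) Objects: types $A$ in context $\Gamma$. 1-cells $A\to B$: judgements $x:\Gamma,y:A(x)\vdash f(x,y):B(x)$, composed by substitution. 2-cells $f\Rightarrow g$: judgements $x:\Gamma,y:A(x)\vdash\alpha(x,y):\mathrm{Id}_{B(x)}(f(x,y),g(x,y))$. For $p:\mathrm{Id}_A(y,y')$, $q:\mathrm{Id}_A(y',y'')$, the composite $q\circ p:\mathrm{Id}_A(y,y'')$ is defined by elimination on $q$ with $\mathrm r(y')\circ p=p$; for $h\colon A\to B$, $h^\bullet(p):\mathrm{Id}_B(hy,hy')$ is defined by elimination on $p$ with $h^\bullet(\mathrm r(y))=\mathrm r(hy)$. Vertical composition of 2-cells is pointwise $\circ$, identities are $\mathrm r(f(x,y))$, whiskering on the right is substitution and on the left is application of $h^\bullet$. $\Gamma.A$ is the context $(x:\Gamma,y:A(x))$, $\pi_A\colon\Gamma.A\to\Gamma$ is its projection, and $\Delta_A=\mathfrak T_{\mathrm S}(\pi_A)$ sends a type, term or identity proof in context $\Gamma$ to the same one weakened to context $\Gamma.A$. **Retract biadjoints.** A functor $P$ is a *surjective equivalence* if there are a functor $I$ with $PI=\mathrm{id}$ and an isomorphism $\theta\colon\mathrm{id}\Rightarrow IP$ with $\theta I=\mathrm{id}_I$, $P\theta=\mathrm{id}_P$. For a 2-functor $U\colon\mathbf K\to\mathbf L$ and $x\in\mathbf L$, a *retract bireflection* of $x$ along $U$ is an object $Fx\in\mathbf K$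 with a morphism $\eta_x\colon x\to UFx$ such that for each $y\in\mathbf K$ the functor $\mathbf K(Fx,y)\to\mathbf L(x,Uy)$, $h\mapsto Uh\circ\eta_x$, is a surjective equivalence of categories. A *left retract biadjoint* for $U$ is a choice, for each $x\in\mathbf L$, of a retract bireflection of $x$ along $U$. -}

module Defs where

open import Data.Fin.Base as Fin using (Fin; zero; suc)
open import Data.List.Base using (List; []; _∷_)
open import Data.Nat.Base using (ℕ; zero; suc; _+_)
open import Data.Sum.Base using (_⊎_; inj₁; inj₂; [_,_]′)
open import Data.Product.Base using (Σ-syntax; _×_; _,_; proj₁; proj₂)
open import Function.Base using (_∘_)
open import Level using (0ℓ)
open import Relation.Binary.Core using (Rel)
open import Relation.Binary.Structures using (IsEquivalence)
open import Relation.Binary.Indexed.Heterogeneous using (IRel; IsIndexedEquivalence)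
open import Relation.Binary.PropositionalEquality.Core
  using (_≡_; refl; sym; trans; cong; cong₂; subst)

-- There are no quotients, so "modulo definitional equality" is rendered
-- by equality relations on objects and on cells of every dimension.  The
-- relation on cells is heterogeneous: equal cells have equal boundaries,
-- and a cell can be moved along an equality of boundaries.  All
-- strictness conditions below are equations for these relations.

record Category : Set₁ where
  infix  4 _≈₀_ _≈₁_ _⟶_
  infixr 9 _∙_
  field
    Obj : Set
    Hom : Obj × Obj → Set

  _⟶_ : Obj → Obj → Set
  a ⟶ b = Hom (a , b)

  field
    _≈₀_ : Rel Obj 0ℓ
    isEquivalence₀ : IsEquivalence _≈₀_
    _≈₁_ : IRel Hom 0ℓ
    isEquivalence₁ : IsIndexedEquivalence Hom _≈₁_
    boundary : ∀ {a b a′ b′} {f : a ⟶ b} {f′ : a′ ⟶ b′} →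
               f ≈₁ f′ → a ≈₀ a′ × b ≈₀ b′
    transport : ∀ {a b a′ b′} → a ≈₀ a′ → b ≈₀ b′ →
                (f : a ⟶ b) → Σ[ f′ ∈ a′ ⟶ b′ ] f ≈₁ f′

    id  : ∀ {a} → a ⟶ a
    _∙_ : ∀ {a b c} → b ⟶ c → a ⟶ b → a ⟶ c

    id-cong : ∀ {a a′} → a ≈₀ a′ → id {a} ≈₁ id {a′}
    ∙-cong  : ∀ {a b c a′ b′ c′}
              {g : b ⟶ c} {f : a ⟶ b} {g′ : b′ ⟶ c′} {f′ : a′ ⟶ b′} →
              g ≈₁ g′ → f ≈₁ f′ → g ∙ f ≈₁ g′ ∙ f′
    identityˡ : ∀ {a b} {f : a ⟶ b} → id ∙ f ≈₁ f
    identityʳ : ∀ {a b} {f : a ⟶ b} → f ∙ id ≈₁ f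
    assoc : ∀ {a b c d} {h : c ⟶ d} {g : b ⟶ c} {f : a ⟶ b} →
            (h ∙ g) ∙ f ≈₁ h ∙ (g ∙ f)

record Functor (C D : Category) : Set where
  private
    module C = Category C
    module D = Category D
  field
    F₀ : C.Obj → D.Obj
    F₁ : ∀ {a b} → a C.⟶ b → F₀ a D.⟶ F₀ b
    F₀-cong : ∀ {a a′} → a C.≈₀ a′ → F₀ a D.≈₀ F₀ a′
    F₁-cong : ∀ {a b a′ b′} {f : a C.⟶ b} {f′ : a′ C.⟶ b′} →
              f C.≈₁ f′ → F₁ f D.≈₁ F₁ f′
    F-id : ∀ {a} → F₁ (C.id {a}) D.≈₁ D.id {F₀ a}
    F-∙  : ∀ {a b c} {g : b C.⟶ c} {f : a C.⟶ b} →
           F₁ (g C.∙ f) D.≈₁ F₁ g D.∙ F₁ f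

-- P ∘ I = id is an equality of functors, so the equations θ I = id_I and
-- P θ = id_P relate morphisms whose boundaries are only equal up to ≈₀.
record SurjectiveEquivalence {C D : Category} (P : Functor C D) : Set where
  private
    module C = Category C
    module D = Category D
    module P = Functor P
  field
    I : Functor D C
  private
    module I = Functor I
  field
    PI-id₀ : ∀ d → P.F₀ (I.F₀ d) D.≈₀ d
    PI-id₁ : ∀ {d e} (f : d D.⟶ e) → P.F₁ (I.F₁ f) D.≈₁ f

    θ   : ∀ c → c C.⟶ I.F₀ (P.F₀ c)
    θ⁻¹ : ∀ c → I.F₀ (P.F₀ c) C.⟶ c
    θ-cong    : ∀ {c c′} → c C.≈₀ c′ → θ c C.≈₁ θ c′
    θ-natural : ∀ {c c′} (f : c C.⟶ c′) →
                I.F₁ (P.F₁ f) C.∙ θ c C.≈₁ θ c′ C.∙ f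
    θ-isoˡ : ∀ c → θ⁻¹ c C.∙ θ c C.≈₁ C.id {c}
    θ-isoʳ : ∀ c → θ c C.∙ θ⁻¹ c C.≈₁ C.id {I.F₀ (P.F₀ c)}

    θI≈id : ∀ d → θ (I.F₀ d) C.≈₁ C.id {I.F₀ d}
    Pθ≈id : ∀ c → P.F₁ (θ c) D.≈₁ D.id {P.F₀ c}

record TwoCategory : Set₁ where
  infix  4 _≈₀_ _≈₁_ _≈₂_ _⟶_ _⇒_
  infixr 9 _∘₁_ _∙_
  infixr 10 _◃_
  infixl 10 _▹_
  field
    Obj : Set
    Hom : Obj × Obj → Set

  _⟶_ : Obj → Obj → Set
  A ⟶ B = Hom (A , B)

  Parallel : Set
  Parallel = Σ[ AB ∈ Obj × Obj ] Hom AB × Hom AB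

  field
    Cell : Parallel → Set

  _⇒_ : ∀ {A B} → A ⟶ B → A ⟶ B → Set
  _⇒_ {A} {B} f g = Cell ((A , B) , f , g)

  field
    _≈₀_ : Rel Obj 0ℓ
    isEquivalence₀ : IsEquivalence _≈₀_
    _≈₁_ : IRel Hom 0ℓ
    isEquivalence₁ : IsIndexedEquivalence Hom _≈₁_
    boundary₁ : ∀ {A B A′ B′} {f : A ⟶ B} {f′ : A′ ⟶ B′} →
                f ≈₁ f′ → A ≈₀ A′ × B ≈₀ B′
    transport₁ : ∀ {A B A′ B′} → A ≈₀ A′ → B ≈₀ B′ →
                 (f : A ⟶ B) → Σ[ f′ ∈ A′ ⟶ B′ ] f ≈₁ f′
    _≈₂_ : IRel Cell 0ℓ
    isEquivalence₂ : IsIndexedEquivalence Cell _≈₂_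
    boundary₂ : ∀ {A B A′ B′} {f g : A ⟶ B} {f′ g′ : A′ ⟶ B′}
                {α : f ⇒ g} {α′ : f′ ⇒ g′} →
                α ≈₂ α′ → f ≈₁ f′ × g ≈₁ g′
    transport₂ : ∀ {A B A′ B′} {f g : A ⟶ B} {f′ g′ : A′ ⟶ B′} →
                 f ≈₁ f′ → g ≈₁ g′ → (α : f ⇒ g) →
                 Σ[ α′ ∈ f′ ⇒ g′ ] α ≈₂ α′

    id₁  : ∀ {A} → A ⟶ A
    _∘₁_ : ∀ {A B C} → B ⟶ C → A ⟶ B → A ⟶ C
    id₂  : ∀ {A B} {f : A ⟶ B} → f ⇒ f
    _∙_  : ∀ {A B} {f g h : A ⟶ B} → g ⇒ h → f ⇒ g → f ⇒ h
    _◃_  : ∀ {A B C} (k : B ⟶ C) {f g : A ⟶ B} → f ⇒ g → k ∘₁ f ⇒ k ∘₁ g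
    _▹_  : ∀ {A B C} {f g : B ⟶ C} → f ⇒ g → (k : A ⟶ B) → f ∘₁ k ⇒ g ∘₁ k

    id₁-cong : ∀ {A A′} → A ≈₀ A′ → id₁ {A} ≈₁ id₁ {A′}
    ∘₁-cong : ∀ {A B C A′ B′ C′}
              {g : B ⟶ C} {f : A ⟶ B} {g′ : B′ ⟶ C′} {f′ : A′ ⟶ B′} →
              g ≈₁ g′ → f ≈₁ f′ → g ∘₁ f ≈₁ g′ ∘₁ f′
    id₂-cong : ∀ {A B A′ B′} {f : A ⟶ B} {f′ : A′ ⟶ B′} →
               f ≈₁ f′ → id₂ {f = f} ≈₂ id₂ {f = f′}
    ∙-cong : ∀ {A B A′ B′} {f g h : A ⟶ B} {f′ g′ h′ : A′ ⟶ B′}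
             {β : g ⇒ h} {α : f ⇒ g} {β′ : g′ ⇒ h′} {α′ : f′ ⇒ g′} →
             β ≈₂ β′ → α ≈₂ α′ → β ∙ α ≈₂ β′ ∙ α′
    ◃-cong : ∀ {A B C A′ B′ C′} {k : B ⟶ C} {f g : A ⟶ B}
             {k′ : B′ ⟶ C′} {f′ g′ : A′ ⟶ B′} {α : f ⇒ g} {α′ : f′ ⇒ g′} →
             k ≈₁ k′ → α ≈₂ α′ → k ◃ α ≈₂ k′ ◃ α′
    ▹-cong : ∀ {A B C A′ B′ C′} {f g : B ⟶ C} {k : A ⟶ B}
             {f′ g′ : B′ ⟶ C′} {k′ : A′ ⟶ B′} {α : f ⇒ g} {α′ : f′ ⇒ g′} →
             α ≈₂ α′ → k ≈₁ k′ → α ▹ k ≈₂ α′ ▹ k′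

    ∘₁-identityˡ : ∀ {A B} {f : A ⟶ B} → id₁ ∘₁ f ≈₁ f
    ∘₁-identityʳ : ∀ {A B} {f : A ⟶ B} → f ∘₁ id₁ ≈₁ f
    ∘₁-assoc : ∀ {A B C D} {h : C ⟶ D} {g : B ⟶ C} {f : A ⟶ B} →
               (h ∘₁ g) ∘₁ f ≈₁ h ∘₁ (g ∘₁ f)

    ∙-identityˡ : ∀ {A B} {f g : A ⟶ B} {α : f ⇒ g} → id₂ ∙ α ≈₂ α
    ∙-identityʳ : ∀ {A B} {f g : A ⟶ B} {α : f ⇒ g} → α ∙ id₂ ≈₂ α
    ∙-assoc : ∀ {A B} {f g h k : A ⟶ B}
              {γ : h ⇒ k} {β : g ⇒ h} {α : f ⇒ g} →
              (γ ∙ β) ∙ α ≈₂ γ ∙ (β ∙ α)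

    ◃-id₂ : ∀ {A B C} {k : B ⟶ C} {f : A ⟶ B} →
            k ◃ id₂ {f = f} ≈₂ id₂ {f = k ∘₁ f}
    ◃-∙   : ∀ {A B C} {k : B ⟶ C} {f g h : A ⟶ B} {β : g ⇒ h} {α : f ⇒ g} →
            k ◃ (β ∙ α) ≈₂ (k ◃ β) ∙ (k ◃ α)
    id₁-◃ : ∀ {A B} {f g : A ⟶ B} {α : f ⇒ g} → id₁ ◃ α ≈₂ α
    ∘₁-◃  : ∀ {A B C D} {l : C ⟶ D} {k : B ⟶ C} {f g : A ⟶ B} {α : f ⇒ g} →
            (l ∘₁ k) ◃ α ≈₂ l ◃ (k ◃ α)
    id₂-▹ : ∀ {A B C} {f : B ⟶ C} {k : A ⟶ B} →
            id₂ {f = f} ▹ k ≈₂ id₂ {f = f ∘₁ k}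
    ∙-▹   : ∀ {A B C} {f g h : B ⟶ C} {k : A ⟶ B} {β : g ⇒ h} {α : f ⇒ g} →
            (β ∙ α) ▹ k ≈₂ (β ▹ k) ∙ (α ▹ k)
    ▹-id₁ : ∀ {A B} {f g : A ⟶ B} {α : f ⇒ g} → α ▹ id₁ ≈₂ α
    ▹-∘₁  : ∀ {A B C D} {f g : C ⟶ D} {k : B ⟶ C} {l : A ⟶ B} {α : f ⇒ g} →
            α ▹ (k ∘₁ l) ≈₂ (α ▹ k) ▹ l
    ◃-▹   : ∀ {A B C D} {l : C ⟶ D} {f g : B ⟶ C} {k : A ⟶ B} {α : f ⇒ g} →
            (l ◃ α) ▹ k ≈₂ l ◃ (α ▹ k)
    interchange : ∀ {A B C} {f g : A ⟶ B} {h k : B ⟶ C}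
                  {β : h ⇒ k} {α : f ⇒ g} →
                  (β ▹ g) ∙ (h ◃ α) ≈₂ (k ◃ α) ∙ (β ▹ f)

  hom : Obj → Obj → Category
  hom A B = record
    { Obj = A ⟶ B
    ; Hom = λ fg → Cell ((A , B) , fg)
    ; _≈₀_ = _≈₁_
    ; isEquivalence₀ = record { refl = E₁.refl ; sym = E₁.sym ; trans = E₁.trans }
    ; _≈₁_ = _≈₂_
    ; isEquivalence₁ = record { refl = E₂.refl ; sym = E₂.sym ; trans = E₂.trans }
    ; boundary = boundary₂
    ; transport = transport₂
    ; id = id₂
    ; _∙_ = _∙_
    ; id-cong = id₂-cong
    ; ∙-cong = ∙-cong
    ; identityˡ = ∙-identityˡ
    ; identityʳ = ∙-identityʳ
    ; assoc = ∙-assoc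
    }
    where
    module E₁ = IsIndexedEquivalence isEquivalence₁
    module E₂ = IsIndexedEquivalence isEquivalence₂

record TwoFunctor (K L : TwoCategory) : Set where
  private
    module K = TwoCategory K
    module L = TwoCategory L
  field
    F₀ : K.Obj → L.Obj
    F₁ : ∀ {A B} → A K.⟶ B → F₀ A L.⟶ F₀ B
    F₂ : ∀ {A B} {f g : A K.⟶ B} → f K.⇒ g → F₁ f L.⇒ F₁ g
    F₀-cong : ∀ {A A′} → A K.≈₀ A′ → F₀ A L.≈₀ F₀ A′
    F₁-cong : ∀ {A B A′ B′} {f : A K.⟶ B} {f′ : A′ K.⟶ B′} →
              f K.≈₁ f′ → F₁ f L.≈₁ F₁ f′
    F₂-cong : ∀ {A B A′ B′} {f g : A K.⟶ B} {f′ g′ : A′ K.⟶ B′}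
              {α : f K.⇒ g} {α′ : f′ K.⇒ g′} →
              α K.≈₂ α′ → F₂ α L.≈₂ F₂ α′
    F-id₁ : ∀ {A} → F₁ (K.id₁ {A}) L.≈₁ L.id₁ {F₀ A}
    F-∘₁  : ∀ {A B C} {g : B K.⟶ C} {f : A K.⟶ B} →
            F₁ (g K.∘₁ f) L.≈₁ F₁ g L.∘₁ F₁ f
    F-id₂ : ∀ {A B} {f : A K.⟶ B} → F₂ (K.id₂ {f = f}) L.≈₂ L.id₂ {f = F₁ f}
    F-∙   : ∀ {A B} {f g h : A K.⟶ B} {β : g K.⇒ h} {α : f K.⇒ g} →
            F₂ (β K.∙ α) L.≈₂ F₂ β L.∙ F₂ α
    F-◃   : ∀ {A B C} {k : B K.⟶ C} {f g : A K.⟶ B} {α : f K.⇒ g} →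
            F₂ (k K.◃ α) L.≈₂ F₁ k L.◃ F₂ α
    F-▹   : ∀ {A B C} {f g : B K.⟶ C} {k : A K.⟶ B} {α : f K.⇒ g} →
            F₂ (α K.▹ k) L.≈₂ F₂ α L.▹ F₁ k

module _ {K L : TwoCategory} (U : TwoFunctor K L) where
  private
    module K = TwoCategory K
    module L = TwoCategory L
    module U = TwoFunctor U
    module E₁ = IsIndexedEquivalence L.isEquivalence₁
    module E₂ = IsIndexedEquivalence L.isEquivalence₂

  precompose : ∀ {x f} → x L.⟶ U.F₀ f → ∀ y → Functor (K.hom f y) (L.hom x (U.F₀ y))
  precompose η y = record
    { F₀ = λ h → U.F₁ h L.∘₁ η
    ; F₁ = λ α → U.F₂ α L.▹ η
    ; F₀-cong = λ e → L.∘₁-cong (U.F₁-cong e) E₁.refl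
    ; F₁-cong = λ e → L.▹-cong (U.F₂-cong e) E₁.refl
    ; F-id = E₂.trans (L.▹-cong U.F-id₂ E₁.refl) L.id₂-▹
    ; F-∙ = E₂.trans (L.▹-cong U.F-∙ E₁.refl) L.∙-▹
    }

  record RetractBireflection (x : L.Obj) : Set where
    field
      F : K.Obj
      η : x L.⟶ U.F₀ F
      universal : ∀ y → SurjectiveEquivalence (precompose η y)

  -- The choice is a function on objects modulo ≈₀, hence respects ≈₀.
  record LeftRetractBiadjoint : Set where
    field
      bireflection : ∀ x → RetractBireflection x

    F : L.Obj → K.Obj
    F x = RetractBireflection.F (bireflection x)

    η : ∀ x → x L.⟶ U.F₀ (F x)
    η x = RetractBireflection.η (bireflection x)

    field
      F-cong : ∀ {x x′} → x L.≈₀ x′ → F x K.≈₀ F x′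
      η-cong : ∀ {x x′} → x L.≈₀ x′ → η x L.≈₁ η x′

data Sort : Set where
  tyˢ tmˢ : Sort

-- One entry per argument: the number of variables it binds and its sort.
Arity : Set
Arity = List (ℕ × Sort)

record Signature : Set₁ where
  field
    Op    : Sort → Set
    arity : ∀ {s} → Op s → Arity

open Signature

private
  variable
    k l m n : ℕ
    s : Sort
    ar : Arity

infixr 5 _∷_

-- Well-scoped de Bruijn syntax, so α-equivalence is propositional equality.
data Exp (𝕊 : Signature) : Sort → ℕ → Set
data Args (𝕊 : Signature) : Arity → ℕ → Set

data Exp 𝕊 where
  var : Fin n → Exp 𝕊 tmˢ n
  op  : (o : Op 𝕊 s) → Args 𝕊 (arity 𝕊 o) n → Exp 𝕊 s n

data Args 𝕊 where
  []  : Args 𝕊 [] n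
  _∷_ : Exp 𝕊 s (k + n) → Args 𝕊 ar n → Args 𝕊 ((k , s) ∷ ar) n

Ty Tm : Signature → ℕ → Set
Ty 𝕊 = Exp 𝕊 tyˢ
Tm 𝕊 = Exp 𝕊 tmˢ

Ren : ℕ → ℕ → Set
Ren m n = Fin m → Fin n

Sub : Signature → ℕ → ℕ → Set
Sub 𝕊 m n = Fin m → Tm 𝕊 n

module _ {𝕊 : Signature} where

  infixl 6 _▸_
  infixl 20 _[_]

  ren     : Ren m n → Exp 𝕊 s m → Exp 𝕊 s n
  renArgs : Ren m n → Args 𝕊 ar m → Args 𝕊 ar n

  ren ρ (var i)   = var (ρ i)
  ren ρ (op o es) = op o (renArgs ρ es)

  renArgs ρ []                = []
  renArgs ρ (_∷_ {k = k} e es) = ren (Fin.lift k ρ) e ∷ renArgs ρ es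

  wk : Exp 𝕊 s n → Exp 𝕊 s (suc n)
  wk = ren suc

  _▸_ : Sub 𝕊 m n → Tm 𝕊 n → Sub 𝕊 (suc m) n
  (σ ▸ a) zero    = a
  (σ ▸ a) (suc i) = σ i

  lift : Sub 𝕊 m n → Sub 𝕊 (suc m) (suc n)
  lift σ = (wk ∘ σ) ▸ var zero

  lifts : ∀ k → Sub 𝕊 m n → Sub 𝕊 (k + m) (k + n)
  lifts zero    σ = σ
  lifts (suc k) σ = lift (lifts k σ)

  _[_]  : Exp 𝕊 s m → Sub 𝕊 m n → Exp 𝕊 s n
  _[_]ᵃ : Args 𝕊 ar m → Sub 𝕊 m n → Args 𝕊 ar n

  var i   [ σ ] = σ i
  op o es [ σ ] = op o (es [ σ ]ᵃ)

  []                  [ σ ]ᵃ = []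
  (_∷_ {k = k} e es) [ σ ]ᵃ = e [ lifts k σ ] ∷ es [ σ ]ᵃ

  -- The weakening substitution, i.e. the projection of a context extension.
  wkˢ : Sub 𝕊 n (suc n)
  wkˢ i = var (suc i)

  x₀ : Tm 𝕊 (suc n)
  x₀ = var zero

  x₁ : Tm 𝕊 (suc (suc n))
  x₁ = var (suc zero)

  x₂ : Tm 𝕊 (suc (suc (suc n)))
  x₂ = var (suc (suc zero))

  wk₁ : Exp 𝕊 s (suc n) → Exp 𝕊 s (suc (suc n))
  wk₁ = ren (Fin.lift 1 suc)

  ren-ren : {ρ : Ren l m} {ρ′ : Ren m n} {τ : Ren l n} → (∀ i → ρ′ (ρ i) ≡ τ i) →
            (e : Exp 𝕊 s l) → ren ρ′ (ren ρ e) ≡ ren τ e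
  ren-renᵃ : {ρ : Ren l m} {ρ′ : Ren m n} {τ : Ren l n} → (∀ i → ρ′ (ρ i) ≡ τ i) →
             (es : Args 𝕊 ar l) → renArgs ρ′ (renArgs ρ es) ≡ renArgs τ es
  lift-ren-ren : {ρ : Ren l m} {ρ′ : Ren m n} {τ : Ren l n} → (∀ i → ρ′ (ρ i) ≡ τ i) →
                 ∀ k i → Fin.lift k ρ′ (Fin.lift k ρ i) ≡ Fin.lift k τ i
  lift-ren-ren h zero    i       = h i
  lift-ren-ren h (suc k) zero    = refl
  lift-ren-ren h (suc k) (suc i) = cong suc (lift-ren-ren h k i)
  ren-ren h (var i)   = cong var (h i)
  ren-ren h (op o es) = cong (op o) (ren-renᵃ h es)
  ren-renᵃ h []                 = refl
  ren-renᵃ h (_∷_ {k = k} e es) =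
    cong₂ _∷_ (ren-ren (lift-ren-ren h k) e) (ren-renᵃ h es)

  ren-sub : {ρ : Ren l m} {σ : Sub 𝕊 m n} {τ : Sub 𝕊 l n} → (∀ i → σ (ρ i) ≡ τ i) →
            (e : Exp 𝕊 s l) → ren ρ e [ σ ] ≡ e [ τ ]
  ren-subᵃ : {ρ : Ren l m} {σ : Sub 𝕊 m n} {τ : Sub 𝕊 l n} → (∀ i → σ (ρ i) ≡ τ i) →
             (es : Args 𝕊 ar l) → renArgs ρ es [ σ ]ᵃ ≡ es [ τ ]ᵃ
  lift-ren-sub : {ρ : Ren l m} {σ : Sub 𝕊 m n} {τ : Sub 𝕊 l n} → (∀ i → σ (ρ i) ≡ τ i) →
                 ∀ k i → lifts k σ (Fin.lift k ρ i) ≡ lifts k τ i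
  lift-ren-sub h zero    i       = h i
  lift-ren-sub h (suc k) zero    = refl
  lift-ren-sub h (suc k) (suc i) = cong wk (lift-ren-sub h k i)
  ren-sub h (var i)   = h i
  ren-sub h (op o es) = cong (op o) (ren-subᵃ h es)
  ren-subᵃ h []                 = refl
  ren-subᵃ h (_∷_ {k = k} e es) =
    cong₂ _∷_ (ren-sub (lift-ren-sub h k) e) (ren-subᵃ h es)

  sub-ren : {σ : Sub 𝕊 l m} {ρ : Ren m n} {τ : Sub 𝕊 l n} → (∀ i → ren ρ (σ i) ≡ τ i) →
            (e : Exp 𝕊 s l) → ren ρ (e [ σ ]) ≡ e [ τ ]
  sub-renᵃ : {σ : Sub 𝕊 l m} {ρ : Ren m n} {τ : Sub 𝕊 l n} → (∀ i → ren ρ (σ i) ≡ τ i) →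
             (es : Args 𝕊 ar l) → renArgs ρ (es [ σ ]ᵃ) ≡ es [ τ ]ᵃ
  lift-sub-ren : {σ : Sub 𝕊 l m} {ρ : Ren m n} {τ : Sub 𝕊 l n} → (∀ i → ren ρ (σ i) ≡ τ i) →
                 ∀ k i → ren (Fin.lift k ρ) (lifts k σ i) ≡ lifts k τ i
  lift-sub-ren h zero    i       = h i
  lift-sub-ren h (suc k) zero    = refl
  lift-sub-ren {σ = σ} {ρ = ρ} h (suc k) (suc i) =
    trans (trans (ren-ren (λ _ → refl) (lifts k σ i))
                 (sym (ren-ren (λ _ → refl) (lifts k σ i))))
          (cong wk (lift-sub-ren h k i))
  sub-ren h (var i)   = h i
  sub-ren h (op o es) = cong (op o) (sub-renᵃ h es)
  sub-renᵃ h []                 = refl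
  sub-renᵃ h (_∷_ {k = k} e es) =
    cong₂ _∷_ (sub-ren (lift-sub-ren h k) e) (sub-renᵃ h es)

  wk-lift : (e : Exp 𝕊 s m) (σ : Sub 𝕊 m n) → wk e [ lift σ ] ≡ wk (e [ σ ])
  wk-lift e σ = trans (ren-sub (λ _ → refl) e) (sym (sub-ren (λ _ → refl) e))

  sub-sub : {σ : Sub 𝕊 l m} {σ′ : Sub 𝕊 m n} {τ : Sub 𝕊 l n} → (∀ i → σ i [ σ′ ] ≡ τ i) →
            (e : Exp 𝕊 s l) → e [ σ ] [ σ′ ] ≡ e [ τ ]
  sub-subᵃ : {σ : Sub 𝕊 l m} {σ′ : Sub 𝕊 m n} {τ : Sub 𝕊 l n} → (∀ i → σ i [ σ′ ] ≡ τ i) →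
             (es : Args 𝕊 ar l) → es [ σ ]ᵃ [ σ′ ]ᵃ ≡ es [ τ ]ᵃ
  lift-sub-sub : {σ : Sub 𝕊 l m} {σ′ : Sub 𝕊 m n} {τ : Sub 𝕊 l n} → (∀ i → σ i [ σ′ ] ≡ τ i) →
                 ∀ k i → lifts k σ i [ lifts k σ′ ] ≡ lifts k τ i
  lift-sub-sub h zero    i       = h i
  lift-sub-sub h (suc k) zero    = refl
  lift-sub-sub {σ = σ} {σ′ = σ′} h (suc k) (suc i) =
    trans (wk-lift (lifts k σ i) (lifts k σ′)) (cong wk (lift-sub-sub h k i))
  sub-sub h (var i)   = h i
  sub-sub h (op o es) = cong (op o) (sub-subᵃ h es)
  sub-subᵃ h []                 = refl
  sub-subᵃ h (_∷_ {k = k} e es) =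
    cong₂ _∷_ (sub-sub (lift-sub-sub h k) e) (sub-subᵃ h es)

  ren-as-sub : {ρ : Ren m n} {σ : Sub 𝕊 m n} → (∀ i → var (ρ i) ≡ σ i) →
               (e : Exp 𝕊 s m) → ren ρ e ≡ e [ σ ]
  ren-as-subᵃ : {ρ : Ren m n} {σ : Sub 𝕊 m n} → (∀ i → var (ρ i) ≡ σ i) →
                (es : Args 𝕊 ar m) → renArgs ρ es ≡ es [ σ ]ᵃ
  lift-ren-as-sub : {ρ : Ren m n} {σ : Sub 𝕊 m n} → (∀ i → var (ρ i) ≡ σ i) →
                    ∀ k i → var (Fin.lift k ρ i) ≡ lifts k σ i
  lift-ren-as-sub h zero    i       = h i
  lift-ren-as-sub h (suc k) zero    = refl
  lift-ren-as-sub h (suc k) (suc i) = cong wk (lift-ren-as-sub h k i)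
  ren-as-sub h (var i)   = h i
  ren-as-sub h (op o es) = cong (op o) (ren-as-subᵃ h es)
  ren-as-subᵃ h []                 = refl
  ren-as-subᵃ h (_∷_ {k = k} e es) =
    cong₂ _∷_ (ren-as-sub (lift-ren-as-sub h k) e) (ren-as-subᵃ h es)

  sub-id : {σ : Sub 𝕊 n n} → (∀ i → σ i ≡ var i) → (e : Exp 𝕊 s n) → e [ σ ] ≡ e
  sub-idᵃ : {σ : Sub 𝕊 n n} → (∀ i → σ i ≡ var i) → (es : Args 𝕊 ar n) → es [ σ ]ᵃ ≡ es
  lift-sub-id : {σ : Sub 𝕊 n n} → (∀ i → σ i ≡ var i) → ∀ k i → lifts k σ i ≡ var i
  lift-sub-id h zero    i       = h i
  lift-sub-id h (suc k) zero    = refl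
  lift-sub-id h (suc k) (suc i) = cong wk (lift-sub-id h k i)
  sub-id h (var i)   = h i
  sub-id h (op o es) = cong (op o) (sub-idᵃ h es)
  sub-idᵃ h []                 = refl
  sub-idᵃ h (_∷_ {k = k} e es) =
    cong₂ _∷_ (sub-id (lift-sub-id h k) e) (sub-idᵃ h es)

  sub-cong : {σ τ : Sub 𝕊 m n} → (∀ i → σ i ≡ τ i) → (e : Exp 𝕊 s m) → e [ σ ] ≡ e [ τ ]
  sub-cong {σ = σ} h e =
    trans (sym (cong (_[ σ ]) (sub-id (λ _ → refl) e))) (sub-sub h e)

infixl 5 _▷_

data Ctx (𝕊 : Signature) : ℕ → Set where
  ε   : Ctx 𝕊 zero
  _▷_ : Ctx 𝕊 n → Ty 𝕊 n → Ctx 𝕊 (suc n)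

lookup : {𝕊 : Signature} → Ctx 𝕊 n → Fin n → Ty 𝕊 n
lookup (Γ ▷ A) zero    = wk A
lookup (Γ ▷ A) (suc i) = wk (lookup Γ i)

record Judgements (𝕊 : Signature) : Set₁ where
  infix 3 _⊢_type _⊢_∶_ _⊢_≈_type _⊢_≈_∶_
  field
    _⊢_type   : Ctx 𝕊 n → Ty 𝕊 n → Set
    _⊢_∶_     : Ctx 𝕊 n → Tm 𝕊 n → Ty 𝕊 n → Set
    _⊢_≈_type : Ctx 𝕊 n → Ty 𝕊 n → Ty 𝕊 n → Set
    _⊢_≈_∶_   : Ctx 𝕊 n → Tm 𝕊 n → Tm 𝕊 n → Ty 𝕊 n → Set

module Contexts {𝕊 : Signature} (𝒥 : Judgements 𝕊) where
  open Judgements 𝒥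

  infix 3 ⊢_ _⊢ˢ_∶_ _⊢ˢ_≈_∶_

  data ⊢_ : Ctx 𝕊 n → Set where
    ε   : ⊢ ε
    _▷_ : {Γ : Ctx 𝕊 n} {A : Ty 𝕊 n} → ⊢ Γ → Γ ⊢ A type → ⊢ Γ ▷ A

  record _⊢ˢ_∶_ (Δ : Ctx 𝕊 n) (σ : Sub 𝕊 m n) (Γ : Ctx 𝕊 m) : Set where
    constructor subst-ok
    field
      ctx  : ⊢ Δ
      term : ∀ i → Δ ⊢ σ i ∶ lookup Γ i [ σ ]

  record _⊢ˢ_≈_∶_ (Δ : Ctx 𝕊 n) (σ τ : Sub 𝕊 m n) (Γ : Ctx 𝕊 m) : Set where
    constructor subst≈-ok
    field
      left  : Δ ⊢ˢ σ ∶ Γ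
      right : Δ ⊢ˢ τ ∶ Γ
      term  : ∀ i → Δ ⊢ σ i ≈ τ i ∶ lookup Γ i [ σ ]

-- A theory is any family of derivable judgements closed under the
-- following rules; nothing is said about how it is generated.
record TypeTheory (𝕊 : Signature) : Set₁ where
  field
    judgements : Judgements 𝕊

  open Judgements judgements public
  open Contexts judgements public

  field
    type⇒ctx     : {Γ : Ctx 𝕊 n} {A : Ty 𝕊 n} → Γ ⊢ A type → ⊢ Γ
    term⇒type    : {Γ : Ctx 𝕊 n} {A : Ty 𝕊 n} {a : Tm 𝕊 n} →
                   Γ ⊢ a ∶ A → Γ ⊢ A type
    type≈⇒types  : {Γ : Ctx 𝕊 n} {A B : Ty 𝕊 n} →
                   Γ ⊢ A ≈ B type → (Γ ⊢ A type) × (Γ ⊢ B type)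
    term≈⇒terms  : {Γ : Ctx 𝕊 n} {A : Ty 𝕊 n} {a b : Tm 𝕊 n} →
                   Γ ⊢ a ≈ b ∶ A → (Γ ⊢ a ∶ A) × (Γ ⊢ b ∶ A)

    -- Variables and simultaneous substitution, of which weakening,
    -- contraction, exchange and single substitution are instances.
    variable-rule : {Γ : Ctx 𝕊 n} → ⊢ Γ → ∀ i → Γ ⊢ var i ∶ lookup Γ i
    sub-type  : {Γ : Ctx 𝕊 m} {Δ : Ctx 𝕊 n} {σ : Sub 𝕊 m n} {A : Ty 𝕊 m} →
                Δ ⊢ˢ σ ∶ Γ → Γ ⊢ A type → Δ ⊢ A [ σ ] type
    sub-term  : {Γ : Ctx 𝕊 m} {Δ : Ctx 𝕊 n} {σ : Sub 𝕊 m n} {A : Ty 𝕊 m} {a : Tm 𝕊 m} →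
                Δ ⊢ˢ σ ∶ Γ → Γ ⊢ a ∶ A → Δ ⊢ a [ σ ] ∶ A [ σ ]
    sub-type≈ : {Γ : Ctx 𝕊 m} {Δ : Ctx 𝕊 n} {σ : Sub 𝕊 m n} {A B : Ty 𝕊 m} →
                Δ ⊢ˢ σ ∶ Γ → Γ ⊢ A ≈ B type → Δ ⊢ A [ σ ] ≈ B [ σ ] type
    sub-term≈ : {Γ : Ctx 𝕊 m} {Δ : Ctx 𝕊 n} {σ : Sub 𝕊 m n} {A : Ty 𝕊 m} {a b : Tm 𝕊 m} →
                Δ ⊢ˢ σ ∶ Γ → Γ ⊢ a ≈ b ∶ A → Δ ⊢ a [ σ ] ≈ b [ σ ] ∶ A [ σ ]

    type-refl  : {Γ : Ctx 𝕊 n} {A : Ty 𝕊 n} → Γ ⊢ A type → Γ ⊢ A ≈ A type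
    type-sym   : {Γ : Ctx 𝕊 n} {A B : Ty 𝕊 n} → Γ ⊢ A ≈ B type → Γ ⊢ B ≈ A type
    type-trans : {Γ : Ctx 𝕊 n} {A B C : Ty 𝕊 n} →
                 Γ ⊢ A ≈ B type → Γ ⊢ B ≈ C type → Γ ⊢ A ≈ C type
    term-refl  : {Γ : Ctx 𝕊 n} {A : Ty 𝕊 n} {a : Tm 𝕊 n} → Γ ⊢ a ∶ A → Γ ⊢ a ≈ a ∶ A
    term-sym   : {Γ : Ctx 𝕊 n} {A : Ty 𝕊 n} {a b : Tm 𝕊 n} →
                 Γ ⊢ a ≈ b ∶ A → Γ ⊢ b ≈ a ∶ A
    term-trans : {Γ : Ctx 𝕊 n} {A : Ty 𝕊 n} {a b c : Tm 𝕊 n} →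
                 Γ ⊢ a ≈ b ∶ A → Γ ⊢ b ≈ c ∶ A → Γ ⊢ a ≈ c ∶ A
    conv       : {Γ : Ctx 𝕊 n} {A B : Ty 𝕊 n} {a : Tm 𝕊 n} →
                 Γ ⊢ A ≈ B type → Γ ⊢ a ∶ A → Γ ⊢ a ∶ B
    conv≈      : {Γ : Ctx 𝕊 n} {A B : Ty 𝕊 n} {a b : Tm 𝕊 n} →
                 Γ ⊢ A ≈ B type → Γ ⊢ a ≈ b ∶ A → Γ ⊢ a ≈ b ∶ B
    type-cong  : {Γ : Ctx 𝕊 m} {Δ : Ctx 𝕊 n} {σ τ : Sub 𝕊 m n} {A : Ty 𝕊 m} →
                 Δ ⊢ˢ σ ≈ τ ∶ Γ → Γ ⊢ A type → Δ ⊢ A [ σ ] ≈ A [ τ ] type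
    term-cong  : {Γ : Ctx 𝕊 m} {Δ : Ctx 𝕊 n} {σ τ : Sub 𝕊 m n} {A : Ty 𝕊 m} {a : Tm 𝕊 m} →
                 Δ ⊢ˢ σ ≈ τ ∶ Γ → Γ ⊢ a ∶ A → Δ ⊢ a [ σ ] ≈ a [ τ ] ∶ A [ σ ]

data ML₂Op : Sort → Set where
  Σ-op 𝟙-op Id-op Π-op : ML₂Op tyˢ
  pair-op E-op ⋆-op U-op r-op J-op λ-op app-op ext-op : ML₂Op tmˢ

ML₂-arity : ML₂Op s → Arity
ML₂-arity Σ-op    = (0 , tyˢ) ∷ (1 , tyˢ) ∷ []
ML₂-arity 𝟙-op    = []
ML₂-arity Id-op   = (0 , tyˢ) ∷ (0 , tmˢ) ∷ (0 , tmˢ) ∷ []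
ML₂-arity Π-op    = (0 , tyˢ) ∷ (1 , tyˢ) ∷ []
ML₂-arity pair-op = (0 , tyˢ) ∷ (1 , tyˢ) ∷ (0 , tmˢ) ∷ (0 , tmˢ) ∷ []
ML₂-arity E-op    = (0 , tyˢ) ∷ (1 , tyˢ) ∷ (1 , tyˢ) ∷ (2 , tmˢ) ∷ (0 , tmˢ) ∷ []
ML₂-arity ⋆-op    = []
ML₂-arity U-op    = (1 , tyˢ) ∷ (0 , tmˢ) ∷ (0 , tmˢ) ∷ []
ML₂-arity r-op    = (0 , tyˢ) ∷ (0 , tmˢ) ∷ []
ML₂-arity J-op    = (0 , tyˢ) ∷ (3 , tyˢ) ∷ (1 , tmˢ) ∷ (0 , tmˢ) ∷ (0 , tmˢ) ∷ (0 , tmˢ) ∷ []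
ML₂-arity λ-op    = (0 , tyˢ) ∷ (1 , tyˢ) ∷ (1 , tmˢ) ∷ []
ML₂-arity app-op  = (0 , tyˢ) ∷ (1 , tyˢ) ∷ (0 , tmˢ) ∷ (0 , tmˢ) ∷ []
ML₂-arity ext-op  = (0 , tyˢ) ∷ (1 , tyˢ) ∷ (0 , tmˢ) ∷ (0 , tmˢ) ∷ (1 , tmˢ) ∷ []

ML₂+ : Signature → Signature
ML₂+ 𝕊 .Op s   = ML₂Op s ⊎ Op 𝕊 s
ML₂+ 𝕊 .arity  = [ ML₂-arity , arity 𝕊 ]′

-- Terms carry the type annotations that E_d(z), J_d(x,y,p), λf, m·y, …
-- leave implicit.
module _ {𝕊 : Signature} where
  private
    T t : ℕ → Set
    T = Ty (ML₂+ 𝕊)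
    t = Tm (ML₂+ 𝕊)

  `Σ : T n → T (suc n) → T n
  `Σ A B = op (inj₁ Σ-op) (A ∷ B ∷ [])

  `𝟙 : T n
  `𝟙 = op (inj₁ 𝟙-op) []

  Id : T n → t n → t n → T n
  Id A a b = op (inj₁ Id-op) (A ∷ a ∷ b ∷ [])

  `Π : T n → T (suc n) → T n
  `Π A B = op (inj₁ Π-op) (A ∷ B ∷ [])

  pair : T n → T (suc n) → t n → t n → t n
  pair A B a b = op (inj₁ pair-op) (A ∷ B ∷ a ∷ b ∷ [])

  E : T n → T (suc n) → T (suc n) → t (suc (suc n)) → t n → t n
  E A B C d z = op (inj₁ E-op) (A ∷ B ∷ C ∷ d ∷ z ∷ [])

  ⋆ : t n
  ⋆ = op (inj₁ ⋆-op) []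

  U : T (suc n) → t n → t n → t n
  U C d z = op (inj₁ U-op) (C ∷ d ∷ z ∷ [])

  r : T n → t n → t n
  r A a = op (inj₁ r-op) (A ∷ a ∷ [])

  J : T n → T (suc (suc (suc n))) → t (suc n) → t n → t n → t n → t n
  J A C d a b p = op (inj₁ J-op) (A ∷ C ∷ d ∷ a ∷ b ∷ p ∷ [])

  lam : T n → T (suc n) → t (suc n) → t n
  lam A B f = op (inj₁ λ-op) (A ∷ B ∷ f ∷ [])

  app : T n → T (suc n) → t n → t n → t n
  app A B m a = op (inj₁ app-op) (A ∷ B ∷ m ∷ a ∷ [])

  ext : T n → T (suc n) → t n → t n → t (suc n) → t n
  ext A B m n p = op (inj₁ ext-op) (A ∷ B ∷ m ∷ n ∷ p ∷ [])

  -- (x : A, y : B) ↦ ⟨x , y⟩, as a substitution into Γ ▷ Σ A B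
  pairˢ : T n → T (suc n) → Sub (ML₂+ 𝕊) (suc n) (suc (suc n))
  pairˢ A B = (wk ∘ wkˢ) ▸ pair (wk (wk A)) (wk₁ (wk₁ B)) x₁ x₀

  -- (x , y : A, p : Id A x y)
  _▷Id_ : Ctx (ML₂+ 𝕊) n → T n → Ctx (ML₂+ 𝕊) (suc (suc (suc n)))
  Γ ▷Id A = Γ ▷ A ▷ wk A ▷ Id (wk (wk A)) x₁ x₀

  -- (x : A) ↦ (x , x , r x), as a substitution into Γ ▷Id A
  reflˢ : T n → Sub (ML₂+ 𝕊) (suc (suc (suc n))) (suc n)
  reflˢ A = wkˢ ▸ x₀ ▸ x₀ ▸ r (wk A) x₀

  -- p ∗ a := J_{[x] r(x · a)}(m, n, p)
  _∗⟨_,_,_,_⟩_ : t n → T n → T (suc n) → t n → t n → t n → t n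
  p ∗⟨ A , B , m , n ⟩ a =
    J (`Π A B)
      (Id (wk (wk (wk (B [ var ▸ a ]))))
          (app (wk (wk (wk A))) (wk₁ (wk₁ (wk₁ B))) x₂ (wk (wk (wk a))))
          (app (wk (wk (wk A))) (wk₁ (wk₁ (wk₁ B))) x₁ (wk (wk (wk a)))))
      (r (wk (B [ var ▸ a ])) (app (wk A) (wk₁ B) x₀ (wk a)))
      m n p

module _ {𝕊 : Signature} (S : TypeTheory (ML₂+ 𝕊)) where
  open TypeTheory S

  private
    variable
      Γ : Ctx (ML₂+ 𝕊) n
      A A′ B B′ C C′ : Ty (ML₂+ 𝕊) n
      a a′ b b′ c c′ d d′ f f′ h h′ p p′ q α : Tm (ML₂+ 𝕊) n

  record AdmitsML₂ : Set where
    field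
      Σ-form : Γ ⊢ A type → Γ ▷ A ⊢ B type → Γ ⊢ `Σ A B type
      Σ-intro : Γ ⊢ A type → Γ ▷ A ⊢ B type → Γ ⊢ a ∶ A → Γ ⊢ b ∶ B [ var ▸ a ] →
                Γ ⊢ pair A B a b ∶ `Σ A B
      Σ-elim : Γ ⊢ A type → Γ ▷ A ⊢ B type → Γ ▷ `Σ A B ⊢ C type →
               Γ ▷ A ▷ B ⊢ d ∶ C [ pairˢ A B ] → Γ ⊢ c ∶ `Σ A B →
               Γ ⊢ E A B C d c ∶ C [ var ▸ c ]
      Σ-comp : Γ ⊢ A type → Γ ▷ A ⊢ B type → Γ ▷ `Σ A B ⊢ C type →
               Γ ▷ A ▷ B ⊢ d ∶ C [ pairˢ A B ] →
               Γ ⊢ a ∶ A → Γ ⊢ b ∶ B [ var ▸ a ] →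
               Γ ⊢ E A B C d (pair A B a b) ≈ d [ var ▸ a ▸ b ] ∶ C [ var ▸ pair A B a b ]

      𝟙-form : ⊢ Γ → Γ ⊢ `𝟙 type
      𝟙-intro : ⊢ Γ → Γ ⊢ ⋆ ∶ `𝟙
      𝟙-elim : Γ ▷ `𝟙 ⊢ C type → Γ ⊢ d ∶ C [ var ▸ ⋆ ] → Γ ⊢ c ∶ `𝟙 →
               Γ ⊢ U C d c ∶ C [ var ▸ c ]
      𝟙-comp : Γ ▷ `𝟙 ⊢ C type → Γ ⊢ d ∶ C [ var ▸ ⋆ ] →
               Γ ⊢ U C d ⋆ ≈ d ∶ C [ var ▸ ⋆ ]

      Id-form : Γ ⊢ A type → Γ ⊢ a ∶ A → Γ ⊢ b ∶ A → Γ ⊢ Id A a b type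
      Id-intro : Γ ⊢ A type → Γ ⊢ a ∶ A → Γ ⊢ r A a ∶ Id A a a
      Id-elim : Γ ⊢ A type → Γ ▷Id A ⊢ C type → Γ ▷ A ⊢ d ∶ C [ reflˢ A ] →
                Γ ⊢ a ∶ A → Γ ⊢ b ∶ A → Γ ⊢ p ∶ Id A a b →
                Γ ⊢ J A C d a b p ∶ C [ var ▸ a ▸ b ▸ p ]
      Id-comp : Γ ⊢ A type → Γ ▷Id A ⊢ C type → Γ ▷ A ⊢ d ∶ C [ reflˢ A ] →
                Γ ⊢ a ∶ A →
                Γ ⊢ J A C d a a (r A a) ≈ d [ var ▸ a ] ∶ C [ var ▸ a ▸ a ▸ r A a ]

      Π-form : Γ ⊢ A type → Γ ▷ A ⊢ B type → Γ ⊢ `Π A B type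
      Π-intro : Γ ⊢ A type → Γ ▷ A ⊢ B type → Γ ▷ A ⊢ f ∶ B → Γ ⊢ lam A B f ∶ `Π A B
      Π-elim : Γ ⊢ A type → Γ ▷ A ⊢ B type → Γ ⊢ h ∶ `Π A B → Γ ⊢ a ∶ A →
               Γ ⊢ app A B h a ∶ B [ var ▸ a ]
      Π-comp : Γ ⊢ A type → Γ ▷ A ⊢ B type → Γ ▷ A ⊢ f ∶ B → Γ ⊢ a ∶ A →
               Γ ⊢ app A B (lam A B f) a ≈ f [ var ▸ a ] ∶ B [ var ▸ a ]

      discrete : Γ ⊢ A type → Γ ⊢ a ∶ A → Γ ⊢ b ∶ A →
                 Γ ⊢ p ∶ Id A a b → Γ ⊢ q ∶ Id A a b → Γ ⊢ α ∶ Id (Id A a b) p q →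
                 (Γ ⊢ p ≈ q ∶ Id A a b) ×
                 (Γ ⊢ α ≈ r (Id A a b) p ∶ Id (Id A a b) p q)

      ext-intro : Γ ⊢ A type → Γ ▷ A ⊢ B type → Γ ⊢ h ∶ `Π A B → Γ ⊢ f ∶ `Π A B →
                  Γ ▷ A ⊢ p ∶ Id B (app (wk A) (wk₁ B) (wk h) x₀)
                                   (app (wk A) (wk₁ B) (wk f) x₀) →
                  Γ ⊢ ext A B h f p ∶ Id (`Π A B) h f
      ext-r : Γ ⊢ A type → Γ ▷ A ⊢ B type → Γ ⊢ h ∶ `Π A B →
              Γ ⊢ ext A B h h (r B (app (wk A) (wk₁ B) (wk h) x₀))
                ≈ r (`Π A B) h ∶ Id (`Π A B) h h
      ext-∗ : Γ ⊢ A type → Γ ▷ A ⊢ B type → Γ ⊢ h ∶ `Π A B → Γ ⊢ f ∶ `Π A B →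
              Γ ▷ A ⊢ p ∶ Id B (app (wk A) (wk₁ B) (wk h) x₀)
                               (app (wk A) (wk₁ B) (wk f) x₀) →
              Γ ⊢ a ∶ A →
              Γ ⊢ ext A B h f p ∗⟨ A , B , h , f ⟩ a ≈ p [ var ▸ a ]
                ∶ Id (B [ var ▸ a ]) (app A B h a) (app A B f a)

      Σ-cong : Γ ⊢ A ≈ A′ type → Γ ▷ A ⊢ B ≈ B′ type → Γ ⊢ `Σ A B ≈ `Σ A′ B′ type
      pair-cong : Γ ⊢ A ≈ A′ type → Γ ▷ A ⊢ B ≈ B′ type →
                  Γ ⊢ a ≈ a′ ∶ A → Γ ⊢ b ≈ b′ ∶ B [ var ▸ a ] →
                  Γ ⊢ pair A B a b ≈ pair A′ B′ a′ b′ ∶ `Σ A B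
      E-cong : Γ ⊢ A ≈ A′ type → Γ ▷ A ⊢ B ≈ B′ type → Γ ▷ `Σ A B ⊢ C ≈ C′ type →
               Γ ▷ A ▷ B ⊢ d ≈ d′ ∶ C [ pairˢ A B ] → Γ ⊢ c ≈ c′ ∶ `Σ A B →
               Γ ⊢ E A B C d c ≈ E A′ B′ C′ d′ c′ ∶ C [ var ▸ c ]
      U-cong : Γ ▷ `𝟙 ⊢ C ≈ C′ type → Γ ⊢ d ≈ d′ ∶ C [ var ▸ ⋆ ] → Γ ⊢ c ≈ c′ ∶ `𝟙 →
               Γ ⊢ U C d c ≈ U C′ d′ c′ ∶ C [ var ▸ c ]
      Id-cong : Γ ⊢ A ≈ A′ type → Γ ⊢ a ≈ a′ ∶ A → Γ ⊢ b ≈ b′ ∶ A →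
                Γ ⊢ Id A a b ≈ Id A′ a′ b′ type
      r-cong : Γ ⊢ A ≈ A′ type → Γ ⊢ a ≈ a′ ∶ A → Γ ⊢ r A a ≈ r A′ a′ ∶ Id A a a
      J-cong : Γ ⊢ A ≈ A′ type → Γ ▷Id A ⊢ C ≈ C′ type → Γ ▷ A ⊢ d ≈ d′ ∶ C [ reflˢ A ] →
               Γ ⊢ a ≈ a′ ∶ A → Γ ⊢ b ≈ b′ ∶ A → Γ ⊢ p ≈ p′ ∶ Id A a b →
               Γ ⊢ J A C d a b p ≈ J A′ C′ d′ a′ b′ p′ ∶ C [ var ▸ a ▸ b ▸ p ]
      Π-cong : Γ ⊢ A ≈ A′ type → Γ ▷ A ⊢ B ≈ B′ type → Γ ⊢ `Π A B ≈ `Π A′ B′ type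
      lam-cong : Γ ⊢ A ≈ A′ type → Γ ▷ A ⊢ B ≈ B′ type → Γ ▷ A ⊢ f ≈ f′ ∶ B →
                 Γ ⊢ lam A B f ≈ lam A′ B′ f′ ∶ `Π A B
      app-cong : Γ ⊢ A ≈ A′ type → Γ ▷ A ⊢ B ≈ B′ type →
                 Γ ⊢ h ≈ h′ ∶ `Π A B → Γ ⊢ a ≈ a′ ∶ A →
                 Γ ⊢ app A B h a ≈ app A′ B′ h′ a′ ∶ B [ var ▸ a ]
      ext-cong : Γ ⊢ A ≈ A′ type → Γ ▷ A ⊢ B ≈ B′ type →
                 Γ ⊢ h ≈ h′ ∶ `Π A B → Γ ⊢ f ≈ f′ ∶ `Π A B →
                 Γ ▷ A ⊢ p ≈ p′ ∶ Id B (app (wk A) (wk₁ B) (wk h) x₀)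
                                       (app (wk A) (wk₁ B) (wk f) x₀) →
                 Γ ⊢ ext A B h f p ≈ ext A′ B′ h′ f′ p′ ∶ Id (`Π A B) h f

module _ {𝕊 : Signature} where

  ↑ : ∀ k → Sub 𝕊 n (k + n)
  ↑ k i = var (k Fin.↑ʳ i)

  [var] : (e : Exp 𝕊 s n) → e [ var ] ≡ e
  [var] = sub-id (λ _ → refl)

  [wkˢ] : (e : Exp 𝕊 s n) → e [ wkˢ ] ≡ wk e
  [wkˢ] e = sym (ren-as-sub (λ _ → refl) e)

  wk-▸ : (e : Exp 𝕊 s m) {σ : Sub 𝕊 m n} {a : Tm 𝕊 n} → wk e [ σ ▸ a ] ≡ e [ σ ]
  wk-▸ e = ren-sub (λ _ → refl) e

  wk-⟨⟩ : (e : Exp 𝕊 s n) {a : Tm 𝕊 n} → wk e [ var ▸ a ] ≡ e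
  wk-⟨⟩ e = trans (wk-▸ e) ([var] e)

  ▸-sub : (e : Exp 𝕊 s (suc l)) {σ : Sub 𝕊 l m} {a : Tm 𝕊 m} {τ : Sub 𝕊 m n} →
          e [ σ ▸ a ] [ τ ] ≡ e [ (λ i → σ i [ τ ]) ▸ (a [ τ ]) ]
  ▸-sub e = sub-sub (λ { zero → refl ; (suc i) → refl }) e

  ▸-cong : (e : Exp 𝕊 s (suc m)) {σ σ′ : Sub 𝕊 m n} {a a′ : Tm 𝕊 n} →
           (∀ i → σ i ≡ σ′ i) → a ≡ a′ → e [ σ ▸ a ] ≡ e [ σ′ ▸ a′ ]
  ▸-cong e h h₀ = sub-cong (λ { zero → h₀ ; (suc i) → h i }) e

  lift-▸ : (e : Exp 𝕊 s (suc l)) {σ : Sub 𝕊 l m} {τ : Sub 𝕊 m n} {a : Tm 𝕊 n} →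
           e [ lift σ ] [ τ ▸ a ] ≡ e [ (λ i → σ i [ τ ]) ▸ a ]
  lift-▸ e {σ} = sub-sub (λ { zero → refl ; (suc i) → wk-▸ (σ i) }) e

  lift-⟨⟩ : (e : Exp 𝕊 s (suc m)) {σ : Sub 𝕊 m n} {a : Tm 𝕊 n} →
            e [ lift σ ] [ var ▸ a ] ≡ e [ σ ▸ a ]
  lift-⟨⟩ e {σ} = trans (lift-▸ e) (▸-cong e (λ i → [var] (σ i)) refl)

  ⟨⟩-sub : (e : Exp 𝕊 s (suc m)) {a : Tm 𝕊 m} {σ : Sub 𝕊 m n} →
           e [ var ▸ a ] [ σ ] ≡ e [ lift σ ] [ var ▸ (a [ σ ]) ]
  ⟨⟩-sub e {a} {σ} = trans (▸-sub e {var} {a} {σ}) (sym (lift-⟨⟩ e {σ} {a [ σ ]}))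

  lift-lift : (e : Exp 𝕊 s (suc l)) {σ : Sub 𝕊 l m} {τ : Sub 𝕊 m n} →
              e [ lift σ ] [ lift τ ] ≡ e [ lift (λ i → σ i [ τ ]) ]
  lift-lift e = sub-sub (lift-sub-sub (λ _ → refl) 1) e

  [wkˢ▸x₀] : (e : Exp 𝕊 s (suc n)) → e [ wkˢ ▸ x₀ ] ≡ e
  [wkˢ▸x₀] = sub-id (λ { zero → refl ; (suc i) → refl })

  ↑-lifts : ∀ k (e : Exp 𝕊 s m) {σ : Sub 𝕊 m n} → e [ ↑ k ] [ lifts k σ ] ≡ e [ σ ] [ ↑ k ]
  ↑-lifts {m = m} {n = n} k e {σ} = trans (sub-sub (pointwise k) e) (sym (sub-sub (λ _ → refl) e))
    where
    pointwise : ∀ k i → lifts k σ (k Fin.↑ʳ i) ≡ σ i [ ↑ k ]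
    pointwise zero    i = sym ([var] (σ i))
    pointwise (suc k) i = trans (cong wk (pointwise k i)) (sub-ren (λ _ → refl) (σ i))

  ↑-suc : ∀ k (e : Exp 𝕊 s n) → wk (e [ ↑ k ]) ≡ e [ ↑ (suc k) ]
  ↑-suc k e = sub-ren (λ _ → refl) e

  ↑1 : (e : Exp 𝕊 s n) → wk e ≡ e [ ↑ 1 ]
  ↑1 = ren-as-sub (λ _ → refl)

  ↑2 : (e : Exp 𝕊 s n) → wk (wk e) ≡ e [ ↑ 2 ]
  ↑2 e = trans (cong wk (↑1 e)) (↑-suc 1 e)

  ↑3 : (e : Exp 𝕊 s n) → wk (wk (wk e)) ≡ e [ ↑ 3 ]
  ↑3 e = trans (cong wk (↑2 e)) (↑-suc 2 e)

  ↑-sub : ∀ k (e : Exp 𝕊 s m) {σ : Sub 𝕊 (k + m) n} → e [ ↑ k ] [ σ ] ≡ e [ (λ i → σ (k Fin.↑ʳ i)) ]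
  ↑-sub k e = sub-sub (λ _ → refl) e

  ↑-lift : ∀ k (e : Exp 𝕊 s m) {σ : Sub 𝕊 (k + m) n} →
           e [ ↑ (suc k) ] [ lift σ ] ≡ wk (e [ (λ i → σ (k Fin.↑ʳ i)) ])
  ↑-lift k e = trans (sub-sub (λ _ → refl) e) (sym (sub-ren (λ _ → refl) e))

  -- g [ wkˢ ▸ f ] is the composite of y : A ⊢ f : B and y : B ⊢ g : C.
  wk-∘ : (C : Ty 𝕊 n) {f : Tm 𝕊 (suc n)} → wk C [ wkˢ ▸ f ] ≡ wk C
  wk-∘ C = trans (wk-▸ C) ([wkˢ] C)

  lift-wkˢ-∘ : (e : Exp 𝕊 s (suc n)) {f : Tm 𝕊 (suc n)} →
               e [ lift wkˢ ] [ lift (wkˢ ▸ f) ] ≡ e [ lift wkˢ ]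
  lift-wkˢ-∘ e {f} = lift-lift e {wkˢ} {wkˢ ▸ f}

  ∘-lift : (g : Exp 𝕊 s (suc m)) {f : Tm 𝕊 (suc m)} {σ : Sub 𝕊 m n} →
           g [ wkˢ ▸ f ] [ lift σ ] ≡ g [ lift σ ] [ wkˢ ▸ (f [ lift σ ]) ]
  ∘-lift g {f} {σ} = trans (▸-sub g {wkˢ} {f} {lift σ})
    (trans (▸-cong g (λ i → sym ([wkˢ] (σ i))) refl)
           (sym (lift-▸ g {σ} {wkˢ} {f [ lift σ ]})))

  ∘-assoc : (h : Exp 𝕊 s (suc n)) {g f : Tm 𝕊 (suc n)} →
            h [ wkˢ ▸ g ] [ wkˢ ▸ f ] ≡ h [ wkˢ ▸ (g [ wkˢ ▸ f ]) ]
  ∘-assoc h {g} {f} = ▸-sub h {wkˢ} {g} {wkˢ ▸ f}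

module _ {𝕊 : Signature} where
  private
    T t : ℕ → Set
    T = Ty (ML₂+ 𝕊)
    t = Tm (ML₂+ 𝕊)

    variable
      A A′ B B′ C C′ : T n
      a a′ b b′ c c′ d d′ g g′ p p′ q q′ : t n

  Id≡ : A ≡ A′ → a ≡ a′ → b ≡ b′ → Id A a b ≡ Id A′ a′ b′
  Id≡ refl refl refl = refl

  private
    app≡ : A ≡ A′ → B ≡ B′ → c ≡ c′ → a ≡ a′ → app A B c a ≡ app A′ B′ c′ a′
    app≡ refl refl refl refl = refl

    J≡ : C ≡ C′ → d ≡ d′ → J A C d a b p ≡ J A C′ d′ a b p
    J≡ refl refl = refl

    lam≡ : A ≡ A′ → B ≡ B′ → c ≡ c′ → lam A B c ≡ lam A′ B′ c′
    lam≡ refl refl refl = refl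

    wk²-lift : (e : Exp (ML₂+ 𝕊) s m) {σ : Sub (ML₂+ 𝕊) m n} →
               wk (wk e) [ lift (lift σ) ] ≡ wk (wk (e [ σ ]))
    wk²-lift e {σ} = trans (wk-lift (wk e) (lift σ)) (cong wk (wk-lift e σ))

  -- Elimination on q : Id A x y generalises over p : Id A a x, by way of
  -- the motive Π (p : Id A a x) → Id A a y.
  compose-type : T n → t n → T (suc (suc (suc n)))
  compose-type A a =
    `Π (Id (A [ ↑ 3 ]) (a [ ↑ 3 ]) x₂) (Id (A [ ↑ 4 ]) (a [ ↑ 4 ]) x₂)

  compose-refl : T n → t n → t (suc n)
  compose-refl A a =
    lam (Id (wk A) (wk a) x₀) (Id (wk (wk A)) (wk (wk a)) x₁) x₀

  -- q ∘ p, for p : Id A a b and q : Id A b c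
  compose : T n → t n → t n → t n → t n → t n → t n
  compose A a b c q p =
    app (Id A a b) (Id (wk A) (wk a) (wk c))
        (J A (compose-type A a) (compose-refl A a) b c q)
        p

  apply-type : T n → t (suc n) → T (suc (suc (suc n)))
  apply-type B g = Id (B [ ↑ 3 ]) (g [ ↑ 3 ▸ x₂ ]) (g [ ↑ 3 ▸ x₁ ])

  -- g • p : Id B (g a) (g b), for y : A ⊢ g : B and p : Id A a b
  apply : T n → T n → t (suc n) → t n → t n → t n → t n
  apply A B g a b p = J A (apply-type B g) (r (wk B) g) a b p

  compose-type-▸ : (A : T m) (a : t m) {σ : Sub (ML₂+ 𝕊) m n} →
                   compose-type A a [ σ ▸ b ▸ c ▸ q ] ≡
                   `Π (Id (A [ σ ]) (a [ σ ]) b) (Id (wk (A [ σ ])) (wk (a [ σ ])) (wk c))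
  compose-type-▸ A a = cong₂ `Π (Id≡ (↑-sub 3 A) (↑-sub 3 a) refl)
                                (Id≡ (↑-lift 3 A) (↑-lift 3 a) refl)

  compose-sub : (A : T m) (a b c q p : t m) (σ : Sub (ML₂+ 𝕊) m n) →
                compose A a b c q p [ σ ] ≡
                compose (A [ σ ]) (a [ σ ]) (b [ σ ]) (c [ σ ]) (q [ σ ]) (p [ σ ])
  compose-sub A a b c q p σ =
    app≡ refl (Id≡ (wk-lift A σ) (wk-lift a σ) (wk-lift c σ))
      (J≡ (cong₂ `Π (Id≡ (↑-lifts 3 A) (↑-lifts 3 a) refl)
                    (Id≡ (↑-lifts 4 A) (↑-lifts 4 a) refl))
          (lam≡ (Id≡ (wk-lift A σ) (wk-lift a σ) refl)
                (Id≡ (wk²-lift A) (wk²-lift a) refl) refl))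
      refl

  compose≡ : A ≡ A′ → a ≡ a′ → b ≡ b′ → c ≡ c′ → q ≡ q′ → p ≡ p′ →
             compose A a b c q p ≡ compose A′ a′ b′ c′ q′ p′
  compose≡ refl refl refl refl refl refl = refl

  apply-type-▸ : (B : T m) (g : t (suc m)) {σ : Sub (ML₂+ 𝕊) m n} →
                 apply-type B g [ σ ▸ a ▸ b ▸ p ] ≡ Id (B [ σ ]) (g [ σ ▸ a ]) (g [ σ ▸ b ])
  apply-type-▸ B g = Id≡ (↑-sub 3 B) (▸-sub g) (▸-sub g)

  apply-sub : (A B : T m) (g : t (suc m)) (a b p : t m) (σ : Sub (ML₂+ 𝕊) m n) →
              apply A B g a b p [ σ ] ≡
              apply (A [ σ ]) (B [ σ ]) (g [ lift σ ]) (a [ σ ]) (b [ σ ]) (p [ σ ])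
  apply-sub A B g a b p σ =
    J≡ (Id≡ (↑-lifts 3 B) (swap g) (swap g)) (cong₂ r (wk-lift B σ) refl)
    where
    swap : (g : t (suc _)) {x : t (suc (suc (suc _)))} →
           g [ ↑ 3 ▸ x ] [ lifts 3 σ ] ≡ g [ lift σ ] [ ↑ 3 ▸ (x [ lifts 3 σ ]) ]
    swap g = trans (▸-sub g)
      (trans (▸-cong g (λ i → ↑-lifts 3 (var i) {σ}) refl) (sym (lift-▸ g {σ})))

  apply≡ : A ≡ A′ → B ≡ B′ → g ≡ g′ → a ≡ a′ → b ≡ b′ → p ≡ p′ →
           apply A B g a b p ≡ apply A′ B′ g′ a′ b′ p′
  apply≡ refl refl refl refl refl refl = refl

module Derived {𝕊 : Signature} (S : TypeTheory (ML₂+ 𝕊)) (M : AdmitsML₂ S) where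
  open TypeTheory S
  open AdmitsML₂ M

  private
    variable
      Γ Δ : Ctx (ML₂+ 𝕊) n
      σ τ : Sub (ML₂+ 𝕊) m n
      A A′ B B′ C C′ D W : Ty (ML₂+ 𝕊) n
      a a′ b b′ c c′ d d′ f f′ g g′ h h′ p p′ q q′ t u v w : Tm (ML₂+ 𝕊) n

  ⊢≡ : A ≡ B → Γ ⊢ a ∶ A → Γ ⊢ a ∶ B
  ⊢≡ refl ta = ta

  ⊢≡ᵗ : a ≡ b → Γ ⊢ a ∶ A → Γ ⊢ b ∶ A
  ⊢≡ᵗ refl ta = ta

  ≈≡ : A ≡ B → Γ ⊢ a ≈ b ∶ A → Γ ⊢ a ≈ b ∶ B
  ≈≡ refl e = e

  ≡⇒≈ : a ≡ b → Γ ⊢ a ∶ A → Γ ⊢ a ≈ b ∶ A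
  ≡⇒≈ refl ta = term-refl ta

  ≈-≡ : a ≡ a′ → b ≡ b′ → Γ ⊢ a ≈ b ∶ A → Γ ⊢ a′ ≈ b′ ∶ A
  ≈-≡ refl refl e = e

  type≡ : A ≡ B → Γ ⊢ A type → Γ ⊢ B type
  type≡ refl tA = tA

  ty≈≡ : A ≡ A′ → B ≡ B′ → Γ ⊢ A ≈ B type → Γ ⊢ A′ ≈ B′ type
  ty≈≡ refl refl e = e

  left : Γ ⊢ a ≈ b ∶ A → Γ ⊢ a ∶ A
  left e = proj₁ (term≈⇒terms e)

  right : Γ ⊢ a ≈ b ∶ A → Γ ⊢ b ∶ A
  right e = proj₂ (term≈⇒terms e)

  leftᵗ : Γ ⊢ A ≈ B type → Γ ⊢ A type
  leftᵗ e = proj₁ (type≈⇒types e)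

  rightᵗ : Γ ⊢ A ≈ B type → Γ ⊢ B type
  rightᵗ e = proj₂ (type≈⇒types e)

  ⊢▷ : Γ ⊢ A type → ⊢ Γ ▷ A
  ⊢▷ tA = type⇒ctx tA ▷ tA

  ⊢var : ⊢ Γ → Γ ⊢ˢ var ∶ Γ
  ⊢var {Γ = Γ} tΓ = subst-ok tΓ (λ i → ⊢≡ (sym ([var] (lookup Γ i))) (variable-rule tΓ i))

  ⊢▸ : Δ ⊢ˢ σ ∶ Γ → Δ ⊢ a ∶ A [ σ ] → Δ ⊢ˢ σ ▸ a ∶ Γ ▷ A
  ⊢▸ {Γ = Γ} {A = A} (subst-ok tΔ tσ) ta = subst-ok tΔ
    (λ { zero → ⊢≡ (sym (wk-▸ A)) ta ; (suc i) → ⊢≡ (sym (wk-▸ (lookup Γ i))) (tσ i) })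

  ⊢▸⁻ : Δ ⊢ˢ σ ∶ Γ ▷ A → Δ ⊢ˢ (λ i → σ (suc i)) ∶ Γ
  ⊢▸⁻ {Γ = Γ} (subst-ok tΔ tσ) =
    subst-ok tΔ (λ i → ⊢≡ (ren-sub (λ _ → refl) (lookup Γ i)) (tσ (suc i)))

  ⊢↑ˢ : Δ ⊢ˢ σ ∶ Γ → Δ ⊢ A type → Δ ▷ A ⊢ˢ wk ∘ σ ∶ Γ

  ⊢wkˢ : Γ ⊢ A type → Γ ▷ A ⊢ˢ wkˢ ∶ Γ
  ⊢wkˢ tA = ⊢▸⁻ (⊢var (⊢▷ tA))

  wk-term : Γ ⊢ A type → Γ ⊢ b ∶ B → Γ ▷ A ⊢ wk b ∶ wk B
  wk-term {b = b} {B = B} tA tb = ⊢≡ ([wkˢ] B) (⊢≡ᵗ ([wkˢ] b) (sub-term (⊢wkˢ tA) tb))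

  wk-type : Γ ⊢ A type → Γ ⊢ B type → Γ ▷ A ⊢ wk B type
  wk-type {B = B} tA tB = type≡ ([wkˢ] B) (sub-type (⊢wkˢ tA) tB)

  wk-type≈ : Γ ⊢ A type → Γ ⊢ B ≈ B′ type → Γ ▷ A ⊢ wk B ≈ wk B′ type
  wk-type≈ {B = B} {B′ = B′} tA tB = ty≈≡ ([wkˢ] B) ([wkˢ] B′) (sub-type≈ (⊢wkˢ tA) tB)

  wk-term≈ : Γ ⊢ A type → Γ ⊢ b ≈ b′ ∶ B → Γ ▷ A ⊢ wk b ≈ wk b′ ∶ wk B
  wk-term≈ {b = b} {b′ = b′} {B = B} tA tb =
    ≈≡ ([wkˢ] B) (≈-≡ ([wkˢ] b) ([wkˢ] b′) (sub-term≈ (⊢wkˢ tA) tb))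

  ⊢↑ˢ {σ = σ} {Γ = Γ} (subst-ok tΔ tσ) tA = subst-ok (tΔ ▷ tA)
    (λ i → ⊢≡ (sub-ren (λ _ → refl) (lookup Γ i)) (wk-term tA (tσ i)))

  ⊢lift : Δ ⊢ˢ σ ∶ Γ → Γ ⊢ A type → Δ ▷ A [ σ ] ⊢ˢ lift σ ∶ Γ ▷ A
  ⊢lift {A = A} tσ tA =
    ⊢▸ (⊢↑ˢ tσ (sub-type tσ tA))
       (⊢≡ (sub-ren (λ _ → refl) A) (variable-rule (⊢▷ (sub-type tσ tA)) zero))

  ⊢x₀ : Γ ⊢ A type → Γ ▷ A ⊢ x₀ ∶ wk A
  ⊢x₀ tA = variable-rule (⊢▷ tA) zero

  ⊢ˢ-refl : Δ ⊢ˢ σ ∶ Γ → Δ ⊢ˢ σ ≈ σ ∶ Γ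
  ⊢ˢ-refl tσ = subst≈-ok tσ tσ (λ i → term-refl (_⊢ˢ_∶_.term tσ i))

  ⊢▸≈ : Δ ⊢ˢ σ ≈ τ ∶ Γ → Γ ⊢ A type → Δ ⊢ a ≈ b ∶ A [ σ ] → Δ ⊢ˢ σ ▸ a ≈ τ ▸ b ∶ Γ ▷ A
  ⊢▸≈ {Γ = Γ} {A = A} e@(subst≈-ok tσ tτ στ) tA ab = subst≈-ok
    (⊢▸ tσ (left ab))
    (⊢▸ tτ (conv (type-cong e tA) (right ab)))
    (λ { zero → ≈≡ (sym (wk-▸ A)) ab ; (suc i) → ≈≡ (sym (wk-▸ (lookup Γ i))) (στ i) })

  ⊢conv : Γ ⊢ A ≈ A′ type → Γ ▷ A′ ⊢ˢ var ∶ Γ ▷ A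
  ⊢conv {Γ = Γ} {A = A} e = subst-ok (⊢▷ tA′)
    (λ { zero → ⊢≡ (sym ([var] (wk A))) (conv (type-sym (wk-type≈ tA′ e)) (⊢x₀ tA′))
       ; (suc i) → ⊢≡ (sym ([var] (wk (lookup Γ i)))) (variable-rule (⊢▷ tA′) (suc i)) })
    where tA′ = rightᵗ e

  ctx-term : Γ ⊢ A ≈ A′ type → Γ ▷ A ⊢ b ∶ B → Γ ▷ A′ ⊢ b ∶ B
  ctx-term {b = b} {B = B} e tb = ⊢≡ ([var] B) (⊢≡ᵗ ([var] b) (sub-term (⊢conv e) tb))

  ctx-term≈ : Γ ⊢ A ≈ A′ type → Γ ▷ A ⊢ b ≈ b′ ∶ B → Γ ▷ A′ ⊢ b ≈ b′ ∶ B
  ctx-term≈ {b = b} {b′ = b′} {B = B} e tb =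
    ≈≡ ([var] B) (≈-≡ ([var] b) ([var] b′) (sub-term≈ (⊢conv e) tb))

  ⊢IdTy : Γ ⊢ A type → Γ ▷ A ▷ wk A ⊢ Id (wk (wk A)) x₁ x₀ type
  ⊢IdTy tA = Id-form (wk-type tA¹ tA¹) (wk-term tA¹ (⊢x₀ tA)) (⊢x₀ tA¹)
    where tA¹ = wk-type tA tA

  ⊢▷Id : Γ ⊢ A type → ⊢ Γ ▷Id A
  ⊢▷Id tA = ⊢▷ (⊢IdTy tA)

  ⊢▸³ : Δ ⊢ˢ σ ∶ Γ → Δ ⊢ a ∶ A [ σ ] → Δ ⊢ b ∶ A [ σ ] → Δ ⊢ p ∶ Id (A [ σ ]) a b →
        Δ ⊢ˢ σ ▸ a ▸ b ▸ p ∶ Γ ▷Id A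
  ⊢▸³ {A = A} tσ ta tb tp =
    ⊢▸ (⊢▸ (⊢▸ tσ ta) (⊢≡ (sym (wk-▸ A)) tb))
       (⊢≡ (Id≡ (sym (trans (wk-▸ (wk A)) (wk-▸ A))) refl refl) tp)

  ⊢⟨_,_,_⟩ : Γ ⊢ a ∶ A → Γ ⊢ b ∶ A → Γ ⊢ p ∶ Id A a b → Γ ⊢ˢ var ▸ a ▸ b ▸ p ∶ Γ ▷Id A
  ⊢⟨_,_,_⟩ {A = A} ta tb tp =
    ⊢▸³ (⊢var (type⇒ctx (term⇒type ta))) (⊢≡ e ta) (⊢≡ e tb) (⊢≡ (Id≡ e refl refl) tp)
    where e = sym ([var] A)

  ⊢reflˢ : Γ ⊢ A type → Γ ▷ A ⊢ˢ reflˢ A ∶ Γ ▷Id A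
  ⊢reflˢ {A = A} tA =
    ⊢▸³ (⊢wkˢ tA) (⊢≡ e (⊢x₀ tA)) (⊢≡ e (⊢x₀ tA))
        (⊢≡ (Id≡ e refl refl) (Id-intro (wk-type tA tA) (⊢x₀ tA)))
    where e = sym ([wkˢ] A)

  module IdCtx {Γ : Ctx (ML₂+ 𝕊) n} {A : Ty (ML₂+ 𝕊) n} (tA : Γ ⊢ A type) where

    ⊢↑3 : Γ ▷Id A ⊢ˢ ↑ 3 ∶ Γ
    ⊢↑3 = ⊢▸⁻ (⊢▸⁻ (⊢▸⁻ (⊢var (⊢▷Id tA))))

    ⊢x : Γ ▷Id A ⊢ x₂ ∶ A [ ↑ 3 ]
    ⊢x = ⊢≡ (↑3 A) (variable-rule (⊢▷Id tA) (suc (suc zero)))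

    ⊢y : Γ ▷Id A ⊢ x₁ ∶ A [ ↑ 3 ]
    ⊢y = ⊢≡ (↑3 A) (variable-rule (⊢▷Id tA) (suc zero))

    ⊢p : Γ ▷Id A ⊢ x₀ ∶ Id (A [ ↑ 3 ]) x₂ x₁
    ⊢p = ⊢≡ (Id≡ (↑3 A) refl refl) (variable-rule (⊢▷Id tA) zero)

    module Extra {W : Ty (ML₂+ 𝕊) (3 + n)} (tW : Γ ▷Id A ⊢ W type) where

      ⊢↑4 : Γ ▷Id A ▷ W ⊢ˢ ↑ 4 ∶ Γ
      ⊢↑4 = ⊢▸⁻ (⊢▸⁻ (⊢▸⁻ (⊢▸⁻ (⊢var (⊢▷ tW)))))

      ⊢x¹ : Γ ▷Id A ▷ W ⊢ wk x₂ ∶ A [ ↑ 4 ]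
      ⊢x¹ = ⊢≡ (↑-suc 3 A) (wk-term tW ⊢x)

      ⊢y¹ : Γ ▷Id A ▷ W ⊢ wk x₁ ∶ A [ ↑ 4 ]
      ⊢y¹ = ⊢≡ (↑-suc 3 A) (wk-term tW ⊢y)

      ⊢p¹ : Γ ▷Id A ▷ W ⊢ wk x₀ ∶ Id (A [ ↑ 4 ]) (wk x₂) (wk x₁)
      ⊢p¹ = ⊢≡ (Id≡ (↑-suc 3 A) refl refl) (wk-term tW ⊢p)

  -- By discreteness, two elements of an identity type in context
  -- x, y : A, p : Id A x y (and a further variable w : W) are equal as soon
  -- as they are so at (x , x , r x).
  Id-ind : Γ ⊢ A type →
           Γ ▷Id A ⊢ D type → Γ ▷Id A ⊢ c ∶ D → Γ ▷Id A ⊢ d ∶ D →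
           Γ ▷Id A ⊢ u ∶ Id D c d → Γ ▷Id A ⊢ v ∶ Id D c d →
           Γ ▷ A ⊢ u [ reflˢ A ] ≈ v [ reflˢ A ] ∶ Id D c d [ reflˢ A ] →
           Γ ⊢ a ∶ A → Γ ⊢ b ∶ A → Γ ⊢ p ∶ Id A a b →
           Γ ⊢ u [ var ▸ a ▸ b ▸ p ] ≈ v [ var ▸ a ▸ b ▸ p ] ∶ Id D c d [ var ▸ a ▸ b ▸ p ]
  Id-ind {A = A} tA tD tc td tu tv uv ta tb tp =
    proj₁ (discrete (sub-type tι tD) (sub-term tι tc) (sub-term tι td)
                    (sub-term tι tu) (sub-term tι tv)
                    (Id-elim tA (Id-form tI tu tv)
                      (conv (Id-cong (type-refl tI′) (term-refl (left uv)) uv)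
                            (Id-intro tI′ (left uv)))
                      ta tb tp))
    where
    tι = ⊢⟨ ta , tb , tp ⟩
    tI = Id-form tD tc td
    tI′ = sub-type (⊢reflˢ tA) tI

  Id-ind₁ : Γ ⊢ A type → Γ ▷Id A ⊢ W type →
            Γ ▷Id A ▷ W ⊢ D type → Γ ▷Id A ▷ W ⊢ c ∶ D → Γ ▷Id A ▷ W ⊢ d ∶ D →
            Γ ▷Id A ▷ W ⊢ u ∶ Id D c d → Γ ▷Id A ▷ W ⊢ v ∶ Id D c d →
            Γ ▷ A ▷ W [ reflˢ A ] ⊢ u [ lift (reflˢ A) ] ≈ v [ lift (reflˢ A) ]
              ∶ Id D c d [ lift (reflˢ A) ] →
            Γ ⊢ a ∶ A → Γ ⊢ b ∶ A → Γ ⊢ p ∶ Id A a b → Γ ⊢ w ∶ W [ var ▸ a ▸ b ▸ p ] →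
            Γ ⊢ u [ var ▸ a ▸ b ▸ p ▸ w ] ≈ v [ var ▸ a ▸ b ▸ p ▸ w ]
              ∶ Id D c d [ var ▸ a ▸ b ▸ p ▸ w ]
  Id-ind₁ {A = A} {D = D} {c = c} {d = d} {u = u} {v = v} tA tW tD tc td tu tv uv ta tb tp tw =
    proj₁ (discrete (sub-type tι tD) (sub-term tι tc) (sub-term tι td)
                    (sub-term tι tu) (sub-term tι tv)
                    (⊢≡ (lift-⟨⟩ (Id (Id D c d) u v))
                      (Π-elim (sub-type tι₃ tW) (sub-type (⊢lift tι₃ tW) tR)
                        (Id-elim tA (Π-form tW tR)
                          (Π-intro (sub-type tδ tW) (sub-type (⊢lift tδ tW) tR)
                            (conv (Id-cong (type-refl tI′) (term-refl (left uv)) uv)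
                                  (Id-intro tI′ (left uv))))
                          ta tb tp)
                        tw)))
    where
    tδ = ⊢reflˢ tA
    tι₃ = ⊢⟨ ta , tb , tp ⟩
    tι = ⊢▸ tι₃ tw
    tI = Id-form tD tc td
    tR = Id-form tI tu tv
    tI′ = sub-type (⊢lift tδ tW) tI

  ⊢compose-type : Γ ⊢ A type → Γ ⊢ a ∶ A → Γ ▷Id A ⊢ compose-type A a type
  ⊢compose-type tA ta =
    Π-form tW (Id-form (sub-type ⊢↑4 tA) (sub-term ⊢↑4 ta) ⊢y¹)
    where
    open IdCtx tA
    tW = Id-form (sub-type ⊢↑3 tA) (sub-term ⊢↑3 ta) ⊢x
    open Extra tW

  ⊢compose-refl : Γ ⊢ A type → Γ ⊢ a ∶ A →
                  Γ ▷ A ⊢ compose-refl A a ∶ compose-type A a [ reflˢ A ]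
  ⊢compose-refl {A = A} {a = a} tA ta =
    ⊢≡ (sym (trans (compose-type-▸ A a)
              (cong₂ `Π (Id≡ ([wkˢ] A) ([wkˢ] a) refl)
                        (Id≡ (cong wk ([wkˢ] A)) (cong wk ([wkˢ] a)) refl))))
       (Π-intro tW (wk-type tW tW) (⊢x₀ tW))
    where
    tW = Id-form (wk-type tA tA) (wk-term tA ta) (⊢x₀ tA)

  compose-type-⟨⟩ : (A : Ty (ML₂+ 𝕊) n) (a : Tm (ML₂+ 𝕊) n) →
                    compose-type A a [ var ▸ b ▸ c ▸ q ] ≡
                    `Π (Id A a b) (Id (wk A) (wk a) (wk c))
  compose-type-⟨⟩ A a = trans (compose-type-▸ A a)
    (cong₂ `Π (Id≡ ([var] A) ([var] a) refl)
              (Id≡ (cong wk ([var] A)) (cong wk ([var] a)) refl))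

  compose-app-type : (A : Ty (ML₂+ 𝕊) n) (a c : Tm (ML₂+ 𝕊) n) →
                     Id (wk A) (wk a) (wk c) [ var ▸ p ] ≡ Id A a c
  compose-app-type A a c = Id≡ (wk-⟨⟩ A) (wk-⟨⟩ a) (wk-⟨⟩ c)

  ⊢compose : Γ ⊢ A type → Γ ⊢ a ∶ A → Γ ⊢ b ∶ A → Γ ⊢ c ∶ A →
             Γ ⊢ q ∶ Id A b c → Γ ⊢ p ∶ Id A a b → Γ ⊢ compose A a b c q p ∶ Id A a c
  ⊢compose {A = A} {a = a} {c = c} tA ta tb tc tq tp =
    ⊢≡ (compose-app-type A a c)
       (Π-elim tW (wk-type tW (Id-form tA ta tc))
         (⊢≡ (compose-type-⟨⟩ A a)
             (Id-elim tA (⊢compose-type tA ta) (⊢compose-refl tA ta) tb tc tq))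
         tp)
    where
    tW = Id-form tA ta tb

  compose-cong : Γ ⊢ A ≈ A′ type → Γ ⊢ a ≈ a′ ∶ A → Γ ⊢ b ≈ b′ ∶ A → Γ ⊢ c ≈ c′ ∶ A →
                 Γ ⊢ q ≈ q′ ∶ Id A b c → Γ ⊢ p ≈ p′ ∶ Id A a b →
                 Γ ⊢ compose A a b c q p ≈ compose A′ a′ b′ c′ q′ p′ ∶ Id A a c
  compose-cong {A = A} {a = a} {c = c} eA ea eb ec eq ep =
    ≈≡ (compose-app-type A a c)
       (app-cong eW (wk-type≈ (leftᵗ eW) (Id-cong eA ea ec))
         (≈≡ (compose-type-⟨⟩ A a)
             (J-cong eA
               (Π-cong (Id-cong (sub-type≈ ⊢↑3 eA) (sub-term≈ ⊢↑3 ea) (term-refl ⊢x))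
                       (Id-cong (sub-type≈ ⊢↑4 eA) (sub-term≈ ⊢↑4 ea) (term-refl ⊢y¹)))
               (≈≡ (sym (trans (compose-type-▸ A a)
                          (cong₂ `Π (Id≡ ([wkˢ] A) ([wkˢ] a) refl)
                                    (Id≡ (cong wk ([wkˢ] A)) (cong wk ([wkˢ] a)) refl))))
                   (lam-cong eV (wk-type≈ (leftᵗ eV) eV) (term-refl (⊢x₀ (leftᵗ eV)))))
               eb ec eq))
         ep)
    where
    tA = leftᵗ eA
    eW = Id-cong eA ea eb
    eV = Id-cong (wk-type≈ tA eA) (wk-term≈ tA ea) (term-refl (⊢x₀ tA))
    open IdCtx tA
    open Extra (Id-form (sub-type ⊢↑3 tA) (sub-term ⊢↑3 (left ea)) ⊢x)

  compose-rˡ : Γ ⊢ A type → Γ ⊢ a ∶ A → Γ ⊢ b ∶ A → Γ ⊢ p ∶ Id A a b →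
               Γ ⊢ compose A a b b (r A b) p ≈ p ∶ Id A a b
  compose-rˡ {A = A} {a = a} {b = b} tA ta tb tp =
    ≈≡ (compose-app-type A a b)
      (term-trans
        (app-cong (type-refl tW) (type-refl (wk-type tW tW))
          (≈-≡ refl lam-eq
            (≈≡ (compose-type-⟨⟩ A a)
                (Id-comp tA (⊢compose-type tA ta) (⊢compose-refl tA ta) tb)))
          (term-refl tp))
        (Π-comp tW (wk-type tW tW) (⊢x₀ tW) tp))
    where
    tW = Id-form tA ta tb
    lam-eq : compose-refl A a [ var ▸ b ] ≡ lam (Id A a b) (wk (Id A a b)) x₀
    lam-eq = cong₂ (λ X Y → lam X Y x₀)
      (Id≡ (wk-⟨⟩ A) (wk-⟨⟩ a) refl)
      (Id≡ (trans (wk-lift (wk A) _) (cong wk (wk-⟨⟩ A)))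
           (trans (wk-lift (wk a) _) (cong wk (wk-⟨⟩ a))) refl)

  compose-rʳ : Γ ⊢ A type → Γ ⊢ a ∶ A → Γ ⊢ b ∶ A → Γ ⊢ p ∶ Id A a b →
               Γ ⊢ compose A a a b p (r A a) ≈ p ∶ Id A a b
  compose-rʳ {A = A} {a = a} {b = b} {p = p} tA ta tb tp =
    ≈≡ (Id≡ A-eq refl refl)
      (≈-≡ (trans (compose-sub (A [ ↑ 3 ]) x₂ x₂ x₁ x₀ (r (A [ ↑ 3 ]) x₂) (var ▸ a ▸ b ▸ p))
                  (compose≡ A-eq refl refl refl refl (cong₂ r A-eq refl)))
           refl
        (Id-ind {D = A [ ↑ 3 ]} {c = x₂} {d = x₁}
                {u = compose (A [ ↑ 3 ]) x₂ x₂ x₁ x₀ (r (A [ ↑ 3 ]) x₂)} {v = x₀}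
          tA tA³ ⊢x ⊢y (⊢compose tA³ ⊢x ⊢x ⊢y ⊢p (Id-intro tA³ ⊢x)) ⊢p
          (≈-≡ (sym (trans (compose-sub (A [ ↑ 3 ]) x₂ x₂ x₁ x₀ (r (A [ ↑ 3 ]) x₂) (reflˢ A))
                           (compose≡ A-eqδ refl refl refl refl (cong₂ r A-eqδ refl))))
               refl
            (≈≡ (sym (Id≡ A-eqδ refl refl))
              (compose-rˡ tA¹ (⊢x₀ tA) (⊢x₀ tA) (Id-intro tA¹ (⊢x₀ tA)))))
          ta tb tp))
    where
    open IdCtx tA
    tA³ = sub-type ⊢↑3 tA
    tA¹ = wk-type tA tA
    A-eq : {p : Tm (ML₂+ 𝕊) _} → A [ ↑ 3 ] [ var ▸ a ▸ b ▸ p ] ≡ A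
    A-eq = trans (↑-sub 3 A) ([var] A)
    A-eqδ : A [ ↑ 3 ] [ reflˢ A ] ≡ wk A
    A-eqδ = trans (↑-sub 3 A) ([wkˢ] A)

  compose-assoc : Γ ⊢ A type → Γ ⊢ a ∶ A → Γ ⊢ b ∶ A → Γ ⊢ c ∶ A → Γ ⊢ d ∶ A →
                  Γ ⊢ h ∶ Id A c d → Γ ⊢ q ∶ Id A b c → Γ ⊢ p ∶ Id A a b →
                  Γ ⊢ compose A a b d (compose A b c d h q) p ≈
                      compose A a c d h (compose A a b c q p) ∶ Id A a d
  compose-assoc {A = A} {a = a} {b = b} {c = c} {d = d} {h = h} {q = q} {p = p}
                tA ta tb tc td th tq tp =
    ≈≡ (Id≡ (ι A) (ι a) refl)
      (≈-≡ (trans (uτ ι⁴) (compose≡ (ι A) (ι a) (ι b) refl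
                            (compose≡ (ι A) (ι b) refl refl refl refl) (ι p)))
           (trans (vτ ι⁴) (compose≡ (ι A) (ι a) refl refl refl
                            (compose≡ (ι A) (ι a) (ι b) refl refl (ι p))))
        (Id-ind₁ {D = A⁴} {c = a⁴} {d = wk x₁} {u = u⁴} {v = v⁴} tA tW tA⁴ ta⁴ ⊢y¹ tu tv base tc td th
          (⊢≡ (sym (Id≡ (trans (↑-sub 3 A) ([var] A)) (trans (↑-sub 3 b) ([var] b)) refl)) tq)))
    where
    open IdCtx tA
    tW = Id-form (sub-type ⊢↑3 tA) (sub-term ⊢↑3 tb) ⊢x
    open Extra tW
    N = ML₂+ 𝕊
    ι⁴ = var ▸ c ▸ d ▸ h ▸ q
    A⁴ = A [ ↑ 4 ]
    a⁴ = a [ ↑ 4 ]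
    b⁴ = b [ ↑ 4 ]
    p⁴ = p [ ↑ 4 ]
    tA⁴ = sub-type ⊢↑4 tA
    ta⁴ = sub-term ⊢↑4 ta
    tb⁴ = sub-term ⊢↑4 tb
    tp⁴ = sub-term ⊢↑4 tp
    tq⁴ : _ ▷Id A ▷ _ ⊢ x₀ ∶ Id A⁴ b⁴ (wk x₂)
    tq⁴ = ⊢≡ (Id≡ (↑-suc 3 A) (↑-suc 3 b) refl) (⊢x₀ tW)
    u⁴ = compose A⁴ a⁴ b⁴ (wk x₁) (compose A⁴ b⁴ (wk x₂) (wk x₁) (wk x₀) x₀) p⁴
    v⁴ = compose A⁴ a⁴ (wk x₂) (wk x₁) (wk x₀) (compose A⁴ a⁴ b⁴ (wk x₂) x₀ p⁴)
    tu = ⊢compose tA⁴ ta⁴ tb⁴ ⊢y¹ (⊢compose tA⁴ tb⁴ ⊢x¹ ⊢y¹ ⊢p¹ tq⁴) tp⁴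
    tv = ⊢compose tA⁴ ta⁴ ⊢x¹ ⊢y¹ ⊢p¹ (⊢compose tA⁴ ta⁴ tb⁴ ⊢x¹ tq⁴ tp⁴)
    ι : (e : Exp N s _) → e [ ↑ 4 ] [ ι⁴ ] ≡ e
    ι e = trans (↑-sub 4 e) ([var] e)
    uτ : (τ : Sub N _ n) →
         u⁴ [ τ ] ≡
         compose (A⁴ [ τ ]) (a⁴ [ τ ]) (b⁴ [ τ ]) (wk x₁ [ τ ])
           (compose (A⁴ [ τ ]) (b⁴ [ τ ]) (wk x₂ [ τ ]) (wk x₁ [ τ ]) (wk x₀ [ τ ]) (x₀ [ τ ]))
           (p⁴ [ τ ])
    uτ τ = trans (compose-sub A⁴ a⁴ b⁴ (wk x₁)
                            (compose A⁴ b⁴ (wk x₂) (wk x₁) (wk x₀) x₀) p⁴ τ)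
      (compose≡ refl refl refl refl (compose-sub A⁴ b⁴ (wk x₂) (wk x₁) (wk x₀) x₀ τ) refl)
    vτ : (τ : Sub N _ n) →
         v⁴ [ τ ] ≡
         compose (A⁴ [ τ ]) (a⁴ [ τ ]) (wk x₂ [ τ ]) (wk x₁ [ τ ]) (wk x₀ [ τ ])
           (compose (A⁴ [ τ ]) (a⁴ [ τ ]) (b⁴ [ τ ]) (wk x₂ [ τ ]) (x₀ [ τ ]) (p⁴ [ τ ]))
    vτ τ = trans (compose-sub A⁴ a⁴ (wk x₂) (wk x₁) (wk x₀)
                            (compose A⁴ a⁴ b⁴ (wk x₂) x₀ p⁴) τ)
      (compose≡ refl refl refl refl refl (compose-sub A⁴ a⁴ b⁴ (wk x₂) x₀ p⁴ τ))
    δ = lift (reflˢ A)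
    tδ = ⊢lift (⊢reflˢ tA) tW
    r-eq : r (wk (wk A)) x₁ ≡ r (A⁴ [ δ ]) x₁
    r-eq = cong₂ r (sym (trans (↑-lift 3 A) (cong wk ([wkˢ] A)))) refl
    sA = sub-type tδ tA⁴
    sa = sub-term tδ ta⁴
    sb = sub-term tδ tb⁴
    sp = sub-term tδ tp⁴
    sx = sub-term tδ ⊢x¹
    sq = sub-term tδ tq⁴
    base = ≈-≡ (sym (trans (uτ δ)
                       (compose≡ refl refl refl refl (compose≡ refl refl refl refl r-eq refl) refl)))
               (sym (trans (vτ δ) (compose≡ refl refl refl refl r-eq refl)))
      (term-trans
        (compose-cong (type-refl sA) (term-refl sa) (term-refl sb) (term-refl sx)
          (compose-rˡ sA sb sx sq) (term-refl sp))
        (term-sym (compose-rˡ sA sa sx (⊢compose sA sa sb sx sq sp))))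

  ⊢inst : Γ ▷ A ⊢ g ∶ wk B → Δ ⊢ˢ σ ∶ Γ → Δ ⊢ a ∶ A [ σ ] → Δ ⊢ g [ σ ▸ a ] ∶ B [ σ ]
  ⊢inst {B = B} tg tσ ta = ⊢≡ (wk-▸ B) (sub-term (⊢▸ tσ ta) tg)

  ⊢inst₁ : Γ ▷ A ⊢ g ∶ wk B → Γ ⊢ a ∶ A → Γ ⊢ g [ var ▸ a ] ∶ B
  ⊢inst₁ {A = A} {B = B} tg ta =
    ⊢≡ ([var] B) (⊢inst tg (⊢var (type⇒ctx (term⇒type ta))) (⊢≡ (sym ([var] A)) ta))

  inst₁≈ : Γ ▷ A ⊢ g ≈ g′ ∶ wk B → Γ ⊢ a ≈ a′ ∶ A → Γ ⊢ g [ var ▸ a ] ≈ g′ [ var ▸ a′ ] ∶ B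
  inst₁≈ {A = A} {B = B} eg ea =
    ≈≡ (wk-⟨⟩ B)
      (term-trans
        (term-cong (⊢▸≈ (⊢ˢ-refl tv) tA (≈≡ (sym ([var] A)) ea)) (left eg))
        (conv≈ (ty≈≡ (sym (wk-⟨⟩ B)) (sym (wk-⟨⟩ B)) (type-refl (term⇒type (⊢inst₁ (left eg) (left ea)))))
          (sub-term≈ (⊢▸ tv (⊢≡ (sym ([var] A)) (right ea))) eg)))
    where
    tA = term⇒type (left ea)
    tv = ⊢var (type⇒ctx tA)

  ⊢under : Γ ▷ A ⊢ g ∶ wk B → Δ ⊢ˢ σ ∶ Γ → Γ ⊢ A type → Δ ▷ A [ σ ] ⊢ g [ lift σ ] ∶ wk (B [ σ ])
  ⊢under {B = B} tg tσ tA = ⊢≡ (wk-lift B _) (sub-term (⊢lift tσ tA) tg)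

  ⊢apply-type : Γ ⊢ A type → Γ ⊢ B type → Γ ▷ A ⊢ g ∶ wk B → Γ ▷Id A ⊢ apply-type B g type
  ⊢apply-type tA tB tg =
    Id-form (sub-type ⊢↑3 tB) (⊢inst tg ⊢↑3 ⊢x) (⊢inst tg ⊢↑3 ⊢y)
    where open IdCtx tA

  apply-type-reflˢ : (B : Ty (ML₂+ 𝕊) n) (g : Tm (ML₂+ 𝕊) (suc n)) →
                     Id (wk B) g g ≡ apply-type B g [ reflˢ A ]
  apply-type-reflˢ B g = sym (trans (apply-type-▸ B g) (Id≡ ([wkˢ] B) ([wkˢ▸x₀] g) ([wkˢ▸x₀] g)))

  apply-type-⟨⟩ : (B : Ty (ML₂+ 𝕊) n) (g : Tm (ML₂+ 𝕊) (suc n)) →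
                  apply-type B g [ var ▸ a ▸ b ▸ p ] ≡ Id B (g [ var ▸ a ]) (g [ var ▸ b ])
  apply-type-⟨⟩ B g = trans (apply-type-▸ B g) (Id≡ ([var] B) refl refl)

  ⊢apply-refl : Γ ⊢ A type → Γ ⊢ B type → Γ ▷ A ⊢ g ∶ wk B →
                Γ ▷ A ⊢ r (wk B) g ∶ apply-type B g [ reflˢ A ]
  ⊢apply-refl {B = B} {g = g} tA tB tg =
    ⊢≡ (apply-type-reflˢ B g) (Id-intro (wk-type tA tB) tg)

  ⊢apply : Γ ⊢ A type → Γ ⊢ B type → Γ ▷ A ⊢ g ∶ wk B →
           Γ ⊢ a ∶ A → Γ ⊢ b ∶ A → Γ ⊢ p ∶ Id A a b →
           Γ ⊢ apply A B g a b p ∶ Id B (g [ var ▸ a ]) (g [ var ▸ b ])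
  ⊢apply {B = B} {g = g} tA tB tg ta tb tp =
    ⊢≡ (apply-type-⟨⟩ B g)
       (Id-elim tA (⊢apply-type tA tB tg) (⊢apply-refl tA tB tg) ta tb tp)

  apply-cong : Γ ⊢ A ≈ A′ type → Γ ⊢ B ≈ B′ type → Γ ▷ A ⊢ g ≈ g′ ∶ wk B →
               Γ ⊢ a ≈ a′ ∶ A → Γ ⊢ b ≈ b′ ∶ A → Γ ⊢ p ≈ p′ ∶ Id A a b →
               Γ ⊢ apply A B g a b p ≈ apply A′ B′ g′ a′ b′ p′
                 ∶ Id B (g [ var ▸ a ]) (g [ var ▸ b ])
  apply-cong {Γ = Γ} {A = A} {B = B} {g = g} {g′ = g′} eA eB eg ea eb ep =
    ≈≡ (apply-type-⟨⟩ B g)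
      (J-cong eA
        (Id-cong (sub-type≈ ⊢↑3 eB) (at ⊢x) (at ⊢y))
        (≈≡ (apply-type-reflˢ B g) (r-cong (wk-type≈ tA eB) eg))
        ea eb ep)
    where
    tA = leftᵗ eA
    open IdCtx tA
    at : {x : Tm (ML₂+ 𝕊) _} → Γ ▷Id A ⊢ x ∶ A [ ↑ 3 ] →
         Γ ▷Id A ⊢ g [ ↑ 3 ▸ x ] ≈ g′ [ ↑ 3 ▸ x ] ∶ B [ ↑ 3 ]
    at tt = ≈≡ (wk-▸ B) (sub-term≈ (⊢▸ ⊢↑3 tt) eg)

  apply-r : Γ ⊢ A type → Γ ⊢ B type → Γ ▷ A ⊢ g ∶ wk B → Γ ⊢ a ∶ A →
            Γ ⊢ apply A B g a a (r A a) ≈ r B (g [ var ▸ a ])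
              ∶ Id B (g [ var ▸ a ]) (g [ var ▸ a ])
  apply-r {B = B} {g = g} tA tB tg ta =
    ≈≡ (apply-type-⟨⟩ B g) (≈-≡ refl (cong₂ r (wk-⟨⟩ B) refl)
      (Id-comp tA (⊢apply-type tA tB tg) (⊢apply-refl tA tB tg) ta))

  apply-id : Γ ⊢ A type → Γ ⊢ a ∶ A → Γ ⊢ b ∶ A → Γ ⊢ p ∶ Id A a b →
             Γ ⊢ apply A A x₀ a b p ≈ p ∶ Id A a b
  apply-id {A = A} {a = a} {b = b} {p = p} tA ta tb tp =
    ≈≡ (Id≡ A-eq refl refl)
      (≈-≡ (trans (uτ (var ▸ a ▸ b ▸ p)) (apply≡ A-eq A-eq refl refl refl refl)) refl
        (Id-ind {D = A³} {c = x₂} {d = x₁} {u = u³} {v = x₀} tA tA³ ⊢x ⊢y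
          (⊢apply tA³ tA³ (⊢x₀ tA³) ⊢x ⊢y ⊢p) ⊢p
          (≈-≡ (sym (trans (uτ (reflˢ A)) (apply≡ refl refl refl refl refl r-eq))) (sym r-eq)
            (apply-r sA sA (⊢x₀ sA) sx))
          ta tb tp))
    where
    open IdCtx tA
    A³ = A [ ↑ 3 ]
    tA³ = sub-type ⊢↑3 tA
    u³ = apply A³ A³ x₀ x₂ x₁ x₀
    uτ : (τ : Sub (ML₂+ 𝕊) _ n) →
         u³ [ τ ] ≡ apply (A³ [ τ ]) (A³ [ τ ]) x₀ (x₂ [ τ ]) (x₁ [ τ ]) (x₀ [ τ ])
    uτ τ = apply-sub A³ A³ x₀ x₂ x₁ x₀ τ
    A-eq : A³ [ var ▸ a ▸ b ▸ p ] ≡ A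
    A-eq = trans (↑-sub 3 A) ([var] A)
    r-eq : r (wk A) x₀ ≡ r (A³ [ reflˢ A ]) x₀
    r-eq = cong₂ r (sym (trans (↑-sub 3 A) ([wkˢ] A))) refl
    sA = sub-type (⊢reflˢ tA) tA³
    sx = sub-term (⊢reflˢ tA) ⊢x

  apply-∘ : Γ ⊢ A type → Γ ⊢ B type → Γ ⊢ C type →
            Γ ▷ B ⊢ h ∶ wk C → Γ ▷ A ⊢ g ∶ wk B →
            Γ ⊢ a ∶ A → Γ ⊢ b ∶ A → Γ ⊢ p ∶ Id A a b →
            Γ ⊢ apply A C (h [ wkˢ ▸ g ]) a b p ≈
                apply B C h (g [ var ▸ a ]) (g [ var ▸ b ]) (apply A B g a b p)
              ∶ Id C (h [ wkˢ ▸ g ] [ var ▸ a ]) (h [ wkˢ ▸ g ] [ var ▸ b ])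
  apply-∘ {n} {A = A} {B = B} {C = C} {h = h} {g = g} {a = a} {b = b} {p = p}
          tA tB tC th tg ta tb tp =
    ≈≡ (Id≡ (ι C) (trans (⟨⟩-sub hg³ {x₂} {ι³}) (▸≡ (ιₗ hg))) (trans (⟨⟩-sub hg³ {x₁} {ι³}) (▸≡ (ιₗ hg))))
      (≈-≡ (trans (uτ ι³) (apply≡ (ι A) (ι C) (ιₗ hg) refl refl refl))
           (trans (vτ ι³) (apply≡ (ι B) (ι C) (ιₗ h) (▸≡ (ιₗ g)) (▸≡ (ιₗ g))
                                  (apply≡ (ι A) (ι B) (ιₗ g) refl refl refl)))
        (Id-ind {D = C³} {c = hg³ [ var ▸ x₂ ]} {d = hg³ [ var ▸ x₁ ]} {u = u³} {v = v³}
          tA tC³ (⊢inst₁ thg³ ⊢x) (⊢inst₁ thg³ ⊢y) tu tv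
          (≈-≡ (sym (trans (uτ δ) (apply≡ refl refl refl refl refl r-eq)))
               (sym (trans (vτ δ) (apply≡ refl refl refl refl refl (apply≡ refl refl refl refl refl r-eq))))
            (≈≡ (sym (Id≡ refl (⟨⟩-sub hg³ {x₂} {δ}) (⟨⟩-sub hg³ {x₁} {δ})))
            (term-trans
              (apply-r sA sC sf sx)
              (term-sym
                (≈-≡ refl (cong₂ r refl (sym fδ))
                (≈≡ (Id≡ refl (sym fδ) (sym fδ))
                (term-trans
                  (apply-cong (type-refl sB) (type-refl sC) (term-refl sh)
                    (term-refl (⊢inst₁ sg sx)) (term-refl (⊢inst₁ sg sx)) (apply-r sA sB sg sx))
                  (apply-r sB sC sh (⊢inst₁ sg sx)))))))))
          ta tb tp))
    where
    open IdCtx tA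
    N = ML₂+ 𝕊
    ι³ = var ▸ a ▸ b ▸ p
    hg = h [ wkˢ ▸ g ]
    A³ = A [ ↑ 3 ]
    B³ = B [ ↑ 3 ]
    C³ = C [ ↑ 3 ]
    hg³ = hg [ lift (↑ 3) ]
    g³ = g [ lift (↑ 3) ]
    h³ = h [ lift (↑ 3) ]
    thg = ⊢≡ ([wkˢ] C) (⊢inst th (⊢wkˢ tA) (⊢≡ (sym ([wkˢ] B)) tg))
    tA³ = sub-type ⊢↑3 tA
    tB³ = sub-type ⊢↑3 tB
    tC³ = sub-type ⊢↑3 tC
    thg³ = ⊢under thg ⊢↑3 tA
    tg³ = ⊢under tg ⊢↑3 tA
    th³ = ⊢under th ⊢↑3 tB
    u³ = apply A³ C³ hg³ x₂ x₁ x₀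
    v³ = apply B³ C³ h³ (g³ [ var ▸ x₂ ]) (g³ [ var ▸ x₁ ]) (apply A³ B³ g³ x₂ x₁ x₀)
    tu = ⊢apply tA³ tC³ thg³ ⊢x ⊢y ⊢p
    f-eq : {x : Tm N _} → h³ [ var ▸ g³ [ var ▸ x ] ] ≡ hg³ [ var ▸ x ]
    f-eq {x} = trans (lift-⟨⟩ h) (sym (trans (lift-⟨⟩ hg) (trans (▸-sub h {wkˢ} {g} {↑ 3 ▸ x})
                 (▸-cong h (λ _ → refl) (sym (lift-⟨⟩ g))))))
    tv = ⊢≡ (Id≡ refl f-eq f-eq)
      (⊢apply tB³ tC³ th³ (⊢inst₁ tg³ ⊢x) (⊢inst₁ tg³ ⊢y) (⊢apply tA³ tB³ tg³ ⊢x ⊢y ⊢p))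
    ▸≡ : {e e′ : Tm N (suc n)} {x : Tm N n} → e ≡ e′ → e [ var ▸ x ] ≡ e′ [ var ▸ x ]
    ▸≡ = cong _[ var ▸ _ ]
    ι : (e : Exp N s _) → e [ ↑ 3 ] [ ι³ ] ≡ e
    ι e = trans (↑-sub 3 e) ([var] e)
    ιₗ : (e : Exp N s _) → e [ lift (↑ 3) ] [ lift ι³ ] ≡ e
    ιₗ e = trans (lift-lift e) (sub-id (lift-sub-id (λ _ → refl) 1) e)
    uτ : ∀ {k} (τ : Sub N _ k) →
         u³ [ τ ] ≡ apply (A³ [ τ ]) (C³ [ τ ]) (hg³ [ lift τ ]) (x₂ [ τ ]) (x₁ [ τ ]) (x₀ [ τ ])
    uτ τ = apply-sub A³ C³ hg³ x₂ x₁ x₀ τ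
    vτ : ∀ {k} (τ : Sub N _ k) →
         v³ [ τ ] ≡ apply (B³ [ τ ]) (C³ [ τ ]) (h³ [ lift τ ])
           (g³ [ lift τ ] [ var ▸ x₂ [ τ ] ]) (g³ [ lift τ ] [ var ▸ x₁ [ τ ] ])
           (apply (A³ [ τ ]) (B³ [ τ ]) (g³ [ lift τ ]) (x₂ [ τ ]) (x₁ [ τ ]) (x₀ [ τ ]))
    vτ τ = trans (apply-sub B³ C³ h³ (g³ [ var ▸ x₂ ]) (g³ [ var ▸ x₁ ]) (apply A³ B³ g³ x₂ x₁ x₀) τ)
      (apply≡ refl refl refl (⟨⟩-sub g³ {x₂} {τ}) (⟨⟩-sub g³ {x₁} {τ}) (apply-sub A³ B³ g³ x₂ x₁ x₀ τ))
    δ = reflˢ A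
    tδ = ⊢reflˢ tA
    r-eq : r (wk A) x₀ ≡ r (A³ [ δ ]) x₀
    r-eq = cong₂ r (sym (trans (↑-sub 3 A) ([wkˢ] A))) refl
    sA = sub-type tδ tA³
    sB = sub-type tδ tB³
    sC = sub-type tδ tC³
    sf = ⊢under thg³ tδ tA³
    sg = ⊢under tg³ tδ tA³
    sh = ⊢under th³ tδ tB³
    sx = sub-term tδ ⊢x
    fδ : hg³ [ lift δ ] [ var ▸ x₀ ] ≡ h³ [ lift δ ] [ var ▸ g³ [ lift δ ] [ var ▸ x₀ ] ]
    fδ = trans (sym (⟨⟩-sub hg³ {x₂} {δ})) (trans (cong _[ δ ] (sym f-eq))
           (trans (⟨⟩-sub h³ {g³ [ var ▸ x₂ ]} {δ})
             (▸-cong (h³ [ lift δ ]) (λ _ → refl) (⟨⟩-sub g³ {x₂} {δ}))))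

  ⊢inst-Id : Γ ▷ A ⊢ p ∶ Id (wk B) g g′ → Γ ⊢ a ∶ A →
             Γ ⊢ p [ var ▸ a ] ∶ Id B (g [ var ▸ a ]) (g′ [ var ▸ a ])
  ⊢inst-Id {A = A} {B = B} tp ta =
    ⊢≡ (Id≡ (wk-⟨⟩ B) refl refl)
       (sub-term (⊢▸ (⊢var (type⇒ctx (term⇒type ta))) (⊢≡ (sym ([var] A)) ta)) tp)

  apply-natural : Γ ⊢ A type → Γ ⊢ B type → Γ ▷ A ⊢ g ∶ wk B → Γ ▷ A ⊢ g′ ∶ wk B →
                  Γ ▷ A ⊢ q ∶ Id (wk B) g g′ →
                  Γ ⊢ a ∶ A → Γ ⊢ b ∶ A → Γ ⊢ p ∶ Id A a b →
                  Γ ⊢ compose B (g [ var ▸ a ]) (g [ var ▸ b ]) (g′ [ var ▸ b ])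
                        (q [ var ▸ b ]) (apply A B g a b p) ≈
                      compose B (g [ var ▸ a ]) (g′ [ var ▸ a ]) (g′ [ var ▸ b ])
                        (apply A B g′ a b p) (q [ var ▸ a ])
                    ∶ Id B (g [ var ▸ a ]) (g′ [ var ▸ b ])
  apply-natural {n} {A = A} {B = B} {g = g} {g′ = g′} {q = q} {a = a} {b = b} {p = p}
                tA tB tg tg′ tq ta tb tp =
    ≈≡ (Id≡ (ι B) (at g {x₂}) (at g′ {x₁}))
      (≈-≡ (trans (uτ ι³) (compose≡ (ι B) (▸≡ (ιₗ g)) (▸≡ (ιₗ g)) (▸≡ (ιₗ g′)) (▸≡ (ιₗ q))
                             (apply≡ (ι A) (ι B) (ιₗ g) refl refl refl)))
           (trans (vτ ι³) (compose≡ (ι B) (▸≡ (ιₗ g)) (▸≡ (ιₗ g′)) (▸≡ (ιₗ g′))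
                             (apply≡ (ι A) (ι B) (ιₗ g′) refl refl refl) (▸≡ (ιₗ q))))
        (Id-ind {D = B³} {c = g³ [ var ▸ x₂ ]} {d = g′³ [ var ▸ x₁ ]} {u = u³} {v = v³}
          tA tB³ (⊢inst₁ tg³ ⊢x) (⊢inst₁ tg′³ ⊢y) tu tv base ta tb tp))
    where
    open IdCtx tA
    N = ML₂+ 𝕊
    ι³ = var ▸ a ▸ b ▸ p
    A³ = A [ ↑ 3 ]
    B³ = B [ ↑ 3 ]
    g³ = g [ lift (↑ 3) ]
    g′³ = g′ [ lift (↑ 3) ]
    q³ = q [ lift (↑ 3) ]
    tA³ = sub-type ⊢↑3 tA
    tB³ = sub-type ⊢↑3 tB
    tg³ = ⊢under tg ⊢↑3 tA
    tg′³ = ⊢under tg′ ⊢↑3 tA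
    tq³ = ⊢≡ (Id≡ (wk-lift B (↑ 3)) refl refl) (sub-term (⊢lift ⊢↑3 tA) tq)
    u³ = compose B³ (g³ [ var ▸ x₂ ]) (g³ [ var ▸ x₁ ]) (g′³ [ var ▸ x₁ ])
           (q³ [ var ▸ x₁ ]) (apply A³ B³ g³ x₂ x₁ x₀)
    v³ = compose B³ (g³ [ var ▸ x₂ ]) (g′³ [ var ▸ x₂ ]) (g′³ [ var ▸ x₁ ])
           (apply A³ B³ g′³ x₂ x₁ x₀) (q³ [ var ▸ x₂ ])
    tu = ⊢compose tB³ (⊢inst₁ tg³ ⊢x) (⊢inst₁ tg³ ⊢y) (⊢inst₁ tg′³ ⊢y)
           (⊢inst-Id tq³ ⊢y) (⊢apply tA³ tB³ tg³ ⊢x ⊢y ⊢p)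
    tv = ⊢compose tB³ (⊢inst₁ tg³ ⊢x) (⊢inst₁ tg′³ ⊢x) (⊢inst₁ tg′³ ⊢y)
           (⊢apply tA³ tB³ tg′³ ⊢x ⊢y ⊢p) (⊢inst-Id tq³ ⊢x)
    ▸≡ : {e e′ : Tm N (suc n)} {x : Tm N n} → e ≡ e′ → e [ var ▸ x ] ≡ e′ [ var ▸ x ]
    ▸≡ = cong _[ var ▸ _ ]
    ι : (e : Exp N s _) → e [ ↑ 3 ] [ ι³ ] ≡ e
    ι e = trans (↑-sub 3 e) ([var] e)
    ιₗ : (e : Exp N s _) → e [ lift (↑ 3) ] [ lift ι³ ] ≡ e
    ιₗ e = trans (lift-lift e) (sub-id (lift-sub-id (λ _ → refl) 1) e)
    at : (e : Tm N _) {x : Tm N _} →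
         e [ lift (↑ 3) ] [ var ▸ x ] [ ι³ ] ≡ e [ var ▸ (x [ ι³ ]) ]
    at e {x} = trans (⟨⟩-sub (e [ lift (↑ 3) ]) {x} {ι³}) (▸≡ (ιₗ e))
    uτ : ∀ {k} (τ : Sub N _ k) →
         u³ [ τ ] ≡ compose (B³ [ τ ]) (g³ [ lift τ ] [ var ▸ x₂ [ τ ] ])
           (g³ [ lift τ ] [ var ▸ x₁ [ τ ] ]) (g′³ [ lift τ ] [ var ▸ x₁ [ τ ] ])
           (q³ [ lift τ ] [ var ▸ x₁ [ τ ] ])
           (apply (A³ [ τ ]) (B³ [ τ ]) (g³ [ lift τ ]) (x₂ [ τ ]) (x₁ [ τ ]) (x₀ [ τ ]))
    uτ τ = trans (compose-sub B³ (g³ [ var ▸ x₂ ]) (g³ [ var ▸ x₁ ]) (g′³ [ var ▸ x₁ ])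
                    (q³ [ var ▸ x₁ ]) (apply A³ B³ g³ x₂ x₁ x₀) τ)
      (compose≡ refl (⟨⟩-sub g³ {x₂} {τ}) (⟨⟩-sub g³ {x₁} {τ}) (⟨⟩-sub g′³ {x₁} {τ})
        (⟨⟩-sub q³ {x₁} {τ}) (apply-sub A³ B³ g³ x₂ x₁ x₀ τ))
    vτ : ∀ {k} (τ : Sub N _ k) →
         v³ [ τ ] ≡ compose (B³ [ τ ]) (g³ [ lift τ ] [ var ▸ x₂ [ τ ] ])
           (g′³ [ lift τ ] [ var ▸ x₂ [ τ ] ]) (g′³ [ lift τ ] [ var ▸ x₁ [ τ ] ])
           (apply (A³ [ τ ]) (B³ [ τ ]) (g′³ [ lift τ ]) (x₂ [ τ ]) (x₁ [ τ ]) (x₀ [ τ ]))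
           (q³ [ lift τ ] [ var ▸ x₂ [ τ ] ])
    vτ τ = trans (compose-sub B³ (g³ [ var ▸ x₂ ]) (g′³ [ var ▸ x₂ ]) (g′³ [ var ▸ x₁ ])
                    (apply A³ B³ g′³ x₂ x₁ x₀) (q³ [ var ▸ x₂ ]) τ)
      (compose≡ refl (⟨⟩-sub g³ {x₂} {τ}) (⟨⟩-sub g′³ {x₂} {τ}) (⟨⟩-sub g′³ {x₁} {τ})
        (apply-sub A³ B³ g′³ x₂ x₁ x₀ τ) (⟨⟩-sub q³ {x₂} {τ}))
    δ = reflˢ A
    tδ = ⊢reflˢ tA
    r-eq : r (wk A) x₀ ≡ r (A³ [ δ ]) x₀
    r-eq = cong₂ r (sym (trans (↑-sub 3 A) ([wkˢ] A))) refl
    sA = sub-type tδ tA³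
    sB = sub-type tδ tB³
    sg = ⊢under tg³ tδ tA³
    sg′ = ⊢under tg′³ tδ tA³
    sq = ⊢≡ (Id≡ (wk-lift B³ δ) refl refl) (sub-term (⊢lift tδ tA³) tq³)
    sx = sub-term tδ ⊢x
    gx = ⊢inst₁ sg sx
    g′x = ⊢inst₁ sg′ sx
    qx = ⊢inst-Id sq sx
    base = ≈≡ (sym (Id≡ refl (⟨⟩-sub g³ {x₂} {δ}) (⟨⟩-sub g′³ {x₁} {δ})))
      (≈-≡ (sym (trans (uτ δ) (compose≡ refl refl refl refl refl (apply≡ refl refl refl refl refl r-eq))))
           (sym (trans (vτ δ) (compose≡ refl refl refl refl (apply≡ refl refl refl refl refl r-eq) refl)))
        (term-trans
          (term-trans
            (compose-cong (type-refl sB) (term-refl gx) (term-refl gx) (term-refl g′x)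
              (term-refl qx) (apply-r sA sB sg sx))
            (compose-rʳ sB gx g′x qx))
          (term-sym (term-trans
            (compose-cong (type-refl sB) (term-refl gx) (term-refl g′x) (term-refl g′x)
              (apply-r sA sB sg′ sx) (term-refl qx))
            (compose-rˡ sB gx g′x qx)))))

  apply-compose : Γ ⊢ A type → Γ ⊢ B type → Γ ▷ A ⊢ g ∶ wk B →
                  Γ ⊢ a ∶ A → Γ ⊢ b ∶ A → Γ ⊢ c ∶ A →
                  Γ ⊢ q ∶ Id A b c → Γ ⊢ p ∶ Id A a b →
                  Γ ⊢ apply A B g a c (compose A a b c q p) ≈
                      compose B (g [ var ▸ a ]) (g [ var ▸ b ]) (g [ var ▸ c ])
                        (apply A B g b c q) (apply A B g a b p)
                    ∶ Id B (g [ var ▸ a ]) (g [ var ▸ c ])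
  apply-compose {n} {A = A} {B = B} {g = g} {a = a} {b = b} {c = c} {q = q} {p = p}
                tA tB tg ta tb tc tq tp =
    ≈≡ (Id≡ (ι B) (at g {a⁴} (ι a)) (at g {y} refl))
      (≈-≡ (trans (uτ ι⁴) (apply≡ (ι A) (ι B) (ιₗ g) (ι a) refl
                             (compose≡ (ι A) (ι a) refl refl refl refl)))
           (trans (vτ ι⁴) (compose≡ (ι B) (inst≡ (ιₗ g) (ι a)) (inst≡ (ιₗ g) refl) (inst≡ (ιₗ g) refl)
                             (apply≡ (ι A) (ι B) (ιₗ g) refl refl refl)
                             (apply≡ (ι A) (ι B) (ιₗ g) (ι a) refl refl)))
        (Id-ind₁ {D = B⁴} {c = g⁴ [ var ▸ a⁴ ]} {d = g⁴ [ var ▸ y ]} {u = u⁴} {v = v⁴}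
          tA tW tB⁴ ga gy tu tv base tb tc tq
          (⊢≡ (sym (Id≡ (trans (↑-sub 3 A) ([var] A)) (trans (↑-sub 3 a) ([var] a)) refl)) tp)))
    where
    open IdCtx tA
    tW = Id-form (sub-type ⊢↑3 tA) (sub-term ⊢↑3 ta) ⊢x
    open Extra tW
    N = ML₂+ 𝕊
    ι⁴ = var ▸ b ▸ c ▸ q ▸ p
    x y z o : Tm N (4 + n)
    x = wk x₂
    y = wk x₁
    z = wk x₀
    o = x₀
    A⁴ = A [ ↑ 4 ]
    B⁴ = B [ ↑ 4 ]
    a⁴ = a [ ↑ 4 ]
    g⁴ = g [ lift (↑ 4) ]
    tA⁴ = sub-type ⊢↑4 tA
    tB⁴ = sub-type ⊢↑4 tB
    ta⁴ = sub-term ⊢↑4 ta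
    tg⁴ = ⊢under tg ⊢↑4 tA
    tw : _ ▷Id A ▷ _ ⊢ o ∶ Id A⁴ a⁴ x
    tw = ⊢≡ (Id≡ (↑-suc 3 A) (↑-suc 3 a) refl) (⊢x₀ tW)
    ga = ⊢inst₁ tg⁴ ta⁴
    gx = ⊢inst₁ tg⁴ ⊢x¹
    gy = ⊢inst₁ tg⁴ ⊢y¹
    u⁴ = apply A⁴ B⁴ g⁴ a⁴ y (compose A⁴ a⁴ x y z o)
    v⁴ = compose B⁴ (g⁴ [ var ▸ a⁴ ]) (g⁴ [ var ▸ x ]) (g⁴ [ var ▸ y ])
           (apply A⁴ B⁴ g⁴ x y z) (apply A⁴ B⁴ g⁴ a⁴ x o)
    tu = ⊢apply tA⁴ tB⁴ tg⁴ ta⁴ ⊢y¹ (⊢compose tA⁴ ta⁴ ⊢x¹ ⊢y¹ ⊢p¹ tw)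
    tv = ⊢compose tB⁴ ga gx gy (⊢apply tA⁴ tB⁴ tg⁴ ⊢x¹ ⊢y¹ ⊢p¹) (⊢apply tA⁴ tB⁴ tg⁴ ta⁴ ⊢x¹ tw)
    inst≡ : {e e′ : Tm N (suc n)} {x x′ : Tm N n} → e ≡ e′ → x ≡ x′ → e [ var ▸ x ] ≡ e′ [ var ▸ x′ ]
    inst≡ refl refl = refl
    ι : (e : Exp N s _) → e [ ↑ 4 ] [ ι⁴ ] ≡ e
    ι e = trans (↑-sub 4 e) ([var] e)
    ιₗ : (e : Exp N s _) → e [ lift (↑ 4) ] [ lift ι⁴ ] ≡ e
    ιₗ e = trans (lift-lift e) (sub-id (lift-sub-id (λ _ → refl) 1) e)
    at : (e : Tm N _) {x : Tm N _} {x′ : Tm N _} → x [ ι⁴ ] ≡ x′ →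
         e [ lift (↑ 4) ] [ var ▸ x ] [ ι⁴ ] ≡ e [ var ▸ x′ ]
    at e {x} h = trans (⟨⟩-sub (e [ lift (↑ 4) ]) {x} {ι⁴}) (inst≡ (ιₗ e) h)
    uτ : ∀ {k} (τ : Sub N _ k) →
         u⁴ [ τ ] ≡ apply (A⁴ [ τ ]) (B⁴ [ τ ]) (g⁴ [ lift τ ]) (a⁴ [ τ ]) (y [ τ ])
           (compose (A⁴ [ τ ]) (a⁴ [ τ ]) (x [ τ ]) (y [ τ ]) (z [ τ ]) (o [ τ ]))
    uτ τ = trans (apply-sub A⁴ B⁴ g⁴ a⁴ y (compose A⁴ a⁴ x y z o) τ)
      (apply≡ refl refl refl refl refl (compose-sub A⁴ a⁴ x y z o τ))
    vτ : ∀ {k} (τ : Sub N _ k) →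
         v⁴ [ τ ] ≡ compose (B⁴ [ τ ]) (g⁴ [ lift τ ] [ var ▸ a⁴ [ τ ] ])
           (g⁴ [ lift τ ] [ var ▸ x [ τ ] ]) (g⁴ [ lift τ ] [ var ▸ y [ τ ] ])
           (apply (A⁴ [ τ ]) (B⁴ [ τ ]) (g⁴ [ lift τ ]) (x [ τ ]) (y [ τ ]) (z [ τ ]))
           (apply (A⁴ [ τ ]) (B⁴ [ τ ]) (g⁴ [ lift τ ]) (a⁴ [ τ ]) (x [ τ ]) (o [ τ ]))
    vτ τ = trans (compose-sub B⁴ (g⁴ [ var ▸ a⁴ ]) (g⁴ [ var ▸ x ]) (g⁴ [ var ▸ y ])
                    (apply A⁴ B⁴ g⁴ x y z) (apply A⁴ B⁴ g⁴ a⁴ x o) τ)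
      (compose≡ refl (⟨⟩-sub g⁴ {a⁴} {τ}) (⟨⟩-sub g⁴ {x} {τ}) (⟨⟩-sub g⁴ {y} {τ})
        (apply-sub A⁴ B⁴ g⁴ x y z τ) (apply-sub A⁴ B⁴ g⁴ a⁴ x o τ))
    δ = lift (reflˢ A)
    tδ = ⊢lift (⊢reflˢ tA) tW
    r-eq : r (wk (wk A)) x₁ ≡ r (A⁴ [ δ ]) x₁
    r-eq = cong₂ r (sym (trans (↑-lift 3 A) (cong wk ([wkˢ] A)))) refl
    sA = sub-type tδ tA⁴
    sB = sub-type tδ tB⁴
    sg = ⊢under tg⁴ tδ tA⁴
    sa = sub-term tδ ta⁴
    sx = sub-term tδ ⊢x¹
    sw = sub-term tδ tw
    sga = ⊢inst₁ sg sa
    sgx = ⊢inst₁ sg sx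
    sgw = ⊢apply sA sB sg sa sx sw
    base = ≈≡ (sym (Id≡ refl (⟨⟩-sub g⁴ {a⁴} {δ}) (⟨⟩-sub g⁴ {y} {δ})))
      (≈-≡ (sym (trans (uτ δ) (apply≡ refl refl refl refl refl (compose≡ refl refl refl refl r-eq refl))))
           (sym (trans (vτ δ) (compose≡ refl refl refl refl (apply≡ refl refl refl refl refl r-eq) refl)))
        (term-trans
          (apply-cong (type-refl sA) (type-refl sB) (term-refl sg) (term-refl sa) (term-refl sx)
            (compose-rˡ sA sa sx sw))
          (term-sym (term-trans
            (compose-cong (type-refl sB) (term-refl sga) (term-refl sgx) (term-refl sgx)
              (apply-r sA sB sg sx) (term-refl sgw))
            (compose-rˡ sB sga sgx sgw)))))

  ⊢∘ : Γ ⊢ A type → Γ ▷ B ⊢ g ∶ wk C → Γ ▷ A ⊢ f ∶ wk B → Γ ▷ A ⊢ g [ wkˢ ▸ f ] ∶ wk C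
  ⊢∘ {B = B} {C = C} tA tg tf = ⊢≡ ([wkˢ] C) (⊢inst tg (⊢wkˢ tA) (⊢≡ (sym ([wkˢ] B)) tf))

  ∘≈ : Γ ⊢ A type → Γ ⊢ B type → Γ ▷ B ⊢ g ≈ g′ ∶ D → Γ ▷ A ⊢ f ≈ f′ ∶ wk B →
       Γ ▷ A ⊢ g [ wkˢ ▸ f ] ≈ g′ [ wkˢ ▸ f′ ] ∶ D [ wkˢ ▸ f ]
  ∘≈ {B = B} tA tB eg ef =
    term-trans (sub-term≈ (⊢▸ (⊢wkˢ tA) (left ef′)) eg)
               (term-cong (⊢▸≈ (⊢ˢ-refl (⊢wkˢ tA)) tB ef′) (right eg))
    where ef′ = ≈≡ (sym ([wkˢ] B)) ef

module _ {𝕊 : Signature} (S : TypeTheory (ML₂+ 𝕊)) where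
  open TypeTheory S

  record Type (Γ : Ctx (ML₂+ 𝕊) n) : Set where
    constructor mkType
    field
      {ty} : Ty (ML₂+ 𝕊) n
      ok   : Γ ⊢ ty type

  open Type using (ty)

  -- y : A ⊢ f : B
  record Map {Γ : Ctx (ML₂+ 𝕊) n} (AB : Type Γ × Type Γ) : Set where
    constructor mkMap
    field
      {tm} : Tm (ML₂+ 𝕊) (suc n)
      ok   : Γ ▷ ty (proj₁ AB) ⊢ tm ∶ wk (ty (proj₂ AB))

  open Map using (tm)

  -- y : A ⊢ α : Id B f g
  record Homotopy {Γ : Ctx (ML₂+ 𝕊) n}
                  (fg : Σ[ AB ∈ Type Γ × Type Γ ] Map AB × Map AB) : Set where
    constructor mkHomotopy
    private
      A = ty (proj₁ (proj₁ fg))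
      B = ty (proj₂ (proj₁ fg))
      f = tm (proj₁ (proj₂ fg))
      g = tm (proj₂ (proj₂ fg))
    field
      {pf} : Tm (ML₂+ 𝕊) (suc n)
      ok   : Γ ▷ A ⊢ pf ∶ Id (wk B) f g

  open Homotopy using (pf)

  record _≈ᵗ_ {Γ : Ctx (ML₂+ 𝕊) n} (A B : Type Γ) : Set where
    constructor mkType≈
    field
      eq : Γ ⊢ ty A ≈ ty B type

  record _≈ᵐ_ {Γ : Ctx (ML₂+ 𝕊) n} {AB AB′ : Type Γ × Type Γ}
              (f : Map AB) (f′ : Map AB′) : Set where
    constructor mkMap≈
    field
      dom : proj₁ AB ≈ᵗ proj₁ AB′
      cod : proj₂ AB ≈ᵗ proj₂ AB′
      eq  : Γ ▷ ty (proj₁ AB) ⊢ tm f ≈ tm f′ ∶ wk (ty (proj₂ AB))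

  record _≈ʰ_ {Γ : Ctx (ML₂+ 𝕊) n}
              {fg fg′ : Σ[ AB ∈ Type Γ × Type Γ ] Map AB × Map AB}
              (α : Homotopy fg) (α′ : Homotopy fg′) : Set where
    constructor mkHomotopy≈
    private
      A = ty (proj₁ (proj₁ fg))
      B = ty (proj₂ (proj₁ fg))
      f = proj₁ (proj₂ fg)
      g = proj₂ (proj₂ fg)
    field
      src : f ≈ᵐ proj₁ (proj₂ fg′)
      tgt : g ≈ᵐ proj₂ (proj₂ fg′)
      eq  : Γ ▷ A ⊢ pf α ≈ pf α′ ∶ Id (wk B) (tm f) (tm g)

module _ {𝕊 : Signature} (S : TypeTheory (ML₂+ 𝕊)) (M : AdmitsML₂ S) where
  open TypeTheory S
  open AdmitsML₂ M
  open Derived S M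
  open Type
  open Map
  open Homotopy

  module _ {Γ : Ctx (ML₂+ 𝕊) n} where
    private
      infix 4 _≈₀_ _≈₁_ _≈₂_ _⇛_

      variable
        A A′ B B′ C C′ : Type S Γ

      _⇛_ : Map S (A , B) → Map S (A , B) → Set
      _⇛_ {A} {B} f g = Homotopy S ((A , B) , f , g)

      _≈₀_ : Type S Γ → Type S Γ → Set
      _≈₀_ = _≈ᵗ_ S

      _≈₁_ : Map S (A , B) → Map S (A′ , B′) → Set
      _≈₁_ = _≈ᵐ_ S

      _≈₂_ : {f g : Map S (A , B)} {f′ g′ : Map S (A′ , B′)} → f ⇛ g → f′ ⇛ g′ → Set
      _≈₂_ = _≈ʰ_ S

    isEquivalenceᵗ : IsEquivalence _≈₀_
    isEquivalenceᵗ = record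
      { refl  = λ {A} → mkType≈ (type-refl (ok A))
      ; sym   = λ e → mkType≈ (type-sym (_≈ᵗ_.eq e))
      ; trans = λ e e′ → mkType≈ (type-trans (_≈ᵗ_.eq e) (_≈ᵗ_.eq e′))
      }

    private module Eᵗ = IsEquivalence isEquivalenceᵗ

    ≡⇒≈ᵐ : {f f′ : Map S (A , B)} → tm f ≡ tm f′ → f ≈₁ f′
    ≡⇒≈ᵐ {f = f} e = mkMap≈ Eᵗ.refl Eᵗ.refl (≡⇒≈ e (ok f))

    conv-map≈ : {t u : Tm (ML₂+ 𝕊) (suc n)} → A ≈₀ A′ → B ≈₀ B′ →
                Γ ▷ ty A ⊢ t ≈ u ∶ wk (ty B) → Γ ▷ ty A′ ⊢ t ≈ u ∶ wk (ty B′)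
    conv-map≈ {A = A} eA eB e =
      ctx-term≈ (_≈ᵗ_.eq eA) (conv≈ (wk-type≈ (ok A) (_≈ᵗ_.eq eB)) e)

    isEquivalenceᵐ : IsIndexedEquivalence (Map S {Γ = Γ}) (_≈ᵐ_ S)
    isEquivalenceᵐ = record
      { refl  = ≡⇒≈ᵐ refl
      ; sym   = λ { (mkMap≈ eA eB e) →
                    mkMap≈ (Eᵗ.sym eA) (Eᵗ.sym eB) (conv-map≈ eA eB (term-sym e)) }
      ; trans = λ { (mkMap≈ eA eB e) (mkMap≈ eA′ eB′ e′) →
                    mkMap≈ (Eᵗ.trans eA eA′) (Eᵗ.trans eB eB′)
                           (term-trans e (conv-map≈ (Eᵗ.sym eA) (Eᵗ.sym eB) e′)) }
      }

    private module Eᵐ = IsIndexedEquivalence isEquivalenceᵐ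

    homotopy-type≈ : {f g : Map S (A , B)} {f′ g′ : Map S (A′ , B′)} →
                     f ≈₁ f′ → g ≈₁ g′ →
                     Γ ▷ ty A ⊢ Id (wk (ty B)) (tm f) (tm g) ≈ Id (wk (ty B′)) (tm f′) (tm g′) type
    homotopy-type≈ {A = A} (mkMap≈ _ eB ef) (mkMap≈ _ _ eg) =
      Id-cong (wk-type≈ (ok A) (_≈ᵗ_.eq eB)) ef eg

    conv-homotopy≈ : {f g : Map S (A , B)} {f′ g′ : Map S (A′ , B′)}
                     {t u : Tm (ML₂+ 𝕊) (suc n)} → f ≈₁ f′ → g ≈₁ g′ →
                     Γ ▷ ty A ⊢ t ≈ u ∶ Id (wk (ty B)) (tm f) (tm g) →
                     Γ ▷ ty A′ ⊢ t ≈ u ∶ Id (wk (ty B′)) (tm f′) (tm g′)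
    conv-homotopy≈ ef eg e =
      ctx-term≈ (_≈ᵗ_.eq (_≈ᵐ_.dom ef)) (conv≈ (homotopy-type≈ ef eg) e)

    homotopy≈ : {f g : Map S (A , B)} {α β : f ⇛ g} →
                Γ ▷ ty A ⊢ pf α ≈ pf β ∶ Id (wk (ty B)) (tm f) (tm g) → α ≈₂ β
    homotopy≈ = mkHomotopy≈ Eᵐ.refl Eᵐ.refl

    ≡⇒≈ʰ : {f g f′ g′ : Map S (A , B)} {α : f ⇛ g} {β : f′ ⇛ g′} →
           tm f ≡ tm f′ → tm g ≡ tm g′ → pf α ≡ pf β → α ≈₂ β
    ≡⇒≈ʰ {α = α} ef eg e = mkHomotopy≈ (≡⇒≈ᵐ ef) (≡⇒≈ᵐ eg) (≡⇒≈ e (ok α))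

    isEquivalenceʰ : IsIndexedEquivalence (Homotopy S {Γ = Γ}) (_≈ʰ_ S)
    isEquivalenceʰ = record
      { refl  = ≡⇒≈ʰ refl refl refl
      ; sym   = λ { (mkHomotopy≈ ef eg e) →
                    mkHomotopy≈ (Eᵐ.sym ef) (Eᵐ.sym eg) (conv-homotopy≈ ef eg (term-sym e)) }
      ; trans = λ { (mkHomotopy≈ ef eg e) (mkHomotopy≈ ef′ eg′ e′) →
                    mkHomotopy≈ (Eᵐ.trans ef ef′) (Eᵐ.trans eg eg′)
                      (term-trans e (conv-homotopy≈ (Eᵐ.sym ef) (Eᵐ.sym eg) e′)) }
      }

    ⊢wkTy : (A B : Type S Γ) → Γ ▷ ty A ⊢ wk (ty B) type
    ⊢wkTy A B = wk-type (ok A) (ok B)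

    idᵐ : Map S (A , A)
    idᵐ {A} = mkMap (⊢x₀ (ok A))

    _∘ᵐ_ : Map S (B , C) → Map S (A , B) → Map S (A , C)
    _∘ᵐ_ {A = A} g f = mkMap {tm = tm g [ wkˢ ▸ tm f ]} (⊢∘ (ok A) (ok g) (ok f))

    idʰ : {f : Map S (A , B)} → f ⇛ f
    idʰ {A} {B} {f} = mkHomotopy (Id-intro (⊢wkTy A B) (ok f))

    _∙ʰ_ : {f g h : Map S (A , B)} → g ⇛ h → f ⇛ g → f ⇛ h
    _∙ʰ_ {A} {B} {f} {g} {h} β α =
      mkHomotopy (⊢compose (⊢wkTy A B) (ok f) (ok g) (ok h) (ok β) (ok α))

    -- k : B → C in context Γ, viewed in context Γ ▷ A.
    weakened : Map S (B , C) → Tm (ML₂+ 𝕊) (suc (suc n))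
    weakened k = tm k [ lift wkˢ ]

    ⊢weakened : (A : Type S Γ) (k : Map S (B , C)) →
                Γ ▷ ty A ▷ wk (ty B) ⊢ weakened k ∶ wk (wk (ty C))
    ⊢weakened {B} {C} A k = ⊢≡ (cong wk ([wkˢ] (ty C)))
      (ctx-term (ty≈≡ refl ([wkˢ] (ty B)) (type-refl (sub-type (⊢wkˢ (ok A)) (ok B))))
                (⊢under (ok k) (⊢wkˢ (ok A)) (ok B)))

    weakened-inst : (k : Map S (B , C)) {t : Tm (ML₂+ 𝕊) (suc n)} →
                    weakened k [ var ▸ t ] ≡ tm k [ wkˢ ▸ t ]
    weakened-inst k {t} = lift-⟨⟩ (tm k) {wkˢ} {t}

    _◃ʰ_ : (k : Map S (B , C)) {f g : Map S (A , B)} → f ⇛ g → (k ∘ᵐ f) ⇛ (k ∘ᵐ g)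
    _◃ʰ_ {B} {C} {A} k {f} {g} α =
      mkHomotopy {pf = apply (wk (ty B)) (wk (ty C)) (weakened k) (tm f) (tm g) (pf α)}
        (⊢≡ (Id≡ refl (weakened-inst k) (weakened-inst k))
            (⊢apply (⊢wkTy A B) (⊢wkTy A C) (⊢weakened A k) (ok f) (ok g) (ok α)))

    _▹ʰ_ : {f g : Map S (B , C)} → f ⇛ g → (k : Map S (A , B)) → (f ∘ᵐ k) ⇛ (g ∘ᵐ k)
    _▹ʰ_ {B} {C} {A} α k =
      mkHomotopy {pf = pf α [ wkˢ ▸ tm k ]}
        (⊢≡ (Id≡ (wk-∘ (ty C)) refl refl)
            (sub-term (⊢▸ (⊢wkˢ (ok A)) (⊢≡ (sym ([wkˢ] (ty B))) (ok k))) (ok α)))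

    idᵐ-cong : A ≈₀ A′ → idᵐ {A} ≈₁ idᵐ {A′}
    idᵐ-cong {A} eA = mkMap≈ eA eA (term-refl (⊢x₀ (ok A)))

    idʰ-cong : {f : Map S (A , B)} {f′ : Map S (A′ , B′)} → f ≈₁ f′ → idʰ {f = f} ≈₂ idʰ {f = f′}
    idʰ-cong {A} (mkMap≈ eA eB ef) =
      mkHomotopy≈ (mkMap≈ eA eB ef) (mkMap≈ eA eB ef) (r-cong (wk-type≈ (ok A) (_≈ᵗ_.eq eB)) ef)

    ∙ʰ-cong : {f g h : Map S (A , B)} {f′ g′ h′ : Map S (A′ , B′)}
              {β : g ⇛ h} {α : f ⇛ g} {β′ : g′ ⇛ h′} {α′ : f′ ⇛ g′} →
              β ≈₂ β′ → α ≈₂ α′ → β ∙ʰ α ≈₂ β′ ∙ʰ α′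
    ∙ʰ-cong {A} (mkHomotopy≈ eg eh eβ) (mkHomotopy≈ ef _ eα) =
      mkHomotopy≈ ef eh
        (compose-cong (wk-type≈ (ok A) (_≈ᵗ_.eq (_≈ᵐ_.cod ef)))
          (_≈ᵐ_.eq ef) (_≈ᵐ_.eq eg) (_≈ᵐ_.eq eh) eβ eα)

    ∘ᵐ-identityˡ : {f : Map S (A , B)} → idᵐ ∘ᵐ f ≈₁ f
    ∘ᵐ-identityˡ = ≡⇒≈ᵐ refl

    ∘ᵐ-identityʳ : {f : Map S (A , B)} → f ∘ᵐ idᵐ ≈₁ f
    ∘ᵐ-identityʳ {f = f} = ≡⇒≈ᵐ ([wkˢ▸x₀] (tm f))

    ∘ᵐ-assoc : {D : Type S Γ} {h : Map S (C , D)} {g : Map S (B , C)} {f : Map S (A , B)} →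
               (h ∘ᵐ g) ∘ᵐ f ≈₁ h ∘ᵐ (g ∘ᵐ f)
    ∘ᵐ-assoc {h = h} {g} {f} = ≡⇒≈ᵐ (∘-assoc (tm h) {tm g} {tm f})

    ∙ʰ-identityˡ : {f g : Map S (A , B)} {α : f ⇛ g} → idʰ ∙ʰ α ≈₂ α
    ∙ʰ-identityˡ {A} {B} {f} {g} {α} =
      homotopy≈ (compose-rˡ (⊢wkTy A B) (ok f) (ok g) (ok α))

    ∙ʰ-identityʳ : {f g : Map S (A , B)} {α : f ⇛ g} → α ∙ʰ idʰ ≈₂ α
    ∙ʰ-identityʳ {A} {B} {f} {g} {α} =
      homotopy≈ (compose-rʳ (⊢wkTy A B) (ok f) (ok g) (ok α))

    ∙ʰ-assoc : {f g h k : Map S (A , B)} {γ : h ⇛ k} {β : g ⇛ h} {α : f ⇛ g} →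
               (γ ∙ʰ β) ∙ʰ α ≈₂ γ ∙ʰ (β ∙ʰ α)
    ∙ʰ-assoc {A} {B} {f} {g} {h} {k} {γ} {β} {α} =
      homotopy≈ (compose-assoc (⊢wkTy A B) (ok f) (ok g) (ok h) (ok k) (ok γ) (ok β) (ok α))

    ∘ᵐ-cong : {g : Map S (B , C)} {f : Map S (A , B)} {g′ : Map S (B′ , C′)} {f′ : Map S (A′ , B′)} →
              g ≈₁ g′ → f ≈₁ f′ → g ∘ᵐ f ≈₁ g′ ∘ᵐ f′
    ∘ᵐ-cong {B} {C} {A} (mkMap≈ eB eC eg) (mkMap≈ eA _ ef) =
      mkMap≈ eA eC (≈≡ (wk-∘ (ty C)) (∘≈ (ok A) (ok B) eg ef))

    ◃ʰ-cong : {k : Map S (B , C)} {f g : Map S (A , B)}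
              {k′ : Map S (B′ , C′)} {f′ g′ : Map S (A′ , B′)} {α : f ⇛ g} {α′ : f′ ⇛ g′} →
              k ≈₁ k′ → α ≈₂ α′ → k ◃ʰ α ≈₂ k′ ◃ʰ α′
    ◃ʰ-cong {B} {C} {A} {k = k} ek@(mkMap≈ (mkType≈ eB) (mkType≈ eC) eqk) (mkHomotopy≈ ef eg e) =
      mkHomotopy≈ (∘ᵐ-cong ek ef) (∘ᵐ-cong ek eg)
        (≈≡ (Id≡ refl (weakened-inst k) (weakened-inst k))
          (apply-cong (wk-type≈ (ok A) eB) (wk-type≈ (ok A) eC)
            (ctx-term≈ (ty≈≡ refl ([wkˢ] (ty B)) (type-refl (sub-type (⊢wkˢ (ok A)) (ok B))))
              (≈≡ (trans (wk-lift (ty C) wkˢ) (cong wk ([wkˢ] (ty C))))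
                  (sub-term≈ (⊢lift (⊢wkˢ (ok A)) (ok B)) eqk)))
            (_≈ᵐ_.eq ef) (_≈ᵐ_.eq eg) e))

    ▹ʰ-cong : {f g : Map S (B , C)} {k : Map S (A , B)}
              {f′ g′ : Map S (B′ , C′)} {k′ : Map S (A′ , B′)} {α : f ⇛ g} {α′ : f′ ⇛ g′} →
              α ≈₂ α′ → k ≈₁ k′ → α ▹ʰ k ≈₂ α′ ▹ʰ k′
    ▹ʰ-cong {B} {C} {A} (mkHomotopy≈ ef eg e) ek =
      mkHomotopy≈ (∘ᵐ-cong ef ek) (∘ᵐ-cong eg ek)
        (≈≡ (Id≡ (wk-∘ (ty C)) refl refl) (∘≈ (ok A) (ok B) e (_≈ᵐ_.eq ek)))

    ∘ᵐ-◃ʰ : {D : Type S Γ} {l : Map S (C , D)} {k : Map S (B , C)} {f g : Map S (A , B)} {α : f ⇛ g} →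
            (l ∘ᵐ k) ◃ʰ α ≈₂ l ◃ʰ (k ◃ʰ α)
    ∘ᵐ-◃ʰ {C} {B} {A} {D = D} {l = l} {k} {f} {g} {α} =
      mkHomotopy≈ (≡⇒≈ᵐ (∘-assoc (tm l))) (≡⇒≈ᵐ (∘-assoc (tm l)))
        (≈≡ (Id≡ refl (at {f}) (at {g}))
          (≈-≡ (apply≡ refl refl (sym lk) refl refl refl)
               (apply≡ refl refl refl (weakened-inst k) (weakened-inst k) refl)
            (apply-∘ (⊢wkTy A B) (⊢wkTy A C) (⊢wkTy A D) (⊢weakened A l) (⊢weakened A k)
                     (ok f) (ok g) (ok α))))
      where
      lk : weakened (l ∘ᵐ k) ≡ weakened l [ wkˢ ▸ weakened k ]
      lk = ∘-lift (tm l) {tm k} {wkˢ}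
      at : {f : Map S (A , B)} → weakened l [ wkˢ ▸ weakened k ] [ var ▸ tm f ] ≡ tm (l ∘ᵐ k) [ wkˢ ▸ tm f ]
      at {f} = trans (cong _[ var ▸ tm f ] (sym lk)) (weakened-inst (l ∘ᵐ k))

    ◃ʰ-∙ʰ : {k : Map S (B , C)} {f g h : Map S (A , B)} {β : g ⇛ h} {α : f ⇛ g} →
            k ◃ʰ (β ∙ʰ α) ≈₂ (k ◃ʰ β) ∙ʰ (k ◃ʰ α)
    ◃ʰ-∙ʰ {B} {C} {A} {k = k} {f} {g} {h} {β} {α} = homotopy≈
      (≈≡ (Id≡ refl (weakened-inst k) (weakened-inst k))
        (≈-≡ refl (compose≡ refl (weakened-inst k) (weakened-inst k) (weakened-inst k) refl refl)
          (apply-compose (⊢wkTy A B) (⊢wkTy A C) (⊢weakened A k)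
                         (ok f) (ok g) (ok h) (ok β) (ok α))))

    ◃ʰ-idʰ : {k : Map S (B , C)} {f : Map S (A , B)} → k ◃ʰ idʰ {f = f} ≈₂ idʰ {f = k ∘ᵐ f}
    ◃ʰ-idʰ {B} {C} {A} {k = k} {f} = homotopy≈
      (≈≡ (Id≡ refl (weakened-inst k) (weakened-inst k))
        (≈-≡ refl (cong (r _) (weakened-inst k))
          (apply-r (⊢wkTy A B) (⊢wkTy A C) (⊢weakened A k) (ok f))))

    idᵐ-◃ʰ : {f g : Map S (A , B)} {α : f ⇛ g} → idᵐ ◃ʰ α ≈₂ α
    idᵐ-◃ʰ {A} {B} {f} {g} {α} = mkHomotopy≈ (≡⇒≈ᵐ refl) (≡⇒≈ᵐ refl)
      (apply-id (⊢wkTy A B) (ok f) (ok g) (ok α))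

    ◃ʰ-▹ʰ : {D : Type S Γ} {l : Map S (C , D)} {f g : Map S (B , C)} {k : Map S (A , B)} {α : f ⇛ g} →
            (l ◃ʰ α) ▹ʰ k ≈₂ l ◃ʰ (α ▹ʰ k)
    ◃ʰ-▹ʰ {C} {B} {A} {D = D} {l = l} {f} {g} {k} {α} =
      ≡⇒≈ʰ (∘-assoc (tm l)) (∘-assoc (tm l))
        (trans (apply-sub (wk (ty C)) (wk (ty D)) (weakened l) (tm f) (tm g) (pf α) (wkˢ ▸ tm k))
               (apply≡ (wk-∘ (ty C)) (wk-∘ (ty D)) (lift-wkˢ-∘ (tm l)) refl refl refl))

    ∙ʰ-▹ʰ : {f g h : Map S (B , C)} {k : Map S (A , B)} {β : g ⇛ h} {α : f ⇛ g} →
            (β ∙ʰ α) ▹ʰ k ≈₂ (β ▹ʰ k) ∙ʰ (α ▹ʰ k)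
    ∙ʰ-▹ʰ {B} {C} {f = f} {g} {h} {k} {β} {α} =
      ≡⇒≈ʰ refl refl
        (trans (compose-sub (wk (ty C)) (tm f) (tm g) (tm h) (pf β) (pf α) (wkˢ ▸ tm k))
               (compose≡ (wk-∘ (ty C)) refl refl refl refl refl))

    idʰ-▹ʰ : {f : Map S (B , C)} {k : Map S (A , B)} → idʰ {f = f} ▹ʰ k ≈₂ idʰ {f = f ∘ᵐ k}
    idʰ-▹ʰ {C = C} = ≡⇒≈ʰ refl refl (cong₂ r (wk-∘ (ty C)) refl)

    ▹ʰ-idᵐ : {f g : Map S (A , B)} {α : f ⇛ g} → α ▹ʰ idᵐ ≈₂ α
    ▹ʰ-idᵐ {f = f} {g} {α} = ≡⇒≈ʰ ([wkˢ▸x₀] (tm f)) ([wkˢ▸x₀] (tm g)) ([wkˢ▸x₀] (pf α))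

    ▹ʰ-∘ᵐ : {D : Type S Γ} {f g : Map S (C , D)} {k : Map S (B , C)} {l : Map S (A , B)} {α : f ⇛ g} →
            α ▹ʰ (k ∘ᵐ l) ≈₂ (α ▹ʰ k) ▹ʰ l
    ▹ʰ-∘ᵐ {f = f} {g} {k} {l} {α} =
      ≡⇒≈ʰ (sym (∘-assoc (tm f) {tm k} {tm l})) (sym (∘-assoc (tm g) {tm k} {tm l}))
           (sym (∘-assoc (pf α) {tm k} {tm l}))

    interchangeʰ : {f g : Map S (A , B)} {h k : Map S (B , C)} {β : h ⇛ k} {α : f ⇛ g} →
                   (β ▹ʰ g) ∙ʰ (h ◃ʰ α) ≈₂ (k ◃ʰ α) ∙ʰ (β ▹ʰ f)
    interchangeʰ {A} {B} {C} {f} {g} {h} {k} {β} {α} = homotopy≈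
      (≈≡ (Id≡ refl (weakened-inst h) (weakened-inst k))
        (≈-≡ (compose≡ refl (weakened-inst h) (weakened-inst h) (weakened-inst k) (lift-⟨⟩ (pf β)) refl)
             (compose≡ refl (weakened-inst h) (weakened-inst k) (weakened-inst k) refl (lift-⟨⟩ (pf β)))
          (apply-natural (⊢wkTy A B) (⊢wkTy A C) (⊢weakened A h) (⊢weakened A k)
            (⊢≡ (Id≡ (trans (wk-lift (ty C) wkˢ) (cong wk ([wkˢ] (ty C)))) refl refl)
              (ctx-term (ty≈≡ refl ([wkˢ] (ty B)) (type-refl (sub-type (⊢wkˢ (ok A)) (ok B))))
                (sub-term (⊢lift (⊢wkˢ (ok A)) (ok B)) (ok β))))
            (ok f) (ok g) (ok α))))

  𝔗 : Ctx (ML₂+ 𝕊) n → TwoCategory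
  𝔗 Γ = record
    { Obj = Type S Γ
    ; Hom = Map S
    ; Cell = Homotopy S
    ; _≈₀_ = _≈ᵗ_ S
    ; isEquivalence₀ = isEquivalenceᵗ
    ; _≈₁_ = _≈ᵐ_ S
    ; isEquivalence₁ = isEquivalenceᵐ
    ; boundary₁ = λ e → _≈ᵐ_.dom e , _≈ᵐ_.cod e
    ; transport₁ = λ {A} eA eB f →
        mkMap (right (conv-map≈ eA eB (term-refl (ok f)))) , mkMap≈ eA eB (term-refl (ok f))
    ; _≈₂_ = _≈ʰ_ S
    ; isEquivalence₂ = isEquivalenceʰ
    ; boundary₂ = λ e → _≈ʰ_.src e , _≈ʰ_.tgt e
    ; transport₂ = λ ef eg α →
        mkHomotopy (right (conv-homotopy≈ ef eg (term-refl (ok α)))) ,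
        mkHomotopy≈ ef eg (term-refl (ok α))
    ; id₁ = idᵐ
    ; _∘₁_ = _∘ᵐ_
    ; id₂ = idʰ
    ; _∙_ = _∙ʰ_
    ; _◃_ = λ k α → k ◃ʰ α
    ; _▹_ = λ α k → α ▹ʰ k
    ; id₁-cong = idᵐ-cong
    ; ∘₁-cong = ∘ᵐ-cong
    ; id₂-cong = λ {A} {B} {A′} {B′} {f} {f′} → idʰ-cong {f = f} {f′}
    ; ∙-cong = λ {A} {B} {A′} {B′} {f} {g} {h} {f′} {g′} {h′} {β} {α} {β′} {α′} → ∙ʰ-cong {β = β} {α} {β′} {α′}
    ; ◃-cong = λ {A} {B} {C} {A′} {B′} {C′} {k} {f} {g} {k′} {f′} {g′} {α} {α′} → ◃ʰ-cong {k = k} {k′ = k′} {α = α} {α′}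
    ; ▹-cong = λ {A} {B} {C} {A′} {B′} {C′} {f} {g} {k} {f′} {g′} {k′} {α} {α′} → ▹ʰ-cong {k = k} {k′ = k′} {α = α} {α′}
    ; ∘₁-identityˡ = λ {A} {B} {f} → ∘ᵐ-identityˡ {f = f}
    ; ∘₁-identityʳ = λ {A} {B} {f} → ∘ᵐ-identityʳ {f = f}
    ; ∘₁-assoc = λ {A} {B} {C} {D} {h} {g} {f} → ∘ᵐ-assoc {h = h} {g} {f}
    ; ∙-identityˡ = λ {A} {B} {f} {g} {α} → ∙ʰ-identityˡ {α = α}
    ; ∙-identityʳ = λ {A} {B} {f} {g} {α} → ∙ʰ-identityʳ {α = α}
    ; ∙-assoc = λ {A} {B} {f} {g} {h} {k} {γ} {β} {α} → ∙ʰ-assoc {γ = γ} {β} {α}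
    ; ◃-id₂ = λ {A} {B} {C} {k} {f} → ◃ʰ-idʰ {k = k} {f}
    ; ◃-∙ = λ {A} {B} {C} {k} {f} {g} {h} {β} {α} → ◃ʰ-∙ʰ {k = k} {β = β} {α}
    ; id₁-◃ = λ {A} {B} {f} {g} {α} → idᵐ-◃ʰ {α = α}
    ; ∘₁-◃ = λ {A} {B} {C} {D} {l} {k} {f} {g} {α} → ∘ᵐ-◃ʰ {l = l} {k} {α = α}
    ; id₂-▹ = λ {A} {B} {C} {f} {k} → idʰ-▹ʰ {f = f} {k}
    ; ∙-▹ = λ {A} {B} {C} {f} {g} {h} {k} {β} {α} → ∙ʰ-▹ʰ {k = k} {β} {α}
    ; ▹-id₁ = λ {A} {B} {f} {g} {α} → ▹ʰ-idᵐ {α = α}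
    ; ▹-∘₁ = λ {A} {B} {C} {D} {f} {g} {k} {l} {α} → ▹ʰ-∘ᵐ {k = k} {l} {α}
    ; ◃-▹ = λ {A} {B} {C} {D} {l} {f} {g} {k} {α} → ◃ʰ-▹ʰ {l = l} {k = k} {α}
    ; interchange = λ {A} {B} {C} {f} {g} {h} {k} {β} {α} → interchangeʰ {β = β} {α}
    }

  𝔗-map : {Γ : Ctx (ML₂+ 𝕊) m} {Δ : Ctx (ML₂+ 𝕊) n} {σ : Sub (ML₂+ 𝕊) m n} →
          Δ ⊢ˢ σ ∶ Γ → TwoFunctor (𝔗 Γ) (𝔗 Δ)
  𝔗-map {σ = σ} tσ = record
    { F₀ = λ A → mkType (sub-type tσ (ok A))
    ; F₁ = λ {A} f → mkMap (⊢under (ok f) tσ (ok A))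
    ; F₂ = λ {A} {B} α → mkHomotopy
        (⊢≡ (Id≡ (wk-lift (ty B) σ) refl refl) (sub-term (⊢lift tσ (ok A)) (ok α)))
    ; F₀-cong = F₀-cong
    ; F₁-cong = F₁-cong
    ; F₂-cong = λ { {A} {B} (mkHomotopy≈ ef eg e) → mkHomotopy≈ (F₁-cong ef) (F₁-cong eg)
        (≈≡ (Id≡ (wk-lift (ty B) σ) refl refl) (sub-term≈ (⊢lift tσ (ok A)) e)) }
    ; F-id₁ = ≡⇒≈ᵐ refl
    ; F-∘₁ = λ {A} {B} {C} {g} → ≡⇒≈ᵐ (∘-lift (tm g))
    ; F-id₂ = λ {A} {B} → ≡⇒≈ʰ refl refl (cong₂ r (wk-lift (ty B) σ) refl)
    ; F-∙ = λ {A} {B} {f} {g} {h} {β} {α} → ≡⇒≈ʰ refl refl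
        (trans (compose-sub (wk (ty B)) (tm f) (tm g) (tm h) (pf β) (pf α) (lift σ))
               (compose≡ (wk-lift (ty B) σ) refl refl refl refl refl))
    ; F-◃ = λ {A} {B} {C} {k} {f} {g} {α} → ≡⇒≈ʰ (∘-lift (tm k)) (∘-lift (tm k))
        (trans (apply-sub (wk (ty B)) (wk (ty C)) (weakened k) (tm f) (tm g) (pf α) (lift σ))
               (apply≡ (wk-lift (ty B) σ) (wk-lift (ty C) σ) (weakened-lift (tm k)) refl refl refl))
    ; F-▹ = λ {A} {B} {C} {f} {g} {k} {α} →
        ≡⇒≈ʰ (∘-lift (tm f)) (∘-lift (tm g)) (∘-lift (pf α))
    }
    where
    F₀-cong : {A A′ : Type S _} → _≈ᵗ_ S A A′ →
              _≈ᵗ_ S (mkType (sub-type tσ (ok A))) (mkType (sub-type tσ (ok A′)))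
    F₀-cong (mkType≈ e) = mkType≈ (sub-type≈ tσ e)
    F₁-cong : {A B A′ B′ : Type S _} {f : Map S (A , B)} {f′ : Map S (A′ , B′)} → _≈ᵐ_ S f f′ →
              _≈ᵐ_ S (mkMap (⊢under (ok f) tσ (ok A))) (mkMap (⊢under (ok f′) tσ (ok A′)))
    F₁-cong {A} {B} (mkMap≈ eA eB e) = mkMap≈ (F₀-cong eA) (F₀-cong eB)
      (≈≡ (wk-lift (ty B) σ) (sub-term≈ (⊢lift tσ (ok A)) e))
    weakened-lift : (e : Tm (ML₂+ 𝕊) _) →
                    e [ lift wkˢ ] [ lift (lift σ) ] ≡ e [ lift σ ] [ lift wkˢ ]
    weakened-lift e = trans (lift-lift e {wkˢ} {lift σ}) (trans
      (sub-cong (λ { zero → refl ; (suc i) → cong wk (sym ([wkˢ] (σ i))) }) e)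
      (sym (lift-lift e {σ} {wkˢ})))

  Δ[_] : {Γ : Ctx (ML₂+ 𝕊) n} {A : Ty (ML₂+ 𝕊) n} → Γ ⊢ A type → TwoFunctor (𝔗 Γ) (𝔗 (Γ ▷ A))
  Δ[ tA ] = 𝔗-map (⊢wkˢ tA)

{-# OPTIONS --safe #-}
-- Take Σ_A X = Σ(A , X), with unit the pairing.  Precomposing with it is
-- substitution of ⟨x , y⟩ for z : Σ(A , X).  Σ-elimination provides a
-- section on 1-cells and, for motives which are identity types, fullness on
-- 2-cells; both hold on the nose by Σ-computation.  Since identity types are
-- discrete, Σ-elimination also shows that two 2-cells agreeing on pairs are
-- definitionally equal.  A full and faithful functor with a strict section on
-- objects is a surjective equivalence.
module Submission where

open import Data.Nat.Base using (ℕ; suc)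
open import Data.Fin.Base using (zero; suc)
open import Data.Product.Base using (Σ-syntax; _,_; proj₁; proj₂)
open import Relation.Binary.Structures using (IsEquivalence)
open import Relation.Binary.Indexed.Heterogeneous using (IsIndexedEquivalence)
open import Relation.Binary.PropositionalEquality.Core using (_≡_; refl; sym; trans; cong; cong₂)
open import Defs

-- Surjective equivalences from full and faithful functors with a section on objects.

module _ {C D : Category} (P : Functor C D) where
  private
    module C = Category C
    module D = Category D
    module P = Functor P
    module C₀ = IsEquivalence C.isEquivalence₀
    module D₀ = IsEquivalence D.isEquivalence₀
    module C₁ = IsIndexedEquivalence C.isEquivalence₁
    module D₁ = IsIndexedEquivalence D.isEquivalence₁

  -- I₁ f and θ are lifts along P of f and of identities, so the equations required
  -- of them hold after applying P, and faithfulness reflects them.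
  fullyFaithful⇒surjectiveEquivalence :
    (I₀ : D.Obj → C.Obj) →
    (∀ {d d′} → d D.≈₀ d′ → I₀ d C.≈₀ I₀ d′) →
    (∀ d → P.F₀ (I₀ d) D.≈₀ d) →
    (∀ {a b} (f : P.F₀ a D.⟶ P.F₀ b) → Σ[ g ∈ a C.⟶ b ] P.F₁ g D.≈₁ f) →
    (∀ {a b a′ b′} {f : a C.⟶ b} {f′ : a′ C.⟶ b′} →
       a C.≈₀ a′ → b C.≈₀ b′ → P.F₁ f D.≈₁ P.F₁ f′ → f C.≈₁ f′) →
    SurjectiveEquivalence P
  fullyFaithful⇒surjectiveEquivalence I₀ I₀-cong PI₀ full faithful = record
    { I = record
      { F₀ = I₀
      ; F₁ = I₁
      ; F₀-cong = I₀-cong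
      ; F₁-cong = λ {_} {_} {_} {_} {f} {f′} e →
          faithful (I₀-cong (proj₁ (D.boundary e))) (I₀-cong (proj₂ (D.boundary e)))
            (D₁.trans (PI₁ f) (D₁.trans e (D₁.sym (PI₁ f′))))
      ; F-id = λ {d} → faithful C₀.refl C₀.refl
          (D₁.trans (PI₁ D.id) (D₁.trans (D.id-cong (D₀.sym (PI₀ d))) (D₁.sym P.F-id)))
      ; F-∙ = λ {_} {_} {_} {g} {f} → faithful C₀.refl C₀.refl
          (D₁.trans (PI₁ (g D.∙ f))
            (D₁.trans (D.∙-cong (D₁.sym (PI₁ g)) (D₁.sym (PI₁ f))) (D₁.sym P.F-∙)))
      }
    ; PI-id₀ = PI₀
    ; PI-id₁ = PI₁
    ; θ = θ
    ; θ⁻¹ = θ⁻¹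
    ; θ-cong = λ {c} {c′} e → faithful e (I₀-cong (P.F₀-cong e))
        (D₁.trans (Pθ c) (D₁.trans (P.F₁-cong (C.id-cong e)) (D₁.sym (Pθ c′))))
    ; θ-natural = λ {c} {c′} f → faithful C₀.refl C₀.refl
        (D₁.trans P.F-∙ (D₁.trans (D.∙-cong (PI₁ (P.F₁ f)) (Pθ c))
          (D₁.trans (D₁.sym P.F-∙) (D₁.trans (P.F₁-cong (C₁.trans C.identityʳ (C₁.sym C.identityˡ)))
            (D₁.trans P.F-∙ (D₁.trans (D.∙-cong (D₁.sym (Pθ c′)) D₁.refl) (D₁.sym P.F-∙)))))))
    ; θ-isoˡ = λ c → faithful C₀.refl C₀.refl
        (D₁.trans P.F-∙ (D₁.trans (D.∙-cong (Pθ⁻¹ c) (Pθ c))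
          (D₁.trans (D₁.sym P.F-∙) (P.F₁-cong C.identityˡ))))
    ; θ-isoʳ = λ c → faithful C₀.refl C₀.refl
        (D₁.trans P.F-∙ (D₁.trans (D.∙-cong (Pθ c) (Pθ⁻¹ c))
          (D₁.trans (D₁.sym P.F-∙) (D₁.trans (P.F₁-cong C.identityˡ) (PI-id c)))))
    -- The targets `I₀ (P.F₀ (I₀ d))` and `I₀ d` are only related by `≈₀`; this is why `faithful` is
    -- assumed for cells with different boundaries.
    ; θI≈id = λ d → faithful C₀.refl (I₀-cong (PI₀ d)) (Pθ (I₀ d))
    ; Pθ≈id = λ c → D₁.trans (Pθ c) P.F-id
    }
    where
    I₁ : ∀ {d e} → d D.⟶ e → I₀ d C.⟶ I₀ e
    -- Fullness concerns morphisms between images under `P`, so `f` is first moved along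
    -- `d ≈ P (I₀ d)` and `e ≈ P (I₀ e)`.
    I₁ {d} {e} f = proj₁ (full (proj₁ (D.transport (D₀.sym (PI₀ d)) (D₀.sym (PI₀ e)) f)))

    PI₁ : ∀ {d e} (f : d D.⟶ e) → P.F₁ (I₁ f) D.≈₁ f
    PI₁ {d} {e} f with D.transport (D₀.sym (PI₀ d)) (D₀.sym (PI₀ e)) f
    ... | f′ , f≈f′ = D₁.trans (proj₂ (full f′)) (D₁.sym f≈f′)

    -- An equality of images lets the identity be transported and then lifted; read in the two
    -- directions of `PI₀`, this gives both `θ` and `θ⁻¹`.
    id-lift : ∀ {a b} → P.F₀ a D.≈₀ P.F₀ b → Σ[ g ∈ a C.⟶ b ] P.F₁ g D.≈₁ P.F₁ (C.id {a})
    id-lift e with D.transport D₀.refl e (P.F₁ C.id)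
    ... | f′ , id≈f′ = proj₁ (full f′) , D₁.trans (proj₂ (full f′)) (D₁.sym id≈f′)

    -- Needed because `id-lift` compares `θ⁻¹ c` with the identity of its source `I₀ (P.F₀ c)`,
    -- while `θ c` is compared with that of `c`.
    PI-id : ∀ c → P.F₁ (C.id {c}) D.≈₁ P.F₁ (C.id {I₀ (P.F₀ c)})
    PI-id c = D₁.trans P.F-id (D₁.trans (D.id-cong (D₀.sym (PI₀ (P.F₀ c)))) (D₁.sym P.F-id))

    θ : ∀ c → c C.⟶ I₀ (P.F₀ c)
    θ c = proj₁ (id-lift (D₀.sym (PI₀ (P.F₀ c))))

    Pθ : ∀ c → P.F₁ (θ c) D.≈₁ P.F₁ (C.id {c})
    Pθ c = proj₂ (id-lift (D₀.sym (PI₀ (P.F₀ c))))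

    θ⁻¹ : ∀ c → I₀ (P.F₀ c) C.⟶ c
    θ⁻¹ c = proj₁ (id-lift (PI₀ (P.F₀ c)))

    Pθ⁻¹ : ∀ c → P.F₁ (θ⁻¹ c) D.≈₁ P.F₁ (C.id {c})
    Pθ⁻¹ c = D₁.trans (proj₂ (id-lift (PI₀ (P.F₀ c)))) (D₁.sym (PI-id c))

-- Retract bireflections from lifting properties of the unit.

module _ {K L : TwoCategory} (U : TwoFunctor K L) where
  private
    module K = TwoCategory K
    module L = TwoCategory L
    module U = TwoFunctor U

  -- The five inputs are those of the preceding lemma for `precompose U η y`, unfolded to cells of
  -- `K` and `L` and given for all `y` at once.
  retractBireflection :
    ∀ {x f} (η : x L.⟶ U.F₀ f) (section : ∀ {y} → x L.⟶ U.F₀ y → f K.⟶ y) →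
    (∀ {y} {g g′ : x L.⟶ U.F₀ y} → g L.≈₁ g′ → section g K.≈₁ section g′) →
    (∀ {y} (g : x L.⟶ U.F₀ y) → U.F₁ (section g) L.∘₁ η L.≈₁ g) →
    (∀ {y} {h k : f K.⟶ y} (α : U.F₁ h L.∘₁ η L.⇒ U.F₁ k L.∘₁ η) →
       Σ[ β ∈ h K.⇒ k ] U.F₂ β L.▹ η L.≈₂ α) →
    (∀ {y} {h k h′ k′ : f K.⟶ y} {α : h K.⇒ k} {α′ : h′ K.⇒ k′} →
       h K.≈₁ h′ → k K.≈₁ k′ → U.F₂ α L.▹ η L.≈₂ U.F₂ α′ L.▹ η → α K.≈₂ α′) →
    RetractBireflection U x
  retractBireflection {f = f} η section section-cong section-∘ full faithful = record
    { F = f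
    ; η = η
    ; universal = λ y → fullyFaithful⇒surjectiveEquivalence (precompose U η y)
        section section-cong section-∘ full faithful
    }

private
  variable
    m n : ℕ
    s : Sort

-- Substitution into pairs.

module _ {𝕊 : Signature} where
  private
    variable
      A A′ : Ty (ML₂+ 𝕊) n
      B B′ C C′ : Ty (ML₂+ 𝕊) (suc n)
      a a′ b b′ c c′ : Tm (ML₂+ 𝕊) n
      d d′ : Tm (ML₂+ 𝕊) (suc (suc n))

  pair≡ : A ≡ A′ → B ≡ B′ → a ≡ a′ → b ≡ b′ → pair A B a b ≡ pair A′ B′ a′ b′
  pair≡ refl refl refl refl = refl

  E≡ : A ≡ A′ → B ≡ B′ → C ≡ C′ → d ≡ d′ → c ≡ c′ → E A B C d c ≡ E A′ B′ C′ d′ c′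
  E≡ refl refl refl refl refl = refl

  wk₁-lift : (e : Exp (ML₂+ 𝕊) s (suc m)) {σ : Sub (ML₂+ 𝕊) m n} →
             wk₁ e [ lift (lift σ) ] ≡ wk₁ (e [ lift σ ])
  wk₁-lift e {σ} =
    trans (ren-sub (lift-ren-sub {σ = lift σ} (λ _ → refl) 1) e)
          (sym (sub-ren (lift-sub-ren {σ = σ} (λ _ → refl) 1) e))

  wk₁-wk₁ : (e : Exp (ML₂+ 𝕊) s (suc n)) → wk₁ (wk₁ e) ≡ e [ lift (↑ 2) ]
  wk₁-wk₁ e = trans (cong wk₁ (ren-as-sub (lift-ren-as-sub (λ _ → refl) 1) e))
                    (sub-ren (lift-sub-ren {σ = wkˢ} (λ _ → refl) 1) e)

  wk-pairˢ : (e : Exp (ML₂+ 𝕊) s n) → wk e [ pairˢ A B ] ≡ wk (wk e)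
  wk-pairˢ e = trans (wk-▸ e) (sym (↑2 e))

  -- `pairˢ` weakens by renamings, whereas the typing rules are applied along the substitution
  -- `↑ 2`.
  pair-↑2 : (B : Ty (ML₂+ 𝕊) (suc n)) →
            pair (wk (wk A)) (wk₁ (wk₁ B)) x₁ x₀ ≡ pair (A [ ↑ 2 ]) (B [ lift (↑ 2) ]) x₁ x₀
  pair-↑2 {A = A} B = pair≡ (↑2 A) (wk₁-wk₁ B) refl refl

  -- Stability of pairing in the ambient context; it puts the type of a substituted branch into the
  -- form `Σ-elim` expects.
  pairˢ-lift : (e : Exp (ML₂+ 𝕊) s (suc m)) (A : Ty (ML₂+ 𝕊) m) (B : Ty (ML₂+ 𝕊) (suc m))
               {σ : Sub (ML₂+ 𝕊) m n} →
               e [ pairˢ A B ] [ lift (lift σ) ] ≡ e [ lift σ ] [ pairˢ (A [ σ ]) (B [ lift σ ]) ]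
  pairˢ-lift e A B {σ} = trans (sub-sub pointwise e) (sym (sub-sub (λ _ → refl) e))
    where
    pointwise : ∀ i → pairˢ A B i [ lift (lift σ) ] ≡ lift σ i [ pairˢ (A [ σ ]) (B [ lift σ ]) ]
    pointwise zero    = pair≡
      (trans (wk-lift (wk A) (lift σ)) (cong wk (wk-lift A σ)))
      (trans (wk₁-lift (wk₁ B)) (cong wk₁ (wk₁-lift B))) refl refl
    pointwise (suc i) = sym (wk-pairˢ (σ i))

-- Σ-elimination at a generic element.

-- ML₂+ is not injective for unification, which would reconstruct an implicit 𝕊
-- from S only up to η, and comparing the resulting copies of 𝔗 is very slow;
-- hence the explicit {𝕊 = 𝕊}.
module SigmaElimination {𝕊 : Signature} (S : TypeTheory (ML₂+ 𝕊)) (M : AdmitsML₂ {𝕊 = 𝕊} S) where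
  open TypeTheory S
  open AdmitsML₂ {𝕊 = 𝕊} M
  open Derived {𝕊 = 𝕊} S M

  private
    variable
      Γ Δ : Ctx (ML₂+ 𝕊) n
      σ : Sub (ML₂+ 𝕊) m n
      A B B′ C C′ D : Ty (ML₂+ 𝕊) n
      c d d′ u v : Tm (ML₂+ 𝕊) n

  -- The rule eliminates a term of the ambient context. To treat a variable of the Σ-type, that
  -- variable joins the ambient context and all other data are weakened over it.
  split : Ty (ML₂+ 𝕊) n → Ty (ML₂+ 𝕊) (suc n) → Ty (ML₂+ 𝕊) (suc n) →
          Tm (ML₂+ 𝕊) (suc (suc n)) → Tm (ML₂+ 𝕊) (suc n)
  split A B C d =
    E (A [ wkˢ ]) (B [ lift wkˢ ]) (C [ lift wkˢ ]) (d [ lift (lift wkˢ) ]) x₀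

  module _ {Γ : Ctx (ML₂+ 𝕊) n} {A : Ty (ML₂+ 𝕊) n} {B : Ty (ML₂+ 𝕊) (suc n)}
           (tA : Γ ⊢ A type) (tB : Γ ▷ A ⊢ B type) where
    private
      tΣ : Γ ⊢ `Σ A B type
      tΣ = Σ-form tA tB

      ⊢↑2 : Γ ▷ A ▷ B ⊢ˢ ↑ 2 ∶ Γ
      ⊢↑2 = ⊢▸⁻ (⊢▸⁻ (⊢var (⊢▷ tB)))

      ⊢fst : Γ ▷ A ▷ B ⊢ x₁ ∶ A [ ↑ 2 ]
      ⊢fst = ⊢≡ (↑2 A) (wk-term tB (⊢x₀ tA))

      ⊢snd : Γ ▷ A ▷ B ⊢ x₀ ∶ B [ lift (↑ 2) ] [ var ▸ x₁ ]
      ⊢snd = ⊢≡ (trans (ren-as-sub (λ { zero → refl ; (suc i) → refl }) B) (sym (lift-⟨⟩ B))) (⊢x₀ tB)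

    ⊢pairˢ : Γ ▷ A ▷ B ⊢ˢ pairˢ A B ∶ Γ ▷ `Σ A B
    ⊢pairˢ = ⊢▸ ⊢↑2 (⊢≡ᵗ (sym (pair-↑2 B))
      (Σ-intro (sub-type ⊢↑2 tA) (sub-type (⊢lift ⊢↑2 tA) tB) ⊢fst ⊢snd))

    pairˢ-cong : Γ ▷ A ⊢ B ≈ B′ type →
                 Γ ▷ A ▷ B ⊢ pairˢ A B zero ≈ pairˢ A B′ zero ∶ `Σ A B [ ↑ 2 ]
    pairˢ-cong {B′ = B′} eB = ≈-≡ (sym (pair-↑2 B)) (sym (pair-↑2 B′))
      (pair-cong (type-refl (sub-type ⊢↑2 tA)) (sub-type≈ (⊢lift ⊢↑2 tA) eB)
                 (term-refl ⊢fst) (term-refl ⊢snd))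

    private
      -- General in `σ` since it is used at `wkˢ` to type `split` and at `↑ 2` to compute it.
      ⊢branch : Δ ⊢ˢ σ ∶ Γ → Γ ▷ A ▷ B ⊢ d ∶ C [ pairˢ A B ] →
                Δ ▷ A [ σ ] ▷ B [ lift σ ] ⊢ d [ lift (lift σ) ]
                  ∶ C [ lift σ ] [ pairˢ (A [ σ ]) (B [ lift σ ]) ]
      ⊢branch {C = C} tσ td =
        ⊢≡ (pairˢ-lift C A B) (sub-term (⊢lift (⊢lift tσ tA) tB) td)

    ⊢split : Γ ▷ `Σ A B ⊢ C type → Γ ▷ A ▷ B ⊢ d ∶ C [ pairˢ A B ] →
             Γ ▷ `Σ A B ⊢ split A B C d ∶ C
    ⊢split {C = C} tC td =
      ⊢≡ (trans (lift-⟨⟩ C) ([wkˢ▸x₀] C))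
         (Σ-elim (sub-type tw tA) (sub-type (⊢lift tw tA) tB) (sub-type (⊢lift tw tΣ) tC)
                 (⊢branch {C = C} tw td) (⊢≡ (sym ([wkˢ] (`Σ A B))) (⊢x₀ tΣ)))
      where tw = ⊢wkˢ tΣ

    split-cong : Γ ▷ `Σ A B ⊢ C ≈ C′ type → Γ ▷ A ▷ B ⊢ d ≈ d′ ∶ C [ pairˢ A B ] →
                 Γ ▷ `Σ A B ⊢ split A B C d ≈ split A B C′ d′ ∶ C
    split-cong {C = C} eC ed =
      ≈≡ (trans (lift-⟨⟩ C) ([wkˢ▸x₀] C))
         (E-cong (type-refl (sub-type tw tA)) (type-refl (sub-type (⊢lift tw tA) tB))
                 (sub-type≈ (⊢lift tw tΣ) eC)
                 (≈≡ (pairˢ-lift C A B) (sub-term≈ (⊢lift (⊢lift tw tA) tB) ed))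
                 (term-refl (⊢≡ (sym ([wkˢ] (`Σ A B))) (⊢x₀ tΣ))))
      where tw = ⊢wkˢ tΣ

    split-pairˢ : Γ ▷ `Σ A B ⊢ C type → Γ ▷ A ▷ B ⊢ d ∶ C [ pairˢ A B ] →
                  Γ ▷ A ▷ B ⊢ split A B C d [ pairˢ A B ] ≈ d ∶ C [ pairˢ A B ]
    split-pairˢ {C = C} {d = d} tC td =
      ≈≡ (trans (lift-⟨⟩ C) (▸-cong C (λ _ → refl) (sym (pair-↑2 B))))
        (≈-≡ (E≡ (sym (sub-sub (λ _ → refl) A))
                 (sym (sub-sub (lift-sub-sub (λ _ → refl) 1) B))
                 (sym (sub-sub (lift-sub-sub (λ _ → refl) 1) C))
                 (sym (sub-sub (lift-sub-sub (λ _ → refl) 2) d))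
                 (sym (pair-↑2 B)))
             -- The computation rule instantiates the weakened branch at the variables `x₁` and
             -- `x₀`, which gives back `d`.
             (trans (sub-sub (λ { zero → refl ; (suc zero) → refl ; (suc (suc i)) → refl }) d) ([var] d))
          (Σ-comp (sub-type ⊢↑2 tA) (sub-type (⊢lift ⊢↑2 tA) tB) (sub-type (⊢lift ⊢↑2 tΣ) tC)
                  (⊢branch {C = C} ⊢↑2 td) ⊢fst ⊢snd))

    -- The motive is `Id (Id D c d) u v`: on pairs the hypothesis makes reflexivity a valid branch,
    -- and `discrete` makes the resulting identity proof a definitional equality.
    Σ-ind : Γ ▷ `Σ A B ⊢ D type → Γ ▷ `Σ A B ⊢ c ∶ D → Γ ▷ `Σ A B ⊢ d ∶ D →
            Γ ▷ `Σ A B ⊢ u ∶ Id D c d → Γ ▷ `Σ A B ⊢ v ∶ Id D c d →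
            Γ ▷ A ▷ B ⊢ u [ pairˢ A B ] ≈ v [ pairˢ A B ] ∶ Id D c d [ pairˢ A B ] →
            Γ ▷ `Σ A B ⊢ u ≈ v ∶ Id D c d
    Σ-ind tD tc td tu tv uv =
      proj₁ (discrete tD tc td tu tv
        (⊢split (Id-form tI tu tv)
          (conv (Id-cong (type-refl tI′) (term-refl (left uv)) uv) (Id-intro tI′ (left uv)))))
      where
      tI = Id-form tD tc td
      tI′ = sub-type ⊢pairˢ tI

-- The left retract biadjoint of weakening.

module _ {𝕊 : Signature} (S : TypeTheory (ML₂+ 𝕊)) (M : AdmitsML₂ {𝕊 = 𝕊} S) where
  open TypeTheory S
  open AdmitsML₂ {𝕊 = 𝕊} M
  open Derived {𝕊 = 𝕊} S M
  open SigmaElimination {𝕊 = 𝕊} S M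
  open Type
  open Map
  open Homotopy

  module _ {Γ : Ctx (ML₂+ 𝕊) n} {A : Ty (ML₂+ 𝕊) n} (tA : Γ ⊢ A type) where
    private
      module K = TwoCategory (𝔗 {𝕊 = 𝕊} S M Γ)
      module L = TwoCategory (𝔗 {𝕊 = 𝕊} S M (Γ ▷ A))
      module L₁ = IsIndexedEquivalence L.isEquivalence₁
      module W = TwoFunctor (Δ[_] {𝕊 = 𝕊} S M tA)

    ΣType : L.Obj → K.Obj
    ΣType X = mkType (Σ-form tA (ok X))

    ΣType-cong : {X X′ : L.Obj} → X L.≈₀ X′ → ΣType X K.≈₀ ΣType X′
    ΣType-cong e = mkType≈ (Σ-cong (type-refl tA) (_≈ᵗ_.eq e))

    module _ (X : L.Obj) where

      pairing : X L.⟶ W.F₀ (ΣType X)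
      pairing = mkMap {tm = pairˢ A (ty X) zero}
        (⊢≡ (trans (wk-pairˢ (`Σ A (ty X))) (cong wk (sym ([wkˢ] (`Σ A (ty X))))))
            (sub-term (⊢pairˢ tA (ok X)) (⊢x₀ (Σ-form tA (ok X)))))

      module _ {Y : K.Obj} where
        private
          ρ : Sub (ML₂+ 𝕊) (suc n) (suc (suc n))
          ρ = pairˢ A (ty X)

          tY = wk-type (ok (ΣType X)) (ok Y)

          wkY[ρ] : wk (ty Y) [ ρ ] ≡ wk (ty Y [ wkˢ ])
          wkY[ρ] = trans (wk-pairˢ (ty Y)) (cong wk (sym ([wkˢ] (ty Y))))

          -- The two successive weakenings fuse into the one inside `ρ`. Applied to `tm` and to `pf`
          -- alike, this turns `precompose` into substitution of a pair.
          ∘-pairing : (e : Tm (ML₂+ 𝕊) (suc n)) → e [ lift wkˢ ] [ wkˢ ▸ ρ zero ] ≡ e [ ρ ]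
          ∘-pairing e = lift-▸ e

          Id[ρ] : (h k : ΣType X K.⟶ Y) →
                  Id (wk (ty Y)) (tm h) (tm k) [ ρ ] ≡
                  Id (wk (ty Y [ wkˢ ])) (tm (W.F₁ h L.∘₁ pairing)) (tm (W.F₁ k L.∘₁ pairing))
          Id[ρ] h k = Id≡ wkY[ρ] (sym (∘-pairing (tm h))) (sym (∘-pairing (tm k)))

          ⊢branch : (g : X L.⟶ W.F₀ Y) → Γ ▷ A ▷ ty X ⊢ tm g ∶ wk (ty Y) [ ρ ]
          ⊢branch g = ⊢≡ (sym wkY[ρ]) (ok g)

        section : X L.⟶ W.F₀ Y → ΣType X K.⟶ Y
        section g = mkMap (⊢split tA (ok X) tY (⊢branch g))

        section-cong : {g g′ : X L.⟶ W.F₀ Y} → g L.≈₁ g′ → section g K.≈₁ section g′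
        section-cong e = mkMap≈ (mkType≈ (type-refl (ok (ΣType X)))) (mkType≈ (type-refl (ok Y)))
          (split-cong tA (ok X) (type-refl tY) (≈≡ (sym wkY[ρ]) (_≈ᵐ_.eq e)))

        section-∘-pairing : (g : X L.⟶ W.F₀ Y) → W.F₁ (section g) L.∘₁ pairing L.≈₁ g
        section-∘-pairing g =
          mkMap≈ (mkType≈ (type-refl (ok X))) (mkType≈ (type-refl (ok (W.F₀ Y))))
            (≈≡ wkY[ρ] (≈-≡ (sym (∘-pairing (tm (section g)))) refl
              (split-pairˢ tA (ok X) tY (⊢branch g))))

        pairing-full : {h k : ΣType X K.⟶ Y}
                       (α : W.F₁ h L.∘₁ pairing L.⇒ W.F₁ k L.∘₁ pairing) →
                       Σ[ β ∈ h K.⇒ k ] W.F₂ β L.▹ pairing L.≈₂ α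
        pairing-full {h} {k} α =
          β , mkHomotopy≈ L₁.refl L₁.refl
            (≈≡ (Id[ρ] h k) (≈-≡ (sym (∘-pairing (pf β))) refl (split-pairˢ tA (ok X) tI tα)))
          where
          tI = Id-form tY (ok h) (ok k)
          -- Up to the rewriting `Id[ρ]`, `α` itself is a branch for the identity motive between `h`
          -- and `k`.
          tα = ⊢≡ (sym (Id[ρ] h k)) (ok α)
          β : h K.⇒ k
          β = mkHomotopy (⊢split tA (ok X) tI tα)

        pairing-faithful : {h k h′ k′ : ΣType X K.⟶ Y} {α : h K.⇒ k} {α′ : h′ K.⇒ k′} →
                           h K.≈₁ h′ → k K.≈₁ k′ →
                           W.F₂ α L.▹ pairing L.≈₂ W.F₂ α′ L.▹ pairing → α K.≈₂ α′
        pairing-faithful {h} {k} {α = α} {α′} eh ek e = mkHomotopy≈ eh ek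
          (Σ-ind tA (ok X) tY (ok h) (ok k) (ok α)
            -- `α′` runs between `h′` and `k′`; it is retyped over `h` and `k` so that `Σ-ind` can
            -- compare it with `α`.
            (conv (type-sym (Id-cong (type-refl tY) (_≈ᵐ_.eq eh) (_≈ᵐ_.eq ek))) (ok α′))
            (≈≡ (sym (Id[ρ] h k)) (≈-≡ (∘-pairing (pf α)) (∘-pairing (pf α′)) (_≈ʰ_.eq e))))

    -- A pair carries its family as an annotation, so equal types `X` and `X′` give pairs that agree
    -- only by the congruence rule.
    pairing-cong : {X X′ : L.Obj} → X L.≈₀ X′ → pairing X L.≈₁ pairing X′
    pairing-cong {X} {X′} e = mkMap≈ e (mkType≈ (sub-type≈ (⊢wkˢ tA) (_≈ᵗ_.eq (ΣType-cong e))))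
      (≈≡ (trans (sym (↑2 (`Σ A (ty X)))) (cong wk (sym ([wkˢ] (`Σ A (ty X))))))
        (pairˢ-cong tA (ok X) (_≈ᵗ_.eq e)))

    leftRetractBiadjoint : LeftRetractBiadjoint (Δ[_] {𝕊 = 𝕊} S M tA)
    leftRetractBiadjoint = record
      { bireflection = λ X → retractBireflection (Δ[_] {𝕊 = 𝕊} S M tA) (pairing X)
          (section X) (section-cong X) (section-∘-pairing X) (pairing-full X) (pairing-faithful X)
      ; F-cong = ΣType-cong
      ; η-cong = pairing-cong
      }

proposition4p4p1 : {𝕊 : Signature} (S : TypeTheory (ML₂+ 𝕊)) (M : AdmitsML₂ S)
    {n : ℕ} (Γ : Ctx (ML₂+ 𝕊) n) → TypeTheory.⊢_ S Γ →
    (A : Ty (ML₂+ 𝕊) n) (tA : TypeTheory._⊢_type S Γ A) →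
    LeftRetractBiadjoint (Δ[_] S M tA)
proposition4p4p1 {𝕊} S M Γ tΓ A tA = leftRetractBiadjoint {𝕊 = 𝕊} S M {Γ = Γ} {A = A} tA
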